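{- For every integer $k \geq 2$ and every $\theta>0$, there exist $c,\gamma \in (0,1)$ such that the following holds for every sufficiently large $N$ and every red/blue coloring of the edges of $K_N$. Either one can recolor at most $\theta N^2$ edges so that the red graph becomes a balanced complete $k$-partite graph, or else the coloring contains one of the following: (i) at least $\gamma N^k$ red copies of $K_k$, each with at least $(\frac ck+\gamma)N$ extensions to a red $K_{k+1}$; or (ii) at least $\gamma N^k$ blue copies of $K_k$, each with at least $(\frac 1k+\gamma)N$ extensions to a blue $K_{k+1}$.
   Context: A red (resp. blue) copy $Q$ of $K_k$ is a set of $k$ vertices all of whose pairs are red (resp. blue) edges. An extension of $Q$ to a red (resp. blue) $K_{k+1}$ is a vertex $u \notin Q$ such that all edges from $u$ to $Q$ are red (resp. blue); the number of extensions is the number of such vertices $u$. A complete $k$-partite graph is balanced if its $k$ parts have sizes differing by at most one. -}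

module Defs where

open import Data.Bool using (Bool; true; false; _∧_; _∨_; not; if_then_else_)
open import Data.Nat using (ℕ; zero; suc; _+_; _≤_; _≡ᵇ_; _<?_)
open import Data.Fin using (Fin; toℕ)
open import Data.Fin.Properties using (_≟_)
open import Data.Vec using (Vec; []; _∷_; lookup)
open import Data.List using (List; []; _∷_; _++_; map; length; filterᵇ)
open import Data.Fin.Subset using (Subset; ∣_∣)
open import Data.Integer using (+_)
open import Data.Rational using (ℚ; _/_; _≤ᵇ_; _*_; 0ℚ)
open import Data.Product using (Σ; ∃; _×_; _,_)
open import Relation.Binary.PropositionalEquality using (_≡_; _≢_)
open import Relation.Nullary.Decidable using (⌊_⌋)

allFin : ∀ {n} → (Fin n → Bool) → Bool
allFin {zero}  f = true
allFin {suc n} f = f Fin.zero ∧ allFin (λ i → f (Fin.suc i))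

countFin : ∀ {n} → (Fin n → Bool) → ℕ
countFin {zero}  f = 0
countFin {suc n} f = (if f Fin.zero then 1 else 0) + countFin (λ i → f (Fin.suc i))

sumFin : ∀ {n} → (Fin n → ℕ) → ℕ
sumFin {zero}  f = 0
sumFin {suc n} f = f Fin.zero + sumFin (λ i → f (Fin.suc i))

_≡ᶠ_ : ∀ {n} → Fin n → Fin n → Bool
i ≡ᶠ j = ⌊ i ≟ j ⌋

_⇒ᵇ_ : Bool → Bool → Bool
a ⇒ᵇ b = not a ∨ b

_==ᵇ_ : Bool → Bool → Bool
true  ==ᵇ b = b
false ==ᵇ b = not b

allSubsets : ∀ n → List (Subset n)
allSubsets zero    = [] ∷ []
allSubsets (suc n) = map (true ∷_) (allSubsets n) ++ map (false ∷_) (allSubsets n)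

ℕtoℚ : ℕ → ℚ
ℕtoℚ n = + n / 1

-- q / k for a natural k (only used for k ≥ 2)
_/ℕ_ : ℚ → ℕ → ℚ
q /ℕ zero  = 0ℚ
q /ℕ suc k = q * (+ 1 / suc k)

-- Red/blue colourings of the edges of K_N.
-- A colouring is χ : Fin N → Fin N → Bool, with true = red, false = blue,
-- required to be symmetric on distinct pairs; the diagonal is irrelevant.

Colouring : ℕ → Set
Colouring N = Fin N → Fin N → Bool

red blue : Bool
red  = true
blue = false

Symmetric : ∀ {N} → Colouring N → Set
Symmetric {N} χ = (i j : Fin N) → i ≢ j → χ i j ≡ χ j i

isMonoClique : ∀ {N} → Colouring N → Bool → ℕ → Subset N → Bool
isMonoClique χ b k Q =
  (∣ Q ∣ ≡ᵇ k) ∧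
  allFin (λ i → allFin (λ j →
    (lookup Q i ∧ lookup Q j ∧ not (i ≡ᶠ j)) ⇒ᵇ (χ i j ==ᵇ b)))

extensions : ∀ {N} → Colouring N → Bool → Subset N → ℕ
extensions χ b Q =
  countFin (λ u → not (lookup Q u) ∧ allFin (λ v → lookup Q v ⇒ᵇ (χ u v ==ᵇ b)))

numRichCliques : ∀ {N} → Colouring N → Bool → ℕ → ℚ → ℕ
numRichCliques {N} χ b k t =
  length (filterᵇ (λ Q → isMonoClique χ b k Q ∧ (t ≤ᵇ ℕtoℚ (extensions χ b Q)))
                  (allSubsets N))

numDiffEdges : ∀ {N} → Colouring N → Colouring N → ℕ
numDiffEdges χ χ' =
  sumFin (λ i → countFin (λ j →
    ⌊ toℕ i <? toℕ j ⌋ ∧ not (χ i j ==ᵇ χ' i j)))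

partSize : ∀ {N k} → (Fin N → Fin k) → Fin k → ℕ
partSize p a = countFin (λ v → p v ≡ᶠ a)

RedBalancedCompletePartite : ∀ {N} → ℕ → Colouring N → Set
RedBalancedCompletePartite {N} k χ =
  Σ (Fin N → Fin k) λ p →
    ((a b : Fin k) → partSize p a ≤ partSize p b + 1) ×
    ((i j : Fin N) → i ≢ j → χ i j ≡ not (p i ≡ᶠ p j))

{-# OPTIONS --safe #-}

-- If there are few red K_{k+1} and almost no blue K_k is in a large book, the red graph is nearly a Turán graph.
-- A nearly blue vertex set A satisfies Σ_z (blue density from z to A)^k ≤ (1/k + ε) N, because a random k-tuple of A is almost surely a
-- blue clique and not a rich one.  Hence at most about N / k vertices z are "deficient" for A, i.e. have negligible red density to A.
-- Energy increment makes A stable: restricting to a large subset A′ ⊆ A (such as a red neighbourhood) destroys the red density of few z,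
-- so that red cliques among the non-deficient vertices extend greedily into A.  Choose stable nearly blue sets A_1, ..., A_k, each
-- avoiding the deficient sets of the earlier ones.  Since red K_{k+1} are rare, almost no vertex avoids all k deficient sets, and there
-- are few red edges among the vertices avoiding all but the i-th.  These k sets have size about N / k and are nearly blue, and
-- the inequality above, whose sum is already exhausted by the z inside such a set, leaves almost no blue edge between different ones.
module Submission where

open import Defs
open import Data.Bool using (Bool; true; false; _∧_; not; if_then_else_) renaming (T to IsTrue)
open import Data.Bool.Properties using (_≟_; ∧-assoc; ∧-comm)
open import Data.Empty using (⊥-elim)
open import Data.Fin using (Fin; toℕ; fromℕ<)
open import Data.Fin.Properties using (any?) renaming (_≟_ to _≟F_)
open import Data.Fin.Subset using (Subset; ∣_∣) renaming (⊥ to ∅)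
open import Data.Fin.Subset.Properties using (anySubset?)
import Data.Integer as ℤ
open import Data.Integer using (-[1+_]; +[1+_]) renaming (+_ to ⁺_)
import Data.Integer.Properties as ℤ
open import Data.List using (List; []; _∷_; map; length; filterᵇ)
open import Data.List.Membership.Propositional using () renaming (_∈_ to _∈ₗ_)
open import Data.List.Membership.Propositional.Properties using (∈-map⁺; ∈-++⁺ˡ; ∈-++⁺ʳ)
open import Data.List.Relation.Unary.Any using (here; there)
open import Data.Nat using (ℕ; zero; suc; _+_; _∸_; _*_; _^_; _≤_; _<_; _≥_; z≤n; s≤s; _≡ᵇ_; _≤?_; _<?_; NonZero; >-nonZero)
open import Data.Nat.DivMod using (_/_; _%_; m≡m%n+[m/n]*n; m%n<n)
open import Data.Nat.Properties hiding (_≟_)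
open import Data.Nat.Tactic.RingSolver using (solve-∀)
open import Data.Product using (Σ; ∃; _×_; _,_; proj₁; proj₂)
import Data.Rational as ℚ
open import Data.Rational using (ℚ; mkℚ; 0ℚ; 1ℚ; _≤ᵇ_; toℚᵘ)
import Data.Rational.Properties as ℚ
open import Data.Rational.Solver using (module +-*-Solver)
import Data.Rational.Unnormalised as ℚᵘ
import Data.Rational.Unnormalised.Properties as ℚᵘ
open import Data.Sum using (_⊎_; inj₁; inj₂)
open import Data.Vec using (Vec; []; _∷_; lookup; tabulate; _[_]≔_)
open import Data.Vec.Properties using (lookup∘tabulate; lookup∘update; lookup∘update′; lookup-replicate)
open import Function using (_∘_)
open import Relation.Binary.PropositionalEquality using (_≡_; _≢_; refl; sym; trans; cong; cong₂; subst; module ≡-Reasoning)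
open import Relation.Nullary using (¬_; Dec; yes; no)
open import Relation.Nullary.Decidable using (⌊_⌋; _×-dec_)
open import Algebra.Properties.CommutativeMonoid.Sum +-0-commutativeMonoid using (sum; sum-cong-≗; ∑-distrib-+; ∑-comm)
open import Algebra.Properties.Semiring.Sum +-*-semiring using (*-distribˡ-sum; *-distribʳ-sum)

-- The obstacle is that red neighbours in A of every vertex of a red clique need not include a
-- common one. Stability answers this: the common neighbourhood built so far is itself a large
-- subset of A, so most further vertices keep their density to it. Each blob then costs one clique
-- size: if red K_{r+1} are rare in `U`, red K_r are rare after the deficient set is removed. From
-- K_{k+1}, k blobs lead to K_1 rare in `U`, so `U` is small, and K_2 rare in each part. Failure of
-- (i) makes red K_{k+1} rare because c is taken equal to γ: a poor red K_k then has at most 2γN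
-- extensions. Failure of (ii) enters with accuracy S: a deficient set has at most (1/k + 2/S) N
-- vertices. Estimates live in ℕ with denominators cleared: `N ≤ m * # A` stands for density at
-- least 1/m, `e * x ≤ y` for smallness 1/e, and cliques are counted as ordered tuples. The
-- constants are fixed in the order h ≥ 1/θ, S, e, those of the blobs, and finally 1/γ.

VSet : ℕ → Set
VSet N = Fin N → Bool

infix 4 _⊆_
infixr 7 _∩_
infixl 6 _∖_

_⊆_ : ∀ {N} → VSet N → VSet N → Set
A ⊆ B = ∀ x → A x ≡ true → B x ≡ true

_∩_ _∖_ : ∀ {N} → VSet N → VSet N → VSet N
(A ∩ B) x = A x ∧ B x
(A ∖ B) x = A x ∧ not (B x)

⟦_⟧ : Bool → ℕ
⟦ b ⟧ = if b then 1 else 0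

# : ∀ {N} → VSet N → ℕ
# A = sum (λ x → ⟦ A x ⟧)

-- Booleans, indicators and arithmetic

∧-true : ∀ {a b} → a ∧ b ≡ true → a ≡ true × b ≡ true
∧-true {true} {true} _ = refl , refl

∧-intro : ∀ {a b} → a ≡ true → b ≡ true → a ∧ b ≡ true
∧-intro refl refl = refl

∧-swapʳ : ∀ a b c → (a ∧ b) ∧ c ≡ (a ∧ c) ∧ b
∧-swapʳ a b c = trans (∧-assoc a b c) (trans (cong (a ∧_) (∧-comm b c)) (sym (∧-assoc a c b)))

not-true : ∀ {b} → not b ≡ true → b ≡ false
not-true {false} _ = refl

⟦⟧≤1 : ∀ b → ⟦ b ⟧ ≤ 1
⟦⟧≤1 false = z≤n
⟦⟧≤1 true  = ≤-refl

⟦∧⟧ : ∀ a b → ⟦ a ∧ b ⟧ ≡ ⟦ a ⟧ * ⟦ b ⟧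
⟦∧⟧ false b = refl
⟦∧⟧ true  b = sym (+-identityʳ ⟦ b ⟧)

⟦⟧-mono : ∀ {a b} → (a ≡ true → b ≡ true) → ⟦ a ⟧ ≤ ⟦ b ⟧
⟦⟧-mono {false} h = z≤n
⟦⟧-mono {true}  h rewrite h refl = ≤-refl

⟦⟧-split : ∀ a b → ⟦ a ⟧ ≡ ⟦ a ∧ b ⟧ + ⟦ a ∧ not b ⟧
⟦⟧-split false b     = refl
⟦⟧-split true  false = refl
⟦⟧-split true  true  = refl

⟦⟧*-mono : ∀ b {x y} → (b ≡ true → x ≤ y) → ⟦ b ⟧ * x ≤ ⟦ b ⟧ * y
⟦⟧*-mono false h = z≤n
⟦⟧*-mono true  h = *-monoʳ-≤ 1 (h refl)

⟦⟧*≤ : ∀ b {x y} → (b ≡ true → x ≤ y) → ⟦ b ⟧ * x ≤ y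
⟦⟧*≤ false h = z≤n
⟦⟧*≤ true {x} h = ≤-trans (≤-reflexive (*-identityˡ x)) (h refl)

-- Adding the hypothesis a ≤ b to a goal x ≤ y: what is left is a semiring identity when the slack is made explicit.
≤-by : ∀ {a b x y} → a ≤ b → x + b ≤ y + a → x ≤ y
≤-by {a} {b} {x} {y} p q = +-cancelʳ-≤ b x y (≤-trans q (+-monoʳ-≤ y p))

0<m*n⇒0<m : ∀ m n → 0 < m * n → 0 < m
0<m*n⇒0<m (suc m) n _ = s≤s z≤n

0<m*n⇒0<n : ∀ m n → 0 < m * n → 0 < n
0<m*n⇒0<n m n p = 0<m*n⇒0<m n m (subst (0 <_) (*-comm m n) p)

*-cancelˡ-≤′ : ∀ m {a b} → 0 < m → m * a ≤ m * b → a ≤ b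
*-cancelˡ-≤′ m p = *-cancelˡ-≤ m {{>-nonZero p}}

0<^ : ∀ {n} r → 0 < n → 0 < n ^ r
0<^ {n} r p = m^n>0 n {{>-nonZero p}} r

0<* : ∀ {m n} → 0 < m → 0 < n → 0 < m * n
0<* = *-mono-≤

-- Finite sums

sum-mono : ∀ {n} {f g : Fin n → ℕ} → (∀ i → f i ≤ g i) → sum f ≤ sum g
sum-mono {zero}  h = z≤n
sum-mono {suc n} h = +-mono-≤ (h Fin.zero) (sum-mono (λ i → h (Fin.suc i)))

sum-const : ∀ n c → sum {n} (λ _ → c) ≡ n * c
sum-const zero    c = refl
sum-const (suc n) c = cong (c +_) (sum-const n c)

sum-bound : ∀ {n} {f : Fin n → ℕ} c → (∀ i → f i ≤ c) → sum f ≤ n * c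
sum-bound {n} c h = ≤-trans (sum-mono h) (≤-reflexive (sum-const n c))

sum-*ˡ : ∀ {n} c (f : Fin n → ℕ) → sum (λ i → c * f i) ≡ c * sum f
sum-*ˡ c f = sym (*-distribˡ-sum c f)

sum-*ʳ : ∀ {n} c (f : Fin n → ℕ) → sum (λ i → f i * c) ≡ sum f * c
sum-*ʳ c f = sym (*-distribʳ-sum c f)

sum-pigeon : ∀ {n} (f g : Fin n → ℕ) → sum g < sum f → Σ (Fin n) λ i → g i < f i
sum-pigeon {suc n} f g p with g Fin.zero <? f Fin.zero
... | yes q = Fin.zero , q
... | no ¬q with sum-pigeon (f ∘ Fin.suc) (g ∘ Fin.suc) (+-cancelˡ-< (g Fin.zero) _ _ (≤-trans p (+-monoˡ-≤ _ (≮⇒≥ ¬q))))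
... | i , r = Fin.suc i , r

#-mono : ∀ {N} {A B : VSet N} → A ⊆ B → # A ≤ # B
#-mono h = sum-mono (λ x → ⟦⟧-mono (h x))

#-cong : ∀ {N} {A B : VSet N} → (∀ x → A x ≡ B x) → # A ≡ # B
#-cong h = sum-cong-≗ (λ x → cong ⟦_⟧ (h x))

#≤N : ∀ {N} (A : VSet N) → # A ≤ N
#≤N {N} A = ≤-trans (sum-bound 1 (λ x → ⟦⟧≤1 (A x))) (≤-reflexive (*-identityʳ N))

#-split : ∀ {N} (A B : VSet N) → # A ≡ # (A ∩ B) + # (A ∖ B)
#-split A B = trans (sum-cong-≗ (λ x → ⟦⟧-split (A x) (B x))) (∑-distrib-+ (λ x → ⟦ (A ∩ B) x ⟧) (λ x → ⟦ (A ∖ B) x ⟧))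

-- Red cliques

module _ {N : ℕ} (R : Fin N → Fin N → Bool) where

  clq : ℕ → VSet N → ℕ
  clq zero    X = 1
  clq (suc r) X = sum (λ x → ⟦ X x ⟧ * clq r (X ∩ R x))

  deg : VSet N → Fin N → ℕ
  deg A z = # (A ∩ R z)

  clq-mono : ∀ r {X Y} → X ⊆ Y → clq r X ≤ clq r Y
  clq-mono zero    h = ≤-refl
  clq-mono (suc r) {X} {Y} h = sum-mono (λ x → *-mono-≤ (⟦⟧-mono (h x)) (clq-mono r (λ y p → ∧-intro (h y (proj₁ (∧-true p))) (proj₂ (∧-true {X y} p)))))

  clq-bound : ∀ r X → clq r X ≤ N ^ r
  clq-bound zero    X = ≤-refl
  clq-bound (suc r) X = sum-bound (N ^ r) (λ x → ⟦⟧*≤ (X x) (λ _ → clq-bound r _))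

  clq-1 : ∀ X → clq 1 X ≡ # X
  clq-1 X = sum-cong-≗ (λ x → *-identityʳ ⟦ X x ⟧)

  clq-2 : ∀ X → clq 2 X ≡ sum (λ x → ⟦ X x ⟧ * deg X x)
  clq-2 X = sum-cong-≗ (λ x → cong (⟦ X x ⟧ *_) (clq-1 (X ∩ R x)))

⟦⟧-< : ∀ b α β γ {d c} → α * ⟦ b ⟧ + β * (⟦ b ⟧ * c) < γ * (⟦ b ⟧ * d) → b ≡ true × α + β * c < γ * d
⟦⟧-< false α β γ q = ⊥-elim (n≮0 (≤-trans q (≤-reflexive (*-zeroʳ γ))))
⟦⟧-< true α β γ {d} {c} q = refl , (begin-strict
  α + β * c ≡⟨ cong₂ _+_ (*-identityʳ α) (cong (β *_) (*-identityˡ c)) ⟨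
  α * 1 + β * (1 * c) <⟨ q ⟩
  γ * (1 * d) ≡⟨ cong (γ *_) (*-identityˡ d) ⟩
  γ * d ∎)
  where open ≤-Reasoning

-- Either X itself is sparse, or some vertex of X has a large red neighbourhood in X with few red K_r.
sparse-subset : ∀ r b m → Σ ℕ λ m′ → Σ ℕ λ e → ∀ {N} (R : Fin N → Fin N → Bool) X → 0 < N →
  N ≤ m * # X → e * clq R r X ≤ N ^ r → Σ (VSet N) λ A → A ⊆ X × N ≤ m′ * # A × b * clq R 2 A ≤ # A * # A
-- `clq R 0 X` and `N ^ 0` are both 1, so `e = 2` makes the rarity hypothesis absurd.
sparse-subset zero b m = 0 , 2 , λ R X _ _ p → ⊥-elim (1+n≰n p)
sparse-subset (suc r) b m with sparse-subset r b (2 * b * m)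
... | m′ , e , rec = m + m′ , 2 * b * e * m , go
  where
  go : ∀ {N} (R : Fin N → Fin N → Bool) X → 0 < N → N ≤ m * # X → 2 * b * e * m * clq R (suc r) X ≤ N ^ suc r →
       Σ (VSet N) λ A → A ⊆ X × N ≤ (m + m′) * # A × b * clq R 2 A ≤ # A * # A
  go {N} R X N>0 large few with b * clq R 2 X ≤? # X * # X
  ... | yes p = X , (λ _ q → q) , ≤-trans large (*-monoˡ-≤ (# X) (m≤m+n m m′)) , p
  ... | no ¬p = A , go-⊆ , ≤-trans largeA (*-monoˡ-≤ (# A) (m≤n+m m′ m)) , sparseA
    where
    n = # X
    -- One averaging argument with two conclusions: `g y < f y` forces y into X, and each summand of
    -- `g y` alone is then below `f y`. The first bounds the red degree of y in X from below, the
    -- second the number of red K_r in that neighbourhood from above.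
    f g : Fin N → ℕ
    f y = m * N ^ r * (2 * b) * (⟦ X y ⟧ * deg R X y)
    g y = m * n * N ^ r * ⟦ X y ⟧ + 2 * b * e * m * n * (⟦ X y ⟧ * clq R r (X ∩ R y))
    m>0 : 0 < m
    m>0 = 0<m*n⇒0<m m n (≤-trans N>0 large)
    sum-f : sum f ≡ m * N ^ r * (2 * b) * clq R 2 X
    sum-f = trans (sum-*ˡ (m * N ^ r * (2 * b)) (λ y → ⟦ X y ⟧ * deg R X y)) (cong (m * N ^ r * (2 * b) *_) (sym (clq-2 R X)))
    sum-g : sum g ≡ m * n * N ^ r * n + 2 * b * e * m * n * clq R (suc r) X
    sum-g = trans (∑-distrib-+ (λ y → m * n * N ^ r * ⟦ X y ⟧) (λ y → 2 * b * e * m * n * (⟦ X y ⟧ * clq R r (X ∩ R y))))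
      (cong₂ _+_ (sum-*ˡ (m * n * N ^ r) (λ y → ⟦ X y ⟧)) (sum-*ˡ (2 * b * e * m * n) (λ y → ⟦ X y ⟧ * clq R r (X ∩ R y))))
    g<f : sum g < sum f
    g<f = begin-strict
      sum g ≡⟨ sum-g ⟩
      m * n * N ^ r * n + 2 * b * e * m * n * clq R (suc r) X ≡⟨ e₁ m n (N ^ r) (2 * b * e) (clq R (suc r) X) ⟩
      m * n * N ^ r * n + 2 * b * e * m * clq R (suc r) X * n ≤⟨ +-monoʳ-≤ _ (*-monoˡ-≤ n (≤-trans few (*-monoˡ-≤ (N ^ r) large))) ⟩
      m * n * N ^ r * n + m * n * N ^ r * n ≡⟨ e₂ m n (N ^ r) ⟩
      m * N ^ r * 2 * (n * n) <⟨ *-monoʳ-< (m * N ^ r * 2) {{>-nonZero (0<* (0<* m>0 (0<^ r N>0)) (s≤s z≤n))}} (≰⇒> ¬p) ⟩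
      m * N ^ r * 2 * (b * clq R 2 X) ≡⟨ e₃ m (N ^ r) b (clq R 2 X) ⟩
      m * N ^ r * (2 * b) * clq R 2 X ≡⟨ sym sum-f ⟩
      sum f ∎
      where
      open ≤-Reasoning
      e₁ : ∀ m n k c q → m * n * k * n + c * m * n * q ≡ m * n * k * n + c * m * q * n
      e₁ = solve-∀
      e₂ : ∀ m n k → m * n * k * n + m * n * k * n ≡ m * k * 2 * (n * n)
      e₂ = solve-∀
      e₃ : ∀ m k b q → m * k * 2 * (b * q) ≡ m * k * (2 * b) * q
      e₃ = solve-∀
    y = proj₁ (sum-pigeon f g g<f)
    A₀ : VSet N
    A₀ = X ∩ R y
    q : g y < f y
    q = proj₂ (sum-pigeon f g g<f)
    c = clq R r A₀
    q′ : m * n * N ^ r + 2 * b * e * m * n * c < m * N ^ r * (2 * b) * # A₀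
    q′ = proj₂ (⟦⟧-< (X y) (m * n * N ^ r) (2 * b * e * m * n) (m * N ^ r * (2 * b)) {deg R X y} {clq R r (X ∩ R y)} q)
    d-large : n ≤ 2 * b * # A₀
    d-large = <⇒≤ (*-cancelˡ-< (m * N ^ r) n (2 * b * # A₀) (begin-strict
      m * N ^ r * n ≡⟨ e₁ m (N ^ r) n ⟩
      m * n * N ^ r ≤⟨ m≤m+n _ _ ⟩
      m * n * N ^ r + 2 * b * e * m * n * c <⟨ q′ ⟩
      m * N ^ r * (2 * b) * # A₀ ≡⟨ *-assoc (m * N ^ r) (2 * b) (# A₀) ⟩
      m * N ^ r * (2 * b * # A₀) ∎))
      where
      open ≤-Reasoning
      e₁ : ∀ m k n → m * k * n ≡ m * n * k
      e₁ = solve-∀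
    c-few : e * c ≤ N ^ r
    c-few = <⇒≤ (*-cancelˡ-< (2 * b * m * n) (e * c) (N ^ r) (begin-strict
      2 * b * m * n * (e * c) ≡⟨ e₁ (2 * b) m n e c ⟩
      2 * b * e * m * n * c ≤⟨ m≤n+m _ _ ⟩
      m * n * N ^ r + 2 * b * e * m * n * c <⟨ q′ ⟩
      m * N ^ r * (2 * b) * # A₀ ≤⟨ *-monoʳ-≤ (m * N ^ r * (2 * b)) (#-mono {A = A₀} {X} (λ x p → proj₁ (∧-true p))) ⟩
      m * N ^ r * (2 * b) * n ≡⟨ e₂ (2 * b) m n (N ^ r) ⟩
      2 * b * m * n * N ^ r ∎))
      where
      open ≤-Reasoning
      e₁ : ∀ b m n e c → b * m * n * (e * c) ≡ b * e * m * n * c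
      e₁ = solve-∀
      e₂ : ∀ b m n k → m * k * b * n ≡ b * m * n * k
      e₂ = solve-∀
    sub = rec R A₀ N>0 (≤-trans large (≤-trans (*-monoʳ-≤ m d-large) (≤-reflexive (e₁ m (2 * b) (# A₀))))) c-few
      where
      e₁ : ∀ m b d → m * (b * d) ≡ b * m * d
      e₁ = solve-∀
    A : VSet N
    A = proj₁ sub
    A⊆A₀ = proj₁ (proj₂ sub)
    largeA = proj₁ (proj₂ (proj₂ sub))
    sparseA = proj₂ (proj₂ (proj₂ sub))
    go-⊆ : A ⊆ X
    go-⊆ x p = proj₁ (∧-true (A⊆A₀ x p))

⌊⌋-true : ∀ {P : Set} (d : Dec P) → ⌊ d ⌋ ≡ true → P
⌊⌋-true (yes p) _ = p

⌊⌋-intro : ∀ {P : Set} (d : Dec P) → P → ⌊ d ⌋ ≡ true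
⌊⌋-intro (yes _) _ = refl
⌊⌋-intro (no ¬p) p = ⊥-elim (¬p p)

⌊⌋-false : ∀ {P : Set} (d : Dec P) → ⌊ d ⌋ ≡ false → ¬ P
⌊⌋-false (no ¬p) _ = ¬p

-- Stable blobs

2xy≤x²+y² : ∀ x y → 2 * (x * y) ≤ x * x + y * y
2xy≤x²+y² x y with ≤-total x y
... | inj₁ p with m≤n⇒∃[o]m+o≡n p
... | v , refl = ≤-trans (m≤m+n _ (v * v)) (≤-reflexive (e₁ x v))
  where
  e₁ : ∀ x v → 2 * (x * (x + v)) + v * v ≡ x * x + (x + v) * (x + v)
  e₁ = solve-∀
2xy≤x²+y² x y | inj₂ p with m≤n⇒∃[o]m+o≡n p
... | v , refl = ≤-trans (m≤m+n _ (v * v)) (≤-reflexive (e₁ y v))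
  where
  e₁ : ∀ y v → 2 * ((y + v) * y) + v * v ≡ (y + v) * (y + v) + y * y
  e₁ = solve-∀

-- This is (y - x)² ≥ w² without subtraction; w is the surplus that a dropping vertex adds to
-- `2xy≤x²+y²`.
gap-square : ∀ w x y → w + x ≤ y → w * w + 2 * (x * y) ≤ x * x + y * y
gap-square w x y p with m≤n⇒∃[o]m+o≡n p
... | v , refl = ≤-trans (m≤m+n _ (2 * (w * v) + v * v)) (≤-reflexive (e₁ w x v))
  where
  e₁ : ∀ w x v → w * w + 2 * (x * (w + x + v)) + (2 * (w * v) + v * v) ≡ x * x + (w + x + v) * (w + x + v)
  e₁ = solve-∀

module _ {N : ℕ} (R : Fin N → Fin N → Bool) (t : ℕ) where

  -- z has density at least 1/t to A but less than 1/(2t) to A′.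
  drops : VSet N → VSet N → VSet N
  drops A A′ z = ⌊ # A ≤? t * deg R A z ⌋ ∧ ⌊ 2 * t * deg R A′ z <? # A′ ⌋

  Stable : ℕ → ℕ → VSet N → Set
  Stable M D A = ∀ A′ → A′ ⊆ A → # A ≤ M * # A′ → D * # (drops A A′) ≤ N

  energy : VSet N → ℕ
  energy A = sum (λ z → deg R A z * deg R A z)

  deg≤# : ∀ A z → deg R A z ≤ # A
  deg≤# A z = #-mono {A = A ∩ R z} {A} (λ x p → proj₁ (∧-true p))

  deg-cong : ∀ {A B} → (∀ x → A x ≡ B x) → ∀ z → deg R A z ≡ deg R B z
  deg-cong h z = #-cong (λ x → cong (_∧ R z x) (h x))

  drops-cong : ∀ A {B C} → (∀ x → B x ≡ C x) → ∀ z → drops A B z ≡ drops A C z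
  drops-cong A h z = cong₂ (λ d s → ⌊ # A ≤? t * deg R A z ⌋ ∧ ⌊ 2 * t * d <? s ⌋) (deg-cong h z) (#-cong h)

  deg-split : ∀ A B z → deg R A z ≡ deg R (A ∩ B) z + deg R (A ∖ B) z
  deg-split A B z = trans (#-split (A ∩ R z) B) (cong₂ _+_ (#-cong (λ x → ∧-swapʳ (A x) (R z x) (B x))) (#-cong (λ x → ∧-swapʳ (A x) (R z x) (not (B x)))))

  -- The parallelogram identity behind the energy increment, with a₂d₁ and a₁d₂ moved so that no subtraction occurs.
  drop-gap : ∀ a₁ a₂ d₁ d₂ b → (b ≡ true → a₁ + a₂ ≤ t * (d₁ + d₂) × 2 * t * d₁ < a₁) →
    4 * (t * t) * (a₁ * a₂) * ((d₁ + d₂) * (d₁ + d₂)) + (a₁ + a₂) * (a₁ + a₂) * (a₁ * a₁) * ⟦ b ⟧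
    ≤ 4 * (t * t) * (a₁ + a₂) * (a₂ * (d₁ * d₁) + a₁ * (d₂ * d₂))
  drop-gap a₁ a₂ d₁ d₂ false h = ≤-by (*-monoʳ-≤ (4 * (t * t)) (2xy≤x²+y² (a₂ * d₁) (a₁ * d₂))) (≤-reflexive (e₁ t a₁ a₂ d₁ d₂))
    where
    e₁ : ∀ t a₁ a₂ d₁ d₂ →
      4 * (t * t) * (a₁ * a₂) * ((d₁ + d₂) * (d₁ + d₂)) + (a₁ + a₂) * (a₁ + a₂) * (a₁ * a₁) * 0
      + 4 * (t * t) * (a₂ * d₁ * (a₂ * d₁) + a₁ * d₂ * (a₁ * d₂))
      ≡ 4 * (t * t) * (a₁ + a₂) * (a₂ * (d₁ * d₁) + a₁ * (d₂ * d₂)) + 4 * (t * t) * (2 * (a₂ * d₁ * (a₁ * d₂)))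
    e₁ = solve-∀
  drop-gap a₁ a₂ d₁ d₂ true h = ≤-by (gap-square ((a₁ + a₂) * a₁) (2 * t * (a₂ * d₁)) (2 * t * (a₁ * d₂)) gap) (≤-reflexive (e₁ t a₁ a₂ d₁ d₂))
    where
    p : a₁ + a₂ ≤ t * (d₁ + d₂)
    p = proj₁ (h refl)
    q : 2 * t * d₁ ≤ a₁
    q = <⇒≤ (proj₂ (h refl))
    e₂ : ∀ t a₁ a₂ d₁ d₂ → (a₁ + a₂) * a₁ + 2 * t * (a₂ * d₁) + (2 * a₁ * (t * (d₁ + d₂)) + (a₁ + a₂) * a₁) ≡ 2 * t * (a₁ * d₂) + (2 * a₁ * (a₁ + a₂) + (a₁ + a₂) * (2 * t * d₁))
    e₂ = solve-∀
    gap : (a₁ + a₂) * a₁ + 2 * t * (a₂ * d₁) ≤ 2 * t * (a₁ * d₂)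
    gap = ≤-by (+-mono-≤ (*-monoʳ-≤ (2 * a₁) p) (*-monoʳ-≤ (a₁ + a₂) q)) (≤-reflexive (e₂ t a₁ a₂ d₁ d₂))
    e₁ : ∀ t a₁ a₂ d₁ d₂ →
      4 * (t * t) * (a₁ * a₂) * ((d₁ + d₂) * (d₁ + d₂)) + (a₁ + a₂) * (a₁ + a₂) * (a₁ * a₁) * 1
      + (2 * t * (a₂ * d₁) * (2 * t * (a₂ * d₁)) + 2 * t * (a₁ * d₂) * (2 * t * (a₁ * d₂)))
      ≡ 4 * (t * t) * (a₁ + a₂) * (a₂ * (d₁ * d₁) + a₁ * (d₂ * d₂))
      + ((a₁ + a₂) * a₁ * ((a₁ + a₂) * a₁) + 2 * (2 * t * (a₂ * d₁) * (2 * t * (a₁ * d₂))))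
    e₁ = solve-∀

  -- Write ε for energy / #². Division by 4t² (# A)² # A₁ # A₂ shows the meaning: the mean of ε(A₁)
  -- and ε(A₂), weighted by size, exceeds ε(A) by at least (# A₁ / # A₂) · # (drops A A₁) / (4t²).
  energy-gap : ∀ A A′ → let A₁ = A ∩ A′ ; A₂ = A ∖ A′ in
    4 * (t * t) * (# A₁ * # A₂) * energy A + # A * # A * (# A₁ * # A₁) * # (drops A A₁)
    ≤ 4 * (t * t) * # A * (# A₂ * energy A₁ + # A₁ * energy A₂)
  energy-gap A A′ = begin
    c * energy A + w * # B ≡⟨ cong₂ _+_ (sum-*ˡ c (λ z → deg R A z * deg R A z)) (sum-*ˡ w (λ z → ⟦ B z ⟧)) ⟨
    sum (λ z → c * (deg R A z * deg R A z)) + sum (λ z → w * ⟦ B z ⟧) ≡⟨ ∑-distrib-+ (λ z → c * (deg R A z * deg R A z)) (λ z → w * ⟦ B z ⟧) ⟨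
    sum (λ z → c * (deg R A z * deg R A z) + w * ⟦ B z ⟧) ≤⟨ sum-mono pointwise ⟩
    sum (λ z → v * (# A₂ * (deg R A₁ z * deg R A₁ z) + # A₁ * (deg R A₂ z * deg R A₂ z))) ≡⟨ sum-*ˡ v (λ z → # A₂ * (deg R A₁ z * deg R A₁ z) + # A₁ * (deg R A₂ z * deg R A₂ z)) ⟩
    v * sum (λ z → # A₂ * (deg R A₁ z * deg R A₁ z) + # A₁ * (deg R A₂ z * deg R A₂ z)) ≡⟨ cong (v *_) (trans (∑-distrib-+ (λ z → # A₂ * (deg R A₁ z * deg R A₁ z)) (λ z → # A₁ * (deg R A₂ z * deg R A₂ z))) (cong₂ _+_ (sum-*ˡ (# A₂) (λ z → deg R A₁ z * deg R A₁ z)) (sum-*ˡ (# A₁) (λ z → deg R A₂ z * deg R A₂ z)))) ⟩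
    v * (# A₂ * energy A₁ + # A₁ * energy A₂) ∎
    where
    open ≤-Reasoning
    A₁ = A ∩ A′
    A₂ = A ∖ A′
    B = drops A A₁
    c = 4 * (t * t) * (# A₁ * # A₂)
    w = # A * # A * (# A₁ * # A₁)
    v = 4 * (t * t) * # A
    pointwise : ∀ z → c * (deg R A z * deg R A z) + w * ⟦ B z ⟧ ≤ v * (# A₂ * (deg R A₁ z * deg R A₁ z) + # A₁ * (deg R A₂ z * deg R A₂ z))
    pointwise z = subst₂′ (#-split A A′) (deg-split A A′ z) (drop-gap (# A₁) (# A₂) (deg R A₁ z) (deg R A₂ z) (B z) cond)
      where
      a₁ = # A₁
      a₂ = # A₂
      d₁ = deg R A₁ z
      d₂ = deg R A₂ z
      subst₂′ : ∀ {a d} → a ≡ a₁ + a₂ → d ≡ d₁ + d₂ →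
        4 * (t * t) * (a₁ * a₂) * ((d₁ + d₂) * (d₁ + d₂)) + (a₁ + a₂) * (a₁ + a₂) * (a₁ * a₁) * ⟦ B z ⟧
        ≤ 4 * (t * t) * (a₁ + a₂) * (a₂ * (d₁ * d₁) + a₁ * (d₂ * d₂)) →
        4 * (t * t) * (a₁ * a₂) * (d * d) + a * a * (a₁ * a₁) * ⟦ B z ⟧ ≤ 4 * (t * t) * a * (a₂ * (d₁ * d₁) + a₁ * (d₂ * d₂))
      subst₂′ refl refl p = p
      cond : B z ≡ true → a₁ + a₂ ≤ t * (d₁ + d₂) × 2 * t * d₁ < a₁
      cond p = subst₃ (#-split A A′) (deg-split A A′ z) (⌊⌋-true (# A ≤? t * deg R A z) (proj₁ (∧-true p))) ,
               ⌊⌋-true (2 * t * deg R A₁ z <? # A₁) (proj₂ (∧-true {⌊ # A ≤? t * deg R A z ⌋} p))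
        where
        subst₃ : ∀ {a d} → a ≡ a₁ + a₂ → d ≡ d₁ + d₂ → a ≤ t * d → a₁ + a₂ ≤ t * (d₁ + d₂)
        subst₃ refl refl p = p

  module _ (M D : ℕ) where

    -- The number of levels into which the normalised energy Σ (deg / #)² / N ∈ [0, 1] is discretised.
    Λ : ℕ
    Λ = 4 * (t * t) * D * M

    Level : ℕ → VSet N → Set
    Level m A = m * (# A * # A) * N ≤ Λ * energy A

    Unstable : VSet N → VSet N → Set
    Unstable A A′ = # A ≤ M * # (A ∩ A′) × N < D * # (drops A (A ∩ A′))

    -- Exhaustive search over `Subset N` decides the question. A subset A′ of A that is given as a
    -- function is met as `A ∩ lookup (tabulate A′)`, which agrees with it pointwise.
    stable? : ∀ A → Stable M D A ⊎ Σ (VSet N) (Unstable A)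
    stable? A with anySubset? (λ S → (# A ≤? M * # (A ∩ lookup S)) ×-dec (N <? D * # (drops A (A ∩ lookup S))))
    ... | yes (S , p) = inj₂ (lookup S , p)
    ... | no ¬p = inj₁ (λ A′ sub size → ≮⇒≥ (λ lt → ¬p (tabulate A′ ,
        subst (λ s → # A ≤ M * s) (#-cong (eq A′ sub)) size ,
        subst (λ s → N < D * s) (#-cong (drops-cong A (eq A′ sub))) lt)))
      where
      eq : ∀ A′ → A′ ⊆ A → ∀ x → A′ x ≡ (A ∩ lookup (tabulate A′)) x
      eq A′ sub x rewrite lookup∘tabulate A′ x = absorb (A x) (A′ x) (sub x)
        where
        absorb : ∀ a b → (b ≡ true → a ≡ true) → b ≡ a ∧ b
        absorb true  b     h = refl
        absorb false false h = refl
        absorb false true  h = sym (h refl)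

    module _ (A A′ : VSet N) (u : Unstable A A′) (A>0 : 0 < # A) where
      private
        A₁ A₂ B : VSet N
        A₁ = A ∩ A′
        A₂ = A ∖ A′
        B = drops A A₁
        a a₁ a₂ : ℕ
        a = # A
        a₁ = # A₁
        a₂ = # A₂
        drop : Σ (Fin N) λ z → 0 < ⟦ B z ⟧
        drop = sum-pigeon (λ z → ⟦ B z ⟧) (λ _ → 0) (≤-trans (s≤s (≤-reflexive (trans (sum-const N 0) (*-zeroʳ N)))) (0<m*n⇒0<n D (# B) (≤-trans (s≤s z≤n) (proj₂ u))))

      part₁-large : a ≤ M * a₁
      part₁-large = proj₁ u

      -- A single dropping vertex suffices: it has at least a / t red neighbours in A and fewer than
      -- a / (2t) in A₁, so more than a / (2t) of them lie in A₂.
      part₂-large : a ≤ 2 * t * a₂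
      part₂-large = ≤-by (+-mono-≤ (+-mono-≤ (*-monoʳ-≤ 2 p) (<⇒≤ q)) (*-monoʳ-≤ (2 * t) (deg≤# A₂ z)))
          (≤-trans (+-monoʳ-≤ a (+-monoˡ-≤ (2 * t * a₂) (+-monoʳ-≤ (2 * (t * deg R A z)) a₁≤a)))
            (≤-reflexive (trans (cong (λ d → a + (2 * (t * d) + a + 2 * t * a₂)) (deg-split A A′ z)) (e₁ t a a₂ (deg R A₁ z) (deg R A₂ z)))))
        where
        z = proj₁ drop
        isTrue : ∀ {b} → 0 < ⟦ b ⟧ → b ≡ true
        isTrue {true} _ = refl
        Bz : B z ≡ true
        Bz = isTrue (proj₂ drop)
        p : a ≤ t * deg R A z
        p = ⌊⌋-true (# A ≤? t * deg R A z) (proj₁ (∧-true Bz))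
        q : 2 * t * deg R A₁ z < a₁
        q = ⌊⌋-true (2 * t * deg R A₁ z <? # A₁) (proj₂ (∧-true {⌊ # A ≤? t * deg R A z ⌋} Bz))
        a₁≤a : a₁ ≤ a
        a₁≤a = #-mono {A = A₁} {A} (λ x p → proj₁ (∧-true p))
        e₁ : ∀ t a a₂ d₁ d₂ → a + (2 * (t * (d₁ + d₂)) + a + 2 * t * a₂) ≡ 2 * t * a₂ + (2 * a + 2 * t * d₁ + 2 * t * d₂)
        e₁ = solve-∀

      -- By `energy-gap` and a₂ N ≤ M a₁ D # B, the split raises the weighted mean of energy / #² by
      -- at least N / Λ, which is one level. So the two parts cannot both stay below level m + 1.
      level-up : ∀ m → Level m A → Level (suc m) A₁ ⊎ Level (suc m) A₂
      level-up m lev with suc m * (a₁ * a₁) * N ≤? Λ * energy A₁ | suc m * (a₂ * a₂) * N ≤? Λ * energy A₂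
      ... | yes p | _ = inj₁ p
      ... | no _ | yes p = inj₂ p
      ... | no p₁ | no p₂ = ⊥-elim (<-irrefl refl contra)
        where
        a₁>0 : 0 < a₁
        a₁>0 = 0<m*n⇒0<n M a₁ (≤-trans A>0 part₁-large)
        a₂>0 : 0 < a₂
        a₂>0 = 0<m*n⇒0<n (2 * t) a₂ (≤-trans A>0 part₂-large)
        t>0 : 0 < 2 * t
        t>0 = 0<m*n⇒0<m (2 * t) a₂ (≤-trans A>0 part₂-large)
        E E₁ E₂ β : ℕ
        E = energy A
        E₁ = energy A₁
        E₂ = energy A₂
        β = # B
        lt : a₂ * (Λ * E₁) + a₁ * (Λ * E₂) < a₂ * (suc m * (a₁ * a₁) * N) + a₁ * (suc m * (a₂ * a₂) * N)
        lt = +-mono-< (*-monoʳ-< a₂ {{>-nonZero a₂>0}} (≰⇒> p₁)) (*-monoʳ-< a₁ {{>-nonZero a₁>0}} (≰⇒> p₂))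
        v : ℕ
        v = 4 * (t * t) * a
        v>0 : 0 < v
        v>0 = 0<* (≤-trans (0<* t>0 t>0) (≤-reflexive (e₁ t))) A>0
          where
          e₁ : ∀ t → 2 * t * (2 * t) ≡ 4 * (t * t)
          e₁ = solve-∀
        a₂N≤ : a₂ * N ≤ M * a₁ * (D * β)
        a₂N≤ = *-mono-≤ (≤-trans (#-mono {A = A₂} {A} (λ x p → proj₁ (∧-true p))) part₁-large) (<⇒≤ (proj₂ u))
        open ≤-Reasoning
        e₁ : ∀ t m a a₁ a₂ n → 4 * (t * t) * a * (a₂ * (suc m * (a₁ * a₁) * n) + a₁ * (suc m * (a₂ * a₂) * n)) ≡ 4 * (t * t) * a₁ * a₂ * (m * (a * (a₁ + a₂)) * n) + 4 * (t * t) * a₁ * a * (a₁ + a₂) * (a₂ * n)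
        e₁ = solve-∀
        e₂ : ∀ t a a₁ a₂ M D E β → 4 * (t * t) * a₁ * a₂ * (4 * (t * t) * D * M * E) + 4 * (t * t) * a₁ * a * a * (M * a₁ * (D * β)) ≡ 4 * (t * t) * D * M * (4 * (t * t) * (a₁ * a₂) * E + a * a * (a₁ * a₁) * β)
        e₂ = solve-∀
        e₃ : ∀ L v a₁ a₂ E₁ E₂ → L * (v * (a₂ * E₁ + a₁ * E₂)) ≡ v * (a₂ * (L * E₁) + a₁ * (L * E₂))
        e₃ = solve-∀
        contra : v * (a₂ * (Λ * E₁) + a₁ * (Λ * E₂)) < v * (a₂ * (Λ * E₁) + a₁ * (Λ * E₂))
        contra = begin-strict
          v * (a₂ * (Λ * E₁) + a₁ * (Λ * E₂)) <⟨ *-monoʳ-< v {{>-nonZero v>0}} lt ⟩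
          v * (a₂ * (suc m * (a₁ * a₁) * N) + a₁ * (suc m * (a₂ * a₂) * N)) ≡⟨ e₁ t m a a₁ a₂ N ⟩
          4 * (t * t) * a₁ * a₂ * (m * (a * (a₁ + a₂)) * N) + 4 * (t * t) * a₁ * a * (a₁ + a₂) * (a₂ * N)
            ≡⟨ cong (λ s → 4 * (t * t) * a₁ * a₂ * (m * (a * s) * N) + 4 * (t * t) * a₁ * a * s * (a₂ * N)) (#-split A A′) ⟨
          4 * (t * t) * a₁ * a₂ * (m * (a * a) * N) + 4 * (t * t) * a₁ * a * a * (a₂ * N)
            ≤⟨ +-mono-≤ (*-monoʳ-≤ (4 * (t * t) * a₁ * a₂) lev) (*-monoʳ-≤ (4 * (t * t) * a₁ * a * a) a₂N≤) ⟩
          4 * (t * t) * a₁ * a₂ * (Λ * E) + 4 * (t * t) * a₁ * a * a * (M * a₁ * (D * β)) ≡⟨ e₂ t a a₁ a₂ M D E β ⟩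
          Λ * (4 * (t * t) * (a₁ * a₂) * E + a * a * (a₁ * a₁) * β) ≤⟨ *-monoʳ-≤ Λ (energy-gap A A′) ⟩
          Λ * (v * (a₂ * E₁ + a₁ * E₂)) ≡⟨ e₃ Λ v a₁ a₂ E₁ E₂ ⟩
          v * (a₂ * (Λ * E₁) + a₁ * (Λ * E₂)) ∎

    -- The loss of size in one split: M if A₁ is kept, 2t if A₂ is kept.
    ρ : ℕ
    ρ = suc (M + 2 * t)

    StablePart : ℕ → VSet N → Set
    StablePart n A = Σ (VSet N) λ B → B ⊆ A × # A ≤ ρ ^ n * # B × Stable M D B

    stable-extend : ∀ n {A C} → C ⊆ A → # A ≤ ρ * # C → StablePart n C → StablePart (suc n) A
    stable-extend n {A} {C} C⊆A size (B , B⊆C , sizeB , s) =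
      B , (λ x p → C⊆A x (B⊆C x p)) , ≤-trans size (≤-trans (*-monoʳ-≤ ρ sizeB) (≤-reflexive (sym (*-assoc ρ (ρ ^ n) (# B))))) , s

    -- n is the number of rounds left. Level `suc Λ` is out of reach, since the energy of A is at
    -- most N (# A)², so the process must meet a stable set before n is used up.
    stable-descent : ∀ n m A → n + m ≡ suc Λ → Level m A → 0 < # A → 0 < N → StablePart n A
    stable-descent zero m A refl lev A>0 N>0 = ⊥-elim (<-irrefl refl (begin-strict
        Λ * energy A ≤⟨ *-monoʳ-≤ Λ (sum-bound (# A * # A) (λ z → *-mono-≤ (deg≤# A z) (deg≤# A z))) ⟩
        Λ * (N * (# A * # A)) <⟨ *-monoˡ-< (N * (# A * # A)) {{>-nonZero (0<* N>0 (0<* A>0 A>0))}} (n<1+n Λ) ⟩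
        suc Λ * (N * (# A * # A)) ≡⟨ e₁ (suc Λ) N (# A) ⟩
        suc Λ * (# A * # A) * N ≤⟨ lev ⟩
        Λ * energy A ∎))
      where
      open ≤-Reasoning
      e₁ : ∀ L n a → L * (n * (a * a)) ≡ L * (a * a) * n
      e₁ = solve-∀
    stable-descent (suc n) m A eq lev A>0 N>0 with stable? A
    ... | inj₁ s = A , (λ _ p → p) , ≤-trans (≤-reflexive (sym (*-identityˡ (# A)))) (*-monoˡ-≤ (# A) (0<^ (suc n) (s≤s z≤n))) , s
    ... | inj₂ (A′ , u) with level-up A A′ u A>0 m lev
    ... | inj₁ lev₁ = stable-extend n {A} {A ∩ A′} (λ x p → proj₁ (∧-true p))
        (≤-trans (part₁-large A A′ u A>0) (*-monoˡ-≤ (# (A ∩ A′)) (m≤n⇒m≤1+n (m≤m+n M (2 * t)))))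
        (stable-descent n (suc m) (A ∩ A′) (trans (+-suc n m) eq) lev₁ (0<m*n⇒0<n M (# (A ∩ A′)) (≤-trans A>0 (part₁-large A A′ u A>0))) N>0)
    ... | inj₂ lev₂ = stable-extend n {A} {A ∖ A′} (λ x p → proj₁ (∧-true p))
        (≤-trans (part₂-large A A′ u A>0) (*-monoˡ-≤ (# (A ∖ A′)) (m≤n⇒m≤1+n (m≤n+m (2 * t) M))))
        (stable-descent n (suc m) (A ∖ A′) (trans (+-suc n m) eq) lev₂ (0<m*n⇒0<n (2 * t) (# (A ∖ A′)) (≤-trans A>0 (part₂-large A A′ u A>0))) N>0)

    stable-subset : ∀ A → 0 < # A → 0 < N → StablePart (suc Λ) A
    stable-subset A = stable-descent (suc Λ) 0 A (+-identityʳ (suc Λ)) z≤n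

-- Red cliques outside a deficient set

clq-cong : ∀ {N} (R : Fin N → Fin N → Bool) r {X Y} → (∀ x → X x ≡ Y x) → clq R r X ≡ clq R r Y
clq-cong R zero    h = refl
clq-cong R (suc r) h = sum-cong-≗ (λ x → cong₂ (λ b c → ⟦ b ⟧ * c) (h x) (clq-cong R r (λ y → cong (_∧ R x y) (h y))))

deficient : ∀ {N} (R : Fin N → Fin N → Bool) → ℕ → VSet N → VSet N
deficient R t A z = ⌊ t * deg R A z <? # A ⌋

module _ {N : ℕ} (R : Fin N → Fin N → Bool) (R-sym : ∀ x y → R x y ≡ R y x) where

  -- Ordered red K_{r+1} with the first vertex in A and the others in Y.
  joint : ℕ → VSet N → VSet N → ℕ
  joint r A Y = sum (λ a → ⟦ A a ⟧ * clq R r (Y ∩ R a))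

  -- The same cliques are counted whether x in Y is chosen before or after a in A; symmetry of R
  -- exchanges the two neighbourhood conditions.
  joint-suc : ∀ r A Y → sum (λ x → ⟦ Y x ⟧ * joint r (A ∩ R x) (Y ∩ R x)) ≡ joint (suc r) A Y
  joint-suc r A Y = trans (sum-cong-≗ left) (trans (∑-comm (λ x a → ⟦ Y x ⟧ * (⟦ A a ∧ R x a ⟧ * c₁ x a))) (sum-cong-≗ right))
    where
    c₁ c₂ : Fin N → Fin N → ℕ
    c₁ x a = clq R r ((Y ∩ R x) ∩ R a)
    c₂ x a = clq R r ((Y ∩ R a) ∩ R x)
    left : ∀ x → ⟦ Y x ⟧ * joint r (A ∩ R x) (Y ∩ R x) ≡ sum (λ a → ⟦ Y x ⟧ * (⟦ A a ∧ R x a ⟧ * c₁ x a))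
    left x = sym (sum-*ˡ ⟦ Y x ⟧ (λ a → ⟦ A a ∧ R x a ⟧ * c₁ x a))
    indicators : ∀ a b c → ⟦ a ⟧ * (⟦ b ∧ c ⟧) ≡ ⟦ b ⟧ * ⟦ a ∧ c ⟧
    indicators false false c = refl
    indicators false true  c = refl
    indicators true  false c = refl
    indicators true  true  c = refl
    point : ∀ x a → ⟦ Y x ⟧ * (⟦ A a ∧ R x a ⟧ * c₁ x a) ≡ ⟦ A a ⟧ * (⟦ Y x ∧ R a x ⟧ * c₂ x a)
    point x a = trans (sym (*-assoc ⟦ Y x ⟧ ⟦ A a ∧ R x a ⟧ (c₁ x a)))
      (trans (cong₂ _*_ (trans (indicators (Y x) (A a) (R x a)) (cong (λ b → ⟦ A a ⟧ * ⟦ Y x ∧ b ⟧) (R-sym x a))) (clq-cong R r (λ y → ∧-swapʳ (Y y) (R x y) (R a y))))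
        (*-assoc ⟦ A a ⟧ ⟦ Y x ∧ R a x ⟧ (c₂ x a)))
    right : ∀ a → sum (λ x → ⟦ Y x ⟧ * (⟦ A a ∧ R x a ⟧ * c₁ x a)) ≡ ⟦ A a ⟧ * clq R (suc r) (Y ∩ R a)
    right a = trans (sum-cong-≗ (λ x → point x a)) (sum-*ˡ ⟦ A a ⟧ (λ x → ⟦ Y x ∧ R a x ⟧ * c₂ x a))

  joint≤clq : ∀ r {A Y U} → A ⊆ U → Y ⊆ U → joint r A Y ≤ clq R (suc r) U
  joint≤clq r {A} {Y} A⊆U Y⊆U = sum-mono (λ a → *-mono-≤ (⟦⟧-mono (A⊆U a)) (clq-mono R r (λ x p → ∧-intro (Y⊆U x (proj₁ (∧-true p))) (proj₂ (∧-true {Y x} p)))))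

  module _ (t K D : ℕ) (t>0 : 0 < t) {A : VSet N} (stable : Stable R t ((2 * t) ^ K) D A) where

    -- Choosing the vertices of Y one at a time, all but N / D choices shrink the current subset of A by a factor of at most 2t.
    extend-cliques : ∀ i r A′ Y → i + r ≤ K → A′ ⊆ A → # A ≤ (2 * t) ^ i * # A′ → (∀ x → Y x ≡ true → # A ≤ t * deg R A x) →
      D * # A′ * clq R r Y ≤ D * (2 * t) ^ r * joint r A′ Y + # A′ * (r * (2 * t) ^ r * N ^ r)
    extend-cliques i zero A′ Y _ _ _ _ = ≤-reflexive (trans (e₁ D (# A′)) (cong (λ s → D * 1 * s + # A′ * 0) (sum-cong-≗ (λ a → sym (*-identityʳ ⟦ A′ a ⟧)))))
      where
      e₁ : ∀ D a → D * a * 1 ≡ D * 1 * a + a * 0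
      e₁ = solve-∀
    extend-cliques i (suc r) A′ Y i+r≤K A′⊆A size avoids = begin
      D * a′ * clq R (suc r) Y ≡⟨ sum-*ˡ (D * a′) (λ x → ⟦ Y x ⟧ * c x) ⟨
      sum (λ x → D * a′ * (⟦ Y x ⟧ * c x)) ≤⟨ sum-mono pointwise ⟩
      sum (λ x → u * (⟦ Y x ⟧ * J x) + v + w * ⟦ B x ⟧) ≡⟨ ∑-distrib-+ (λ x → u * (⟦ Y x ⟧ * J x) + v) (λ x → w * ⟦ B x ⟧) ⟩
      sum (λ x → u * (⟦ Y x ⟧ * J x) + v) + sum (λ x → w * ⟦ B x ⟧) ≡⟨ cong₂ _+_ (∑-distrib-+ (λ x → u * (⟦ Y x ⟧ * J x)) (λ x → v)) (sum-*ˡ w (λ x → ⟦ B x ⟧)) ⟩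
      sum (λ x → u * (⟦ Y x ⟧ * J x)) + sum {N} (λ x → v) + w * # B ≡⟨ cong (_+ w * # B) (cong₂ _+_ (trans (sum-*ˡ u (λ x → ⟦ Y x ⟧ * J x)) (cong (u *_) (joint-suc r A′ Y))) (sum-const N v)) ⟩
      u * joint (suc r) A′ Y + N * v + w * # B ≡⟨ e₁ (u * joint (suc r) A′ Y) N v D a′ (N ^ r) (# B) ⟩
      u * joint (suc r) A′ Y + N * v + a′ * N ^ r * (D * # B) ≤⟨ +-monoʳ-≤ (u * joint (suc r) A′ Y + N * v) (*-monoʳ-≤ (a′ * N ^ r) (stable A′ A′⊆A a≤Ma′)) ⟩
      -- The charge for the dropping vertices is inflated by τ ^ (r + 1), so that it joins the r
      -- copies already in `N * v` as copy number r + 1 of the error term.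
      u * joint (suc r) A′ Y + N * v + a′ * N ^ r * N ≤⟨ +-monoʳ-≤ (u * joint (suc r) A′ Y + N * v) (m≤n*m (a′ * N ^ r * N) (τ * τ ^ r) {{>-nonZero (0<^ (suc r) τ>0)}}) ⟩
      u * joint (suc r) A′ Y + N * v + τ * τ ^ r * (a′ * N ^ r * N) ≡⟨ e₂ (u * joint (suc r) A′ Y) a′ r τ (τ ^ r) N (N ^ r) ⟩
      u * joint (suc r) A′ Y + a′ * (suc r * (τ * τ ^ r) * (N * N ^ r)) ∎
      where
      open ≤-Reasoning
      τ a′ u v w : ℕ
      τ = 2 * t
      a′ = # A′
      u = D * (τ * τ ^ r)
      v = a′ * (r * (τ * τ ^ r) * N ^ r)
      w = D * a′ * N ^ r
      c J : Fin N → ℕ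
      c x = clq R r (Y ∩ R x)
      J x = joint r (A′ ∩ R x) (Y ∩ R x)
      B : VSet N
      B = drops R t A A′
      τ>0 : 0 < τ
      τ>0 = 0<* {2} {t} (s≤s z≤n) t>0
      a≤Ma′ : # A ≤ τ ^ K * a′
      a≤Ma′ = ≤-trans size (*-monoˡ-≤ a′ (^-monoʳ-≤ τ {{>-nonZero τ>0}} (≤-trans (m≤m+n i (suc r)) i+r≤K)))
      e₁ : ∀ j N v D a n b → j + N * v + D * a * n * b ≡ j + N * v + a * n * (D * b)
      e₁ = solve-∀
      e₂ : ∀ j a r τ σ N n → j + N * (a * (r * (τ * σ) * n)) + τ * σ * (a * n * N) ≡ j + a * (suc r * (τ * σ) * (N * n))
      e₂ = solve-∀
      caught : ∀ x → Y x ≡ true → ∀ b → B x ≡ b → D * a′ * c x ≤ u * J x + v + w * ⟦ b ⟧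
      caught x Yx true eq = ≤-trans (*-monoʳ-≤ (D * a′) (clq-bound R r (Y ∩ R x))) (≤-trans (≤-reflexive (sym (*-identityʳ w))) (m≤n+m (w * 1) (u * J x + v)))
      caught x Yx false eq = begin
        D * a′ * c x ≤⟨ *-monoˡ-≤ (c x) (*-monoʳ-≤ D keep) ⟩
        D * (τ * d) * c x ≡⟨ e₃ D τ d (c x) ⟩
        τ * (D * d * c x) ≤⟨ *-monoʳ-≤ τ (extend-cliques (suc i) r (A′ ∩ R x) (Y ∩ R x) (≤-trans (≤-reflexive (sym (+-suc i r))) i+r≤K)
             (λ z p → A′⊆A z (proj₁ (∧-true p))) size′ (λ z p → avoids z (proj₁ (∧-true p)))) ⟩
        τ * (D * τ ^ r * J x + d * (r * τ ^ r * N ^ r)) ≡⟨ e₄ τ D (τ ^ r) (J x) d r (N ^ r) ⟩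
        u * J x + d * (r * (τ * τ ^ r) * N ^ r) ≤⟨ +-monoʳ-≤ (u * J x) (*-monoˡ-≤ (r * (τ * τ ^ r) * N ^ r) (deg≤# R t A′ x)) ⟩
        u * J x + v ≤⟨ m≤m+n (u * J x + v) (w * 0) ⟩
        u * J x + v + w * 0 ∎
        where
        d = deg R A′ x
        keep : a′ ≤ τ * d
        keep = ≮⇒≥ (drop-false (⌊⌋-intro (# A ≤? t * deg R A x) (avoids x Yx)) (τ * d <? a′) eq)
          where
          drop-false : ∀ {b} {P : Set} → b ≡ true → (q : Dec P) → b ∧ ⌊ q ⌋ ≡ false → ¬ P
          drop-false refl q h = ⌊⌋-false q h
        size′ : # A ≤ τ ^ suc i * d
        size′ = ≤-trans size (≤-trans (*-monoʳ-≤ (τ ^ i) keep) (≤-reflexive (e₅ τ (τ ^ i) d)))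
          where
          e₅ : ∀ τ σ d → σ * (τ * d) ≡ τ * σ * d
          e₅ = solve-∀
        e₃ : ∀ D τ d c → D * (τ * d) * c ≡ τ * (D * d * c)
        e₃ = solve-∀
        e₄ : ∀ τ D σ j d r n → τ * (D * σ * j + d * (r * σ * n)) ≡ D * (τ * σ) * j + d * (r * (τ * σ) * n)
        e₄ = solve-∀
      pointwise : ∀ x → D * a′ * (⟦ Y x ⟧ * c x) ≤ u * (⟦ Y x ⟧ * J x) + v + w * ⟦ B x ⟧
      pointwise x = byCases (Y x) refl
        where
        byCases : ∀ y → Y x ≡ y → D * a′ * (⟦ y ⟧ * c x) ≤ u * (⟦ y ⟧ * J x) + v + w * ⟦ B x ⟧
        byCases false _ = ≤-trans (≤-reflexive (*-zeroʳ (D * a′))) z≤n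
        byCases true eq = ≤-trans (≤-reflexive (cong (D * a′ *_) (*-identityˡ (c x)))) (≤-trans (caught x eq (B x) refl) (≤-reflexive (cong (λ j → u * j + v + w * ⟦ B x ⟧) (sym (*-identityˡ (J x))))))

  -- A typical red K_r of U outside the deficient set has at least # A / (2t)^r common red
  -- neighbours in A ⊆ U, so too many such cliques would give too many red K_{r+1} in U. The
  -- hypothesis on D keeps the exceptional cliques, and the one on e′ the extended ones, to half of
  -- the budget each.
  few-cliques-outside : ∀ t K D e e′ m r {A U} → 0 < t → 0 < D → 0 < N → r ≤ K → Stable R t ((2 * t) ^ K) D A → A ⊆ U → N ≤ m * # A →
    2 * e * (r * (2 * t) ^ r) ≤ D → 2 * e * m * (2 * t) ^ r ≤ e′ →
    e′ * clq R (suc r) U ≤ N ^ suc r → e * clq R r (U ∖ deficient R t A) ≤ N ^ r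
  few-cliques-outside t K D e e′ m r {A} {U} t>0 D>0 N>0 r≤K stable A⊆U large D-large e′-large few =
    *-cancelˡ-≤′ (2 * m * D * a) (0<* (0<* (0<* {2} {m} (s≤s z≤n) m>0) D>0) a>0) (begin
      2 * m * D * a * (e * C) ≡⟨ e₁ m D a e C ⟩
      2 * e * m * (D * a * C) ≤⟨ *-monoʳ-≤ (2 * e * m) (extend-cliques t K D t>0 stable 0 r A Y r≤K (λ _ p → p) (≤-reflexive (sym (*-identityˡ a))) avoids) ⟩
      2 * e * m * (D * τ * joint r A Y + a * (r * τ * N ^ r)) ≡⟨ e₂ e m D τ (joint r A Y) a r (N ^ r) ⟩
      D * (2 * e * m * τ * joint r A Y) + m * a * (2 * e * (r * τ)) * N ^ r
        ≤⟨ +-mono-≤ (*-monoʳ-≤ D (≤-trans (*-mono-≤ e′-large (joint≤clq r A⊆U (λ x p → proj₁ (∧-true p)))) few)) (*-monoˡ-≤ (N ^ r) (*-monoʳ-≤ (m * a) D-large)) ⟩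
      D * (N * N ^ r) + m * a * D * N ^ r ≤⟨ +-monoˡ-≤ (m * a * D * N ^ r) (*-monoʳ-≤ D (*-monoˡ-≤ (N ^ r) large)) ⟩
      D * (m * a * N ^ r) + m * a * D * N ^ r ≡⟨ e₃ D m a (N ^ r) ⟩
      2 * m * D * a * N ^ r ∎)
    where
    open ≤-Reasoning
    a τ C : ℕ
    a = # A
    τ = (2 * t) ^ r
    Y : VSet N
    Y = U ∖ deficient R t A
    C = clq R r Y
    m>0 : 0 < m
    m>0 = 0<m*n⇒0<m m a (≤-trans N>0 large)
    a>0 : 0 < a
    a>0 = 0<m*n⇒0<n m a (≤-trans N>0 large)
    avoids : ∀ x → Y x ≡ true → a ≤ t * deg R A x
    avoids x p = ≮⇒≥ (⌊⌋-false (t * deg R A x <? a) (not-true (proj₂ (∧-true {U x} p))))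
    e₁ : ∀ m D a e C → 2 * m * D * a * (e * C) ≡ 2 * e * m * (D * a * C)
    e₁ = solve-∀
    e₂ : ∀ e m D τ j a r n → 2 * e * m * (D * τ * j + a * (r * τ * n)) ≡ D * (2 * e * m * τ * j) + m * a * (2 * e * (r * τ)) * n
    e₂ = solve-∀
    e₃ : ∀ D m a n → D * (m * a * n) + m * a * D * n ≡ 2 * m * D * a * n
    e₃ = solve-∀

-- Sums over tuples

ΣV : ∀ {N} r → (Vec (Fin N) r → ℕ) → ℕ
ΣV zero    g = g []
ΣV (suc r) g = sum (λ x → ΣV r (λ f → g (x ∷ f)))

ΣV-mono : ∀ {N} r {g h : Vec (Fin N) r → ℕ} → (∀ f → g f ≤ h f) → ΣV r g ≤ ΣV r h
ΣV-mono zero    p = p []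
ΣV-mono (suc r) p = sum-mono (λ x → ΣV-mono r (λ f → p (x ∷ f)))

ΣV-cong : ∀ {N} r {g h : Vec (Fin N) r → ℕ} → (∀ f → g f ≡ h f) → ΣV r g ≡ ΣV r h
ΣV-cong zero    p = p []
ΣV-cong (suc r) p = sum-cong-≗ (λ x → ΣV-cong r (λ f → p (x ∷ f)))

ΣV-*ˡ : ∀ {N} r c (g : Vec (Fin N) r → ℕ) → ΣV r (λ f → c * g f) ≡ c * ΣV r g
ΣV-*ˡ zero    c g = refl
ΣV-*ˡ (suc r) c g = trans (sum-cong-≗ (λ x → ΣV-*ˡ r c (λ f → g (x ∷ f)))) (sum-*ˡ c (λ x → ΣV r (λ f → g (x ∷ f))))

ΣV-+ : ∀ {N} r (g h : Vec (Fin N) r → ℕ) → ΣV r (λ f → g f + h f) ≡ ΣV r g + ΣV r h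
ΣV-+ zero    g h = refl
ΣV-+ (suc r) g h = trans (sum-cong-≗ (λ x → ΣV-+ r (λ f → g (x ∷ f)) (λ f → h (x ∷ f)))) (∑-distrib-+ (λ x → ΣV r (λ f → g (x ∷ f))) (λ x → ΣV r (λ f → h (x ∷ f))))

ΣV-sum : ∀ {N n} r (g : Vec (Fin N) r → Fin n → ℕ) → ΣV r (λ f → sum (g f)) ≡ sum (λ z → ΣV r (λ f → g f z))
ΣV-sum zero    g = refl
ΣV-sum (suc r) g = trans (sum-cong-≗ (λ x → ΣV-sum r (λ f → g (x ∷ f)))) (∑-comm (λ x z → ΣV r (λ f → g (x ∷ f) z)))

allV : ∀ {N r} → VSet N → Vec (Fin N) r → Bool
allV X []      = true
allV X (x ∷ f) = X x ∧ allV X f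

∧-interchange : ∀ a b c d → (a ∧ b) ∧ c ∧ d ≡ (a ∧ c) ∧ b ∧ d
∧-interchange false b     c d = refl
∧-interchange true  false false d = refl
∧-interchange true  false true  d = refl
∧-interchange true  true  c d = refl

allV-∩ : ∀ {N r} (X Y : VSet N) (f : Vec (Fin N) r) → allV (X ∩ Y) f ≡ allV X f ∧ allV Y f
allV-∩ X Y []      = refl
allV-∩ X Y (x ∷ f) rewrite allV-∩ X Y f = ∧-interchange (X x) (Y x) (allV X f) (allV Y f)

count-allV : ∀ {N} r (X : VSet N) → ΣV r (λ f → ⟦ allV X f ⟧) ≡ # X ^ r
count-allV zero    X = refl
count-allV (suc r) X = trans (sum-cong-≗ step) (sum-*ʳ (# X ^ r) (λ x → ⟦ X x ⟧))
  where
  step : ∀ x → ΣV r (λ f → ⟦ X x ∧ allV X f ⟧) ≡ ⟦ X x ⟧ * # X ^ r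
  step x = trans (ΣV-cong r (λ f → ⟦∧⟧ (X x) (allV X f))) (trans (ΣV-*ˡ r ⟦ X x ⟧ (λ f → ⟦ allV X f ⟧)) (cong (⟦ X x ⟧ *_) (count-allV r X)))

-- Bernoulli's inequality x ^ k ≥ a ^ k - k d a ^ (k - 1) for a = x + d, multiplied by a to avoid the predecessor.
bernoulli : ∀ k x d → (x + d) * (x + d) ^ k ≤ (x + d) * x ^ k + k * d * (x + d) ^ k
bernoulli zero x d = ≤-reflexive (sym (+-identityʳ ((x + d) * 1)))
bernoulli (suc k) x d = begin
  (x + d) * ((x + d) * (x + d) ^ k) ≤⟨ *-monoʳ-≤ (x + d) (bernoulli k x d) ⟩
  (x + d) * ((x + d) * x ^ k + k * d * (x + d) ^ k) ≡⟨ e₁ x d (x ^ k) k ((x + d) ^ k) ⟩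
  (x + d) * (x * x ^ k) + d * (x + d) * x ^ k + k * d * ((x + d) * (x + d) ^ k) ≤⟨ +-monoˡ-≤ _ (+-monoʳ-≤ ((x + d) * (x * x ^ k)) (*-monoʳ-≤ (d * (x + d)) (^-monoˡ-≤ k (m≤m+n x d)))) ⟩
  (x + d) * (x * x ^ k) + d * (x + d) * (x + d) ^ k + k * d * ((x + d) * (x + d) ^ k) ≡⟨ e₂ x d (x ^ k) k ((x + d) ^ k) ⟩
  (x + d) * (x * x ^ k) + suc k * d * ((x + d) * (x + d) ^ k) ∎
  where
  open ≤-Reasoning
  e₁ : ∀ x d p k q → (x + d) * ((x + d) * p + k * d * q) ≡ (x + d) * (x * p) + d * (x + d) * p + k * d * ((x + d) * q)
  e₁ = solve-∀
  e₂ : ∀ x d p k q → (x + d) * (x * p) + d * (x + d) * q + k * d * ((x + d) * q) ≡ (x + d) * (x * p) + suc k * d * ((x + d) * q)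
  e₂ = solve-∀

^-*-distrib : ∀ a b k → (a * b) ^ k ≡ a ^ k * b ^ k
^-*-distrib a b zero = refl
^-*-distrib a b (suc k) rewrite ^-*-distrib a b k = e₁ a b (a ^ k) (b ^ k)
  where
  e₁ : ∀ a b p q → a * b * (p * q) ≡ a * p * (b * q)
  e₁ = solve-∀

-- Blue books

module _ {N : ℕ} (B : Fin N → Fin N → Bool) where

  isClique : ∀ {r} → Vec (Fin N) r → Bool
  isClique []      = true
  isClique (x ∷ f) = allV (B x) f ∧ isClique f

  ext : ∀ {r} → Vec (Fin N) r → ℕ
  ext f = # (λ u → allV (B u) f)

  missing : VSet N → Fin N → ℕ
  missing A z = # (A ∖ B z)

  -- Ordered pairs of A that are not blue. For irreflexive B the diagonal is included, so that
  -- tuples with a repeated entry are also controlled by it.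
  conf : VSet N → ℕ
  conf A = sum (λ x → ⟦ A x ⟧ * missing A x)

  deg-+-missing : ∀ A z → # A ≡ deg B A z + missing A z
  deg-+-missing A z = #-split A (B z)

  bernoulli-deg : ∀ k A z → # A * # A ^ k ≤ # A * deg B A z ^ k + k * missing A z * # A ^ k
  bernoulli-deg k A z rewrite deg-+-missing A z = bernoulli k (deg B A z) (missing A z)

  count-extended : ∀ k A z → ΣV k (λ f → ⟦ allV A f ⟧ * ⟦ allV (B z) f ⟧) ≡ deg B A z ^ k
  count-extended k A z = trans (ΣV-cong k (λ f → trans (sym (⟦∧⟧ (allV A f) (allV (B z) f))) (cong ⟦_⟧ (sym (allV-∩ A (B z) f))))) (count-allV k (A ∩ B z))

  -- Double counting of a vertex z together with a k-tuple of A in its blue neighbourhood: this is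
  -- how book sizes bound blue degrees.
  books : ∀ k A → sum (λ z → deg B A z ^ k) ≡ ΣV k (λ f → ⟦ allV A f ⟧ * ext f)
  books k A = trans (sum-cong-≗ (λ z → sym (count-extended k A z)))
    (trans (sym (ΣV-sum k (λ f z → ⟦ allV A f ⟧ * ⟦ allV (B z) f ⟧))) (ΣV-cong k (λ f → sum-*ˡ ⟦ allV A f ⟧ (λ z → ⟦ allV (B z) f ⟧))))

  nonCliques : ℕ → VSet N → ℕ
  nonCliques k A = ΣV k (λ f → ⟦ allV A f ⟧ * ⟦ not (isClique f) ⟧)

  -- `x ∷ f` fails to be a clique if f does or if x misses an entry of f. By Bernoulli, a proportion
  -- of at most k · missing / # A of the tuples f of A fail in the second way. The factor # A avoids
  -- the exponent k - 1.
  nonCliques-suc : ∀ k A → # A * nonCliques (suc k) A ≤ k * # A ^ k * conf A + # A * (# A * nonCliques k A)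
  nonCliques-suc k A = begin
    a * nonCliques (suc k) A ≤⟨ *-monoʳ-≤ a (sum-mono first) ⟩
    a * sum (λ x → ⟦ A x ⟧ * (far x + nonCliques k A)) ≡⟨ sum-*ˡ a (λ x → ⟦ A x ⟧ * (far x + nonCliques k A)) ⟨
    sum (λ x → a * (⟦ A x ⟧ * (far x + nonCliques k A))) ≤⟨ sum-mono second ⟩
    sum (λ x → k * a ^ k * (⟦ A x ⟧ * missing A x) + a * nonCliques k A * ⟦ A x ⟧) ≡⟨ ∑-distrib-+ (λ x → k * a ^ k * (⟦ A x ⟧ * missing A x)) (λ x → a * nonCliques k A * ⟦ A x ⟧) ⟩
    sum (λ x → k * a ^ k * (⟦ A x ⟧ * missing A x)) + sum (λ x → a * nonCliques k A * ⟦ A x ⟧)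
      ≡⟨ cong₂ _+_ (sum-*ˡ (k * a ^ k) (λ x → ⟦ A x ⟧ * missing A x)) (trans (sum-*ˡ (a * nonCliques k A) (λ x → ⟦ A x ⟧)) (e₁ a (nonCliques k A))) ⟩
    k * a ^ k * conf A + a * (a * nonCliques k A) ∎
    where
    open ≤-Reasoning
    a : ℕ
    a = # A
    far : Fin N → ℕ
    far x = ΣV k (λ f → ⟦ allV A f ⟧ * ⟦ not (allV (B x) f) ⟧)
    e₁ : ∀ a n → a * n * a ≡ a * (a * n)
    e₁ = solve-∀
    bools : ∀ p q r s → ⟦ p ∧ q ⟧ * ⟦ not (r ∧ s) ⟧ ≤ ⟦ p ⟧ * (⟦ q ⟧ * ⟦ not r ⟧ + ⟦ q ⟧ * ⟦ not s ⟧)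
    bools false q     r     s = z≤n
    bools true  false r     s = z≤n
    bools true  true  false false = s≤s z≤n
    bools true  true  false true = s≤s z≤n
    bools true  true  true  false = s≤s z≤n
    bools true  true  true  true = z≤n
    first : ∀ x → ΣV k (λ f → ⟦ A x ∧ allV A f ⟧ * ⟦ not (allV (B x) f ∧ isClique f) ⟧) ≤ ⟦ A x ⟧ * (far x + nonCliques k A)
    first x = ≤-trans (ΣV-mono k (λ f → bools (A x) (allV A f) (allV (B x) f) (isClique f)))
      (≤-reflexive (trans (ΣV-*ˡ k ⟦ A x ⟧ (λ f → ⟦ allV A f ⟧ * ⟦ not (allV (B x) f) ⟧ + ⟦ allV A f ⟧ * ⟦ not (isClique f) ⟧))
        (cong (⟦ A x ⟧ *_) (ΣV-+ k (λ f → ⟦ allV A f ⟧ * ⟦ not (allV (B x) f) ⟧) (λ f → ⟦ allV A f ⟧ * ⟦ not (isClique f) ⟧)))))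
    far-+ : ∀ x → deg B A x ^ k + far x ≡ a ^ k
    far-+ x = trans (cong (_+ far x) (sym (count-extended k A x)))
      (trans (sym (ΣV-+ k (λ f → ⟦ allV A f ⟧ * ⟦ allV (B x) f ⟧) (λ f → ⟦ allV A f ⟧ * ⟦ not (allV (B x) f) ⟧)))
        (trans (ΣV-cong k (λ f → split (allV A f) (allV (B x) f))) (count-allV k A)))
      where
      split : ∀ p q → ⟦ p ⟧ * ⟦ q ⟧ + ⟦ p ⟧ * ⟦ not q ⟧ ≡ ⟦ p ⟧
      split false q = refl
      split true false = refl
      split true true = refl
    far≤ : ∀ x → a * far x ≤ k * missing A x * a ^ k
    far≤ x = +-cancelˡ-≤ (a * deg B A x ^ k) (a * far x) (k * missing A x * a ^ k)
      (≤-trans (≤-reflexive (trans (sym (*-distribˡ-+ a (deg B A x ^ k) (far x))) (cong (a *_) (far-+ x)))) (bernoulli-deg k A x))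
    second : ∀ x → a * (⟦ A x ⟧ * (far x + nonCliques k A)) ≤ k * a ^ k * (⟦ A x ⟧ * missing A x) + a * nonCliques k A * ⟦ A x ⟧
    second x = ≤-trans (≤-reflexive (e₂ a ⟦ A x ⟧ (far x) (nonCliques k A)))
      (≤-trans (+-monoˡ-≤ _ (*-monoʳ-≤ ⟦ A x ⟧ (far≤ x))) (≤-reflexive (e₃ ⟦ A x ⟧ k (missing A x) (a ^ k) (a * nonCliques k A))))
      where
      e₂ : ∀ a i f n → a * (i * (f + n)) ≡ i * (a * f) + a * n * i
      e₂ = solve-∀
      e₃ : ∀ i k m p n → i * (k * m * p) + n * i ≡ k * p * (i * m) + n * i
      e₃ = solve-∀

  -- A union bound over the pairs of entries, each of which is bad for a proportion of at most 1 / b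
  -- of the tuples. Counting k² pairs is generous and lets the induction close.
  nonCliques-bound : ∀ k b A → b * conf A ≤ # A * # A → b * (# A * nonCliques k A) ≤ k * k * (# A * # A ^ k)
  nonCliques-bound zero b A p = ≤-reflexive (trans (cong (b *_) (*-zeroʳ (# A))) (*-zeroʳ b))
  nonCliques-bound (suc k) b A p = begin
    b * (a * nonCliques (suc k) A) ≤⟨ *-monoʳ-≤ b (nonCliques-suc k A) ⟩
    b * (k * a ^ k * conf A + a * (a * nonCliques k A)) ≡⟨ e₁ b k (a ^ k) (conf A) a (nonCliques k A) ⟩
    k * a ^ k * (b * conf A) + a * (b * (a * nonCliques k A)) ≤⟨ +-mono-≤ (*-monoʳ-≤ (k * a ^ k) p) (*-monoʳ-≤ a (nonCliques-bound k b A p)) ⟩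
    k * a ^ k * (a * a) + a * (k * k * (a * a ^ k)) ≤⟨ m≤m+n _ ((k + 1) * (a * (a * a ^ k))) ⟩
    k * a ^ k * (a * a) + a * (k * k * (a * a ^ k)) + (k + 1) * (a * (a * a ^ k)) ≡⟨ e₂ k a (a ^ k) ⟩
    suc k * suc k * (a * (a * a ^ k)) ∎
    where
    open ≤-Reasoning
    a : ℕ
    a = # A
    e₁ : ∀ b k p c a n → b * (k * p * c + a * (a * n)) ≡ k * p * (b * c) + a * (b * (a * n))
    e₁ = solve-∀
    e₂ : ∀ k a p → k * p * (a * a) + a * (k * k * (a * p)) + (k + 1) * (a * (a * p)) ≡ suc k * suc k * (a * (a * p))
    e₂ = solve-∀

  richCliques : ∀ k → (Vec (Fin N) k → Bool) → ℕ
  richCliques k rich = ΣV k (λ f → ⟦ isClique f ∧ rich f ⟧)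

  -- deg B A z ^ k counts the k-tuples of A that z extends; most of these tuples are cliques, and most cliques are poor.
  book-bound : ∀ k S m rich A → 0 < k → 0 < m → 0 < # A → (∀ f → isClique f ≡ true → rich f ≡ false → 3 * k * S * ext f ≤ (3 * S + k) * N) →
    3 * S * m ^ k * richCliques k rich ≤ N ^ k → N ≤ m * # A → 3 * (k * k) * S * conf A ≤ # A * # A →
    k * S * sum (λ z → deg B A z ^ k) ≤ (S + k) * N * # A ^ k
  -- After scaling by 3, the error 3kN (# A)^k has three equal shares: tuples that are no cliques,
  -- rich cliques, and the slack k in `poor`.
  book-bound k S m rich A k>0 m>0 a>0 poor few large sparse = *-cancelˡ-≤′ 3 (s≤s z≤n) (begin
    3 * (k * S * sum (λ z → deg B A z ^ k)) ≡⟨ cong (λ s → 3 * (k * S * s)) (books k A) ⟩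
    3 * (k * S * ΣV k (λ f → ⟦ allV A f ⟧ * ext f)) ≡⟨ trans (e₁ k S (ΣV k (λ f → ⟦ allV A f ⟧ * ext f))) (sym (ΣV-*ˡ k (3 * k * S) (λ f → ⟦ allV A f ⟧ * ext f))) ⟩
    ΣV k (λ f → 3 * k * S * (⟦ allV A f ⟧ * ext f)) ≤⟨ ΣV-mono k pointwise ⟩
    ΣV k (λ f → c * (⟦ allV A f ⟧ * ⟦ not (isClique f) ⟧) + c * ⟦ isClique f ∧ rich f ⟧ + d * ⟦ allV A f ⟧)
      ≡⟨ trans (ΣV-+ k (λ f → c * (⟦ allV A f ⟧ * ⟦ not (isClique f) ⟧) + c * ⟦ isClique f ∧ rich f ⟧) (λ f → d * ⟦ allV A f ⟧))
           (cong₂ _+_ (trans (ΣV-+ k (λ f → c * (⟦ allV A f ⟧ * ⟦ not (isClique f) ⟧)) (λ f → c * ⟦ isClique f ∧ rich f ⟧))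
              (cong₂ _+_ (ΣV-*ˡ k c (λ f → ⟦ allV A f ⟧ * ⟦ not (isClique f) ⟧)) (ΣV-*ˡ k c (λ f → ⟦ isClique f ∧ rich f ⟧))))
             (trans (ΣV-*ˡ k d (λ f → ⟦ allV A f ⟧)) (cong (d *_) (count-allV k A)))) ⟩
    c * nonCliques k A + c * richCliques k rich + d * a ^ k ≡⟨ e₂ k S N (nonCliques k A) (richCliques k rich) (a ^ k) ⟩
    k * N * (3 * S * nonCliques k A) + k * N * (3 * S * richCliques k rich) + d * a ^ k
      ≤⟨ +-monoˡ-≤ (d * a ^ k) (+-mono-≤ (*-monoʳ-≤ (k * N) nonCliques≤) (*-monoʳ-≤ (k * N) rich≤)) ⟩
    k * N * a ^ k + k * N * a ^ k + d * a ^ k ≡⟨ e₃ k N S (a ^ k) ⟩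
    3 * ((S + k) * N * a ^ k) ∎)
    where
    open ≤-Reasoning
    a c d : ℕ
    a = # A
    c = 3 * k * S * N
    d = (3 * S + k) * N
    e₁ : ∀ k S s → 3 * (k * S * s) ≡ 3 * k * S * s
    e₁ = solve-∀
    e₂ : ∀ k S N n ρ p → 3 * k * S * N * n + 3 * k * S * N * ρ + (3 * S + k) * N * p ≡ k * N * (3 * S * n) + k * N * (3 * S * ρ) + (3 * S + k) * N * p
    e₂ = solve-∀
    e₃ : ∀ k N S p → k * N * p + k * N * p + (3 * S + k) * N * p ≡ 3 * ((S + k) * N * p)
    e₃ = solve-∀
    nonCliques≤ : 3 * S * nonCliques k A ≤ a ^ k
    nonCliques≤ = *-cancelˡ-≤′ (k * k * a) (0<* (0<* k>0 k>0) a>0) (≤-trans (≤-reflexive (e₄ k S a (nonCliques k A))) (≤-trans (nonCliques-bound k (3 * (k * k) * S) A sparse) (≤-reflexive (sym (*-assoc (k * k) a (a ^ k))))))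
      where
      e₄ : ∀ k S a n → k * k * a * (3 * S * n) ≡ 3 * (k * k) * S * (a * n)
      e₄ = solve-∀
    rich≤ : 3 * S * richCliques k rich ≤ a ^ k
    rich≤ = *-cancelˡ-≤′ (m ^ k) (0<^ k m>0) (≤-trans (≤-reflexive (e₄ S (m ^ k) (richCliques k rich))) (≤-trans few N^k≤))
      where
      N^k≤ : N ^ k ≤ m ^ k * a ^ k
      N^k≤ = ≤-trans (^-monoˡ-≤ k large) (≤-reflexive (^-*-distrib m a k))
      e₄ : ∀ S p ρ → p * (3 * S * ρ) ≡ 3 * S * p * ρ
      e₄ = solve-∀
    pointwise : ∀ f → 3 * k * S * (⟦ allV A f ⟧ * ext f) ≤ c * (⟦ allV A f ⟧ * ⟦ not (isClique f) ⟧) + c * ⟦ isClique f ∧ rich f ⟧ + d * ⟦ allV A f ⟧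
    pointwise f = byCases (allV A f) (isClique f) (rich f) refl refl
      where
      K : ℕ
      K = 3 * k * S
      trivial : K * (1 * ext f) ≤ c
      trivial = ≤-trans (*-monoʳ-≤ K (≤-trans (≤-reflexive (*-identityˡ (ext f))) (#≤N (λ u → allV (B u) f)))) ≤-refl
      byCases : ∀ p q r → isClique f ≡ q → rich f ≡ r → K * (⟦ p ⟧ * ext f) ≤ c * (⟦ p ⟧ * ⟦ not q ⟧) + c * ⟦ q ∧ r ⟧ + d * ⟦ p ⟧
      byCases false q r _ _ = ≤-trans (≤-reflexive (*-zeroʳ K)) z≤n
      byCases true false r _ _ = ≤-trans trivial (≤-trans (≤-reflexive (sym (*-identityʳ c))) (≤-trans (m≤m+n (c * 1) (c * 0)) (m≤m+n (c * 1 + c * 0) (d * 1))))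
      byCases true true true _ _ = ≤-trans trivial (≤-trans (≤-reflexive (sym (*-identityʳ c))) (≤-trans (m≤n+m (c * 1) (c * 0)) (m≤m+n (c * 0 + c * 1) (d * 1))))
      byCases true true false cl po = ≤-trans (*-monoʳ-≤ K (≤-reflexive (*-identityˡ (ext f)))) (≤-trans (poor f cl po) (≤-trans (≤-reflexive (sym (*-identityʳ d))) (m≤n+m (d * 1) (c * 0 + c * 0))))

-- The size of a deficient set

suc-≡ᶠ : ∀ {N} (i j : Fin N) → (Fin.suc i ≡ᶠ Fin.suc j) ≡ (i ≡ᶠ j)
suc-≡ᶠ i j with i ≟F j
... | yes _ = refl
... | no _  = refl

#-single : ∀ {N} (z : Fin N) → # (λ y → z ≡ᶠ y) ≡ 1
#-single {suc N} Fin.zero    = cong suc (trans (sum-const N 0) (*-zeroʳ N))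
#-single {suc N} (Fin.suc z) = trans (#-cong (suc-≡ᶠ z)) (#-single z)

≡ᶠ-refl : ∀ {N} (z : Fin N) → (z ≡ᶠ z) ≡ true
≡ᶠ-refl z = ⌊⌋-intro (z ≟F z) refl

module _ {N : ℕ} (R B : Fin N → Fin N → Bool) (cover : ∀ x y → B x y ≡ false → R x y ≡ true ⊎ x ≡ y) where

  -- The extra 1 is z itself, the one vertex that `cover` allows to be neither blue nor red to z.
  missing≤ : ∀ A z → missing B A z ≤ deg R A z + 1
  missing≤ A z = ≤-trans (sum-mono (λ y → point y (A y) (B z y) refl))
    (≤-reflexive (trans (∑-distrib-+ (λ y → ⟦ A y ∧ R z y ⟧) (λ y → ⟦ z ≡ᶠ y ⟧)) (cong (deg R A z +_) (#-single z))))
    where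
    point : ∀ y a b → B z y ≡ b → ⟦ a ∧ not b ⟧ ≤ ⟦ a ∧ R z y ⟧ + ⟦ z ≡ᶠ y ⟧
    point y false b _ = z≤n
    point y true true _ = z≤n
    point y true false eq with cover z y eq
    ... | inj₁ r rewrite r = s≤s z≤n
    ... | inj₂ refl rewrite ≡ᶠ-refl z = m≤n+m 1 ⟦ R z z ⟧

  conf≤ : ∀ A → conf B A ≤ clq R 2 A + # A
  conf≤ A = begin
    conf B A ≤⟨ sum-mono (λ x → *-monoʳ-≤ ⟦ A x ⟧ (missing≤ A x)) ⟩
    sum (λ x → ⟦ A x ⟧ * (deg R A x + 1)) ≡⟨ sum-cong-≗ (λ x → e₁ ⟦ A x ⟧ (deg R A x)) ⟩
    sum (λ x → ⟦ A x ⟧ * deg R A x + ⟦ A x ⟧) ≡⟨ ∑-distrib-+ (λ x → ⟦ A x ⟧ * deg R A x) (λ x → ⟦ A x ⟧) ⟩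
    sum (λ x → ⟦ A x ⟧ * deg R A x) + # A ≡⟨ cong (_+ # A) (clq-2 R A) ⟨
    clq R 2 A + # A ∎
    where
    open ≤-Reasoning
    e₁ : ∀ i d → i * (d + 1) ≡ i * d + i
    e₁ = solve-∀

  -- Red pairs and the diagonal take half of the budget each; the diagonal is why A must have at
  -- least 2b vertices.
  conf-sparse : ∀ b A → 2 * b * clq R 2 A ≤ # A * # A → 2 * b ≤ # A → b * conf B A ≤ # A * # A
  conf-sparse b A p q = *-cancelˡ-≤′ 2 (s≤s z≤n) (begin
    2 * (b * conf B A) ≡⟨ *-assoc 2 b (conf B A) ⟨
    2 * b * conf B A ≤⟨ *-monoʳ-≤ (2 * b) (conf≤ A) ⟩
    2 * b * (clq R 2 A + # A) ≡⟨ *-distribˡ-+ (2 * b) (clq R 2 A) (# A) ⟩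
    2 * b * clq R 2 A + 2 * b * # A ≤⟨ +-mono-≤ p (*-monoˡ-≤ (# A) q) ⟩
    # A * # A + # A * # A ≡⟨ cong (# A * # A +_) (+-identityʳ (# A * # A)) ⟨
    2 * (# A * # A) ∎)
    where open ≤-Reasoning

  -- With t = 2kS, a deficient z misses at most 2 # A / t vertices of A in blue: half of this
  -- allowance is for red neighbours, half for z itself. By Bernoulli the k-th power of its blue
  -- density to A is at least 1 - 1/S. The degree sum allows only (1/k + 1/S) N (# A)^k, and the
  -- Bernoulli error costs another N / S.
  deficient-small : ∀ k S A → 0 < k → 0 < S → 2 * k * S ≤ # A →
    k * S * sum (λ z → deg B A z ^ k) ≤ (S + k) * N * # A ^ k → k * S * # (deficient R (2 * k * S) A) ≤ (S + 2 * k) * N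
  deficient-small k S A k>0 S>0 t≤a bound = *-cancelˡ-≤′ (t * p) (0<* t>0 (0<^ k a>0)) (begin
    t * p * (k * S * # Z) ≡⟨ e₁ t p (k * S) (# Z) ⟩
    k * S * (# Z * (t * p)) ≡⟨ cong (k * S *_) (sum-*ʳ (t * p) (λ z → ⟦ Z z ⟧)) ⟨
    k * S * sum (λ z → ⟦ Z z ⟧ * (t * p)) ≤⟨ *-monoʳ-≤ (k * S) (sum-mono (λ z → ⟦⟧*≤ (Z z) (pointwise z))) ⟩
    k * S * sum (λ z → t * deg B A z ^ k + 2 * k * p)
      ≡⟨ cong (k * S *_) (trans (∑-distrib-+ (λ z → t * deg B A z ^ k) (λ _ → 2 * k * p)) (cong₂ _+_ (sum-*ˡ t (λ z → deg B A z ^ k)) (sum-const N (2 * k * p)))) ⟩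
    k * S * (t * Σb + N * (2 * k * p)) ≡⟨ e₂ (k * S) t Σb N k p ⟩
    t * (k * S * Σb) + N * (2 * k * (k * S) * p) ≤⟨ +-monoˡ-≤ _ (*-monoʳ-≤ t bound) ⟩
    t * ((S + k) * N * p) + N * (2 * k * (k * S) * p) ≡⟨ e₃ k S N p ⟩
    t * p * ((S + 2 * k) * N) ∎)
    where
    open ≤-Reasoning
    t a p Σb : ℕ
    t = 2 * k * S
    a = # A
    p = a ^ k
    Σb = sum (λ z → deg B A z ^ k)
    Z : VSet N
    Z = deficient R t A
    t>0 : 0 < t
    t>0 = 0<* (0<* {2} {k} (s≤s z≤n) k>0) S>0
    a>0 : 0 < a
    a>0 = ≤-trans t>0 t≤a
    e₁ : ∀ t p c z → t * p * (c * z) ≡ c * (z * (t * p))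
    e₁ = solve-∀
    e₂ : ∀ c t s N k p → c * (t * s + N * (2 * k * p)) ≡ t * (c * s) + N * (2 * k * c * p)
    e₂ = solve-∀
    e₃ : ∀ k S N p → 2 * k * S * ((S + k) * N * p) + N * (2 * k * (k * S) * p) ≡ 2 * k * S * p * ((S + 2 * k) * N)
    e₃ = solve-∀
    pointwise : ∀ z → Z z ≡ true → t * p ≤ t * deg B A z ^ k + 2 * k * p
    pointwise z Zz = *-cancelˡ-≤′ a a>0 (begin
      a * (t * p) ≡⟨ e₄ a t p ⟩
      t * (a * p) ≤⟨ *-monoʳ-≤ t (bernoulli-deg B k A z) ⟩
      t * (a * deg B A z ^ k + k * missing B A z * p) ≡⟨ e₅ t a (deg B A z ^ k) k (missing B A z) p ⟩
      a * (t * deg B A z ^ k) + k * (t * missing B A z) * p ≤⟨ +-monoʳ-≤ (a * (t * deg B A z ^ k)) (*-monoˡ-≤ p (*-monoʳ-≤ k t·missing≤)) ⟩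
      a * (t * deg B A z ^ k) + k * (2 * a) * p ≡⟨ e₆ a (t * deg B A z ^ k) k p ⟩
      a * (t * deg B A z ^ k + 2 * k * p) ∎)
      where
      e₄ : ∀ a t p → a * (t * p) ≡ t * (a * p)
      e₄ = solve-∀
      e₅ : ∀ t a q k m p → t * (a * q + k * m * p) ≡ a * (t * q) + k * (t * m) * p
      e₅ = solve-∀
      e₆ : ∀ a q k p → a * q + k * (2 * a) * p ≡ a * (q + 2 * k * p)
      e₆ = solve-∀
      t·missing≤ : t * missing B A z ≤ 2 * a
      t·missing≤ = begin
        t * missing B A z ≤⟨ *-monoʳ-≤ t (missing≤ A z) ⟩
        t * (deg R A z + 1) ≡⟨ trans (*-distribˡ-+ t (deg R A z) 1) (cong (t * deg R A z +_) (*-identityʳ t)) ⟩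
        t * deg R A z + t ≤⟨ +-mono-≤ (<⇒≤ (⌊⌋-true (t * deg R A z <? a) Zz)) t≤a ⟩
        a + a ≡⟨ cong (a +_) (+-identityʳ a) ⟨
        2 * a ∎

-- Choosing the blobs

-- After j blobs, U consists of the vertices in no deficient set, and part i of those in no deficient set except possibly the i-th.
record Blobs {N : ℕ} (R : Fin N → Fin N → Bool) (k S j r e : ℕ) : Set where
  field
    U    : VSet N
    part : Fin j → VSet N
    U-large      : k * S * N ≤ k * S * # U + j * ((S + 2 * k) * N)
    part-large   : ∀ i → k * S * N + (S + 2 * k) * N ≤ k * S * # (part i) + j * ((S + 2 * k) * N)
    U⊆part       : ∀ i → U ⊆ part i
    part∩part⊆U  : ∀ i i′ → i ≢ i′ → part i ∩ part i′ ⊆ U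
    U-few        : e * clq R r U ≤ N ^ r
    part-few     : ∀ i → e * clq R (suc r) (part i) ≤ N ^ suc r

#∖-lower : ∀ {N} (U Z : VSet N) c x n → n ≤ c * # U → c * # Z ≤ x → n ≤ c * # (U ∖ Z) + x
#∖-lower U Z c x n p q = begin
  n ≤⟨ p ⟩
  c * # U ≡⟨ trans (cong (c *_) (#-split U Z)) (*-distribˡ-+ c (# (U ∩ Z)) (# (U ∖ Z))) ⟩
  c * # (U ∩ Z) + c * # (U ∖ Z) ≡⟨ +-comm (c * # (U ∩ Z)) (c * # (U ∖ Z)) ⟩
  c * # (U ∖ Z) + c * # (U ∩ Z) ≤⟨ +-monoʳ-≤ (c * # (U ∖ Z)) (≤-trans (*-monoʳ-≤ c (#-mono {A = U ∩ Z} {Z} (λ z p → proj₂ (∧-true {U z} p)))) q) ⟩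
  c * # (U ∖ Z) + x ∎
  where open ≤-Reasoning

-- The old `U` becomes the new part, because the newest deficient set is the only one not removed
-- from it. The clique bound needed for it is the old `U-few`, which is one clique size ahead of the
-- new one.
add-blob : ∀ {N} {R : Fin N → Fin N → Bool} {k S j r e′} e (b : Blobs R k S j (suc r) e′) (Z : VSet N) → k * S * # Z ≤ (S + 2 * k) * N →
  e * clq R r (Blobs.U b ∖ Z) ≤ N ^ r → (∀ i → e * clq R (suc r) (Blobs.part b i ∖ Z) ≤ N ^ suc r) → e ≤ e′ → Blobs R k S (suc j) r e
add-blob {N} {R} {k} {S} {j} {r} {e′} e b Z Z-small fewU fewPart e≤e′ = record
  { U = U ∖ Z
  ; part = part′
  ; U-large = shrink U (k * S * N) U-large
  ; part-large = part-large′
  ; U⊆part = U⊆part′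
  ; part∩part⊆U = part∩part⊆U′
  ; U-few = fewU
  ; part-few = part-few′
  }
  where
  open Blobs b
  x : ℕ
  x = (S + 2 * k) * N
  part′ : Fin (suc j) → VSet N
  part′ Fin.zero    = U
  part′ (Fin.suc i) = part i ∖ Z
  shrink : ∀ V n → n ≤ k * S * # V + j * x → n ≤ k * S * # (V ∖ Z) + suc j * x
  shrink V n p = begin
    n ≤⟨ p ⟩
    k * S * # V + j * x ≤⟨ +-monoˡ-≤ (j * x) (#∖-lower V Z (k * S) x (k * S * # V) ≤-refl Z-small) ⟩
    k * S * # (V ∖ Z) + x + j * x ≡⟨ +-assoc (k * S * # (V ∖ Z)) x (j * x) ⟩
    k * S * # (V ∖ Z) + suc j * x ∎
    where open ≤-Reasoning
  part-large′ : ∀ i → k * S * N + x ≤ k * S * # (part′ i) + suc j * x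
  part-large′ Fin.zero    = ≤-by U-large (≤-reflexive (e₁ (k * S * N) x (k * S * # U) (j * x)))
    where
    e₁ : ∀ a x u y → a + x + (u + y) ≡ u + (x + y) + a
    e₁ = solve-∀
  part-large′ (Fin.suc i) = shrink (part i) (k * S * N + x) (part-large i)
  U⊆part′ : ∀ i → U ∖ Z ⊆ part′ i
  U⊆part′ Fin.zero    z p = proj₁ (∧-true p)
  U⊆part′ (Fin.suc i) z p = ∧-intro (U⊆part i z (proj₁ (∧-true p))) (proj₂ (∧-true {U z} p))
  part∩part⊆U′ : ∀ i i′ → i ≢ i′ → part′ i ∩ part′ i′ ⊆ U ∖ Z
  part∩part⊆U′ Fin.zero    Fin.zero     i≢ z p = ⊥-elim (i≢ refl)
  part∩part⊆U′ Fin.zero    (Fin.suc i′) i≢ z p = ∧-intro (proj₁ (∧-true p)) (proj₂ (∧-true {part i′ z} (proj₂ (∧-true {U z} p))))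
  part∩part⊆U′ (Fin.suc i) Fin.zero     i≢ z p = ∧-intro (proj₂ (∧-true {part i z ∧ not (Z z)} p)) (proj₂ (∧-true {part i z} (proj₁ (∧-true p))))
  part∩part⊆U′ (Fin.suc i) (Fin.suc i′) i≢ z p = ∧-intro
    (part∩part⊆U i i′ (λ eq → i≢ (cong Fin.suc eq)) z (∧-intro (proj₁ (∧-true {part i z} (proj₁ (∧-true p)))) (proj₁ (∧-true {part i′ z} (proj₂ (∧-true {part i z ∧ not (Z z)} p))))))
    (proj₂ (∧-true {part i z} (proj₁ (∧-true p))))
  part-few′ : ∀ i → e * clq R (suc r) (part′ i) ≤ N ^ suc r
  part-few′ Fin.zero    = ≤-trans (*-monoˡ-≤ (clq R (suc r) U) e≤e′) U-few
  part-few′ (Fin.suc i) = fewPart i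

-- After j ≤ k - 1 deficient sets, a proportion of at least 1/k - 2j/S of the vertices remains, and
-- S ≥ 4k² makes the loss 2j/S less than half of 1/k.
untouched-large : ∀ k S j s u N → j + suc s ≡ k → 0 < S → 4 * (k * k) ≤ S → k * S * N ≤ k * S * u + j * ((S + 2 * k) * N) → N ≤ 2 * k * u
untouched-large k S j s u N refl S>0 S-large p = *-cancelˡ-≤′ S S>0 (≤-by (+-mono-≤ (*-monoʳ-≤ 2 p) (*-monoˡ-≤ N S-large))
    (≤-trans (m≤m+n _ (4 * (s + 1) * k * N + 2 * s * S * N)) (≤-reflexive (e₁ j s S u N))))
  where
  e₁ : ∀ j s S u N → S * N + (2 * ((j + suc s) * S * u + j * ((S + 2 * (j + suc s)) * N)) + S * N) + (4 * (s + 1) * (j + suc s) * N + 2 * s * S * N)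
    ≡ S * (2 * (j + suc s) * u) + (2 * ((j + suc s) * S * N) + 4 * ((j + suc s) * (j + suc s)) * N)
  e₁ = solve-∀

-- R and B are the red and blue graphs; `poor` bounds the books by (1/k + 1/(3S)) N.
record BookFree {N : ℕ} (R B : Fin N → Fin N → Bool) (k S q : ℕ) : Set where
  field
    R-sym : ∀ x y → R x y ≡ R y x
    cover : ∀ x y → B x y ≡ false → R x y ≡ true ⊎ x ≡ y
    rich  : Vec (Fin N) k → Bool
    poor  : ∀ f → isClique B f ≡ true → rich f ≡ false → 3 * k * S * ext B f ≤ (3 * S + k) * N
    few   : q * richCliques B k rich ≤ N ^ k

BookFree-mono : ∀ {N} {R B : Fin N → Fin N → Bool} {k S q q′} → q ≤ q′ → BookFree R B k S q′ → BookFree R B k S q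
BookFree-mono q≤q′ h = record
  { R-sym = R-sym ; cover = cover ; rich = rich ; poor = poor ; few = ≤-trans (*-monoˡ-≤ (richCliques _ _ rich) q≤q′) few }
  where open BookFree h

module Choose (k S : ℕ) (k>0 : 0 < k) (S>0 : 0 < S) (S-large : 4 * (k * k) ≤ S) where

  -- The threshold required by `deficient-small` and the sparsity of `conf` required by
  -- `book-bound`.
  t b₀ : ℕ
  t  = 2 * k * S
  b₀ = 3 * (k * k) * S

  t>0 : 0 < t
  t>0 = 0<* (0<* {2} {k} (s≤s z≤n) k>0) S>0

  module Step (s e : ℕ) where
    τ D P : ℕ
    τ = 2 * t
    -- The summands serve the two applications of `few-cliques-outside`: to red K_{1+s} in `U` and
    -- to red K_{2+s} in the earlier parts.
    D = suc (2 * e * ((1 + s) * τ ^ (1 + s)) + 2 * e * ((2 + s) * τ ^ (2 + s)))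
    -- The loss of size in `stable-subset` for M = τ ^ (2 + s), the most by which extending a red
    -- K_{2+s} greedily shrinks a blob.
    P = suc (τ ^ (2 + s) + 2 * t) ^ suc (4 * (t * t) * D * (τ ^ (2 + s)))
    -- Passing to a subset smaller by a factor P can raise the density of red pairs by P², so this
    -- factor is requested in advance.
    sparse = sparse-subset (2 + s) (2 * b₀ * (P * P)) (2 * k)
    m₀ e₀ m E q n₀ : ℕ
    m₀ = proj₁ sparse
    e₀ = proj₁ (proj₂ sparse)
    m = m₀ * P
    -- Rarity required before the step: `e` for the part that the old `U` becomes, `e₀` to find a
    -- sparse set, the other summands for removing the deficient set from `U` and from the parts.
    E = e + (e₀ + 2 * e * m * τ ^ (1 + s) + 2 * e * m * τ ^ (2 + s))
    q = 3 * S * m ^ k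
    n₀ = suc (m * (2 * b₀ + t))

    e₀≤E : e₀ ≤ E
    e₀≤E = ≤-trans (≤-trans (m≤m+n e₀ (2 * e * m * τ ^ (1 + s))) (m≤m+n (e₀ + 2 * e * m * τ ^ (1 + s)) (2 * e * m * τ ^ (2 + s)))) (m≤n+m (e₀ + 2 * e * m * τ ^ (1 + s) + 2 * e * m * τ ^ (2 + s)) e)

    -- The constants of a blob depend only on those of the blobs chosen after it, so they are fixed backwards.
    next : ∀ {N} {R B : Fin N → Fin N → Bool} → n₀ ≤ N → BookFree R B k S q → ∀ {j} → j + suc s ≡ k →
      Blobs R k S j (2 + s) E → Blobs R k S (suc j) (1 + s) e
    next {N} {R} {B} N-large h {j} j+s≡k b = add-blob e b Z Z-small
        (few-cliques-outside R R-sym t (2 + s) D e E m (1 + s) t>0 (s≤s z≤n) N>0 (n≤1+n (1 + s)) A-stable A⊆U A-large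
          (≤-trans (m≤m+n _ _) (n≤1+n _)) (≤-trans (≤-trans (m≤n+m _ e₀) (m≤m+n _ _)) (m≤n+m _ e)) U-few)
        (λ i → few-cliques-outside R R-sym t (2 + s) D e E m (2 + s) t>0 (s≤s z≤n) N>0 ≤-refl A-stable (λ x p → U⊆part i x (A⊆U x p)) A-large
          (≤-trans (m≤n+m _ (2 * e * ((1 + s) * τ ^ (1 + s)))) (n≤1+n _)) (≤-trans (m≤n+m _ _) (m≤n+m _ e)) (part-few i))
        (m≤m+n e _)
      where
      open Blobs b
      open BookFree h
      N>0 : 0 < N
      N>0 = ≤-trans (s≤s z≤n) N-large
      sub : Σ (VSet N) λ A → A ⊆ U × N ≤ m₀ * # A × 2 * b₀ * (P * P) * clq R 2 A ≤ # A * # A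
      sub = proj₂ (proj₂ sparse) R U N>0 (untouched-large k S j s (# U) N j+s≡k S>0 S-large U-large)
        (≤-trans (*-monoˡ-≤ (clq R (2 + s) U) e₀≤E) U-few)
      A₀ : VSet N
      A₀ = proj₁ sub
      A₀>0 : 0 < # A₀
      A₀>0 = 0<m*n⇒0<n (m₀) (# A₀) (≤-trans N>0 (proj₁ (proj₂ (proj₂ sub))))
      blob : StablePart R t (τ ^ (2 + s)) D (suc (4 * (t * t) * D * (τ ^ (2 + s)))) A₀
      blob = stable-subset R t (τ ^ (2 + s)) D A₀ A₀>0 N>0
      A : VSet N
      A = proj₁ blob
      A⊆A₀ : A ⊆ A₀
      A⊆A₀ = proj₁ (proj₂ blob)
      A₀≤ : # A₀ ≤ P * # A
      A₀≤ = proj₁ (proj₂ (proj₂ blob))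
      A-stable : Stable R t (τ ^ (2 + s)) D A
      A-stable = proj₂ (proj₂ (proj₂ blob))
      A⊆U : A ⊆ U
      A⊆U x p = proj₁ (proj₂ sub) x (A⊆A₀ x p)
      A-large : N ≤ m * # A
      A-large = ≤-trans (proj₁ (proj₂ (proj₂ sub))) (≤-trans (*-monoʳ-≤ (m₀) A₀≤) (≤-reflexive (sym (*-assoc (m₀) P (# A)))))
      A>0 : 0 < # A
      A>0 = 0<m*n⇒0<n m (# A) (≤-trans N>0 A-large)
      m>0 : 0 < m
      m>0 = 0<m*n⇒0<m m (# A) (≤-trans N>0 A-large)
      P>0 : 0 < P
      P>0 = 0<^ (suc (4 * (t * t) * D * (τ ^ (2 + s)))) (s≤s z≤n)
      A-sparse : 2 * b₀ * clq R 2 A ≤ # A * # A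
      A-sparse = *-cancelˡ-≤′ (P * P) (0<* P>0 P>0) (begin
        P * P * (2 * b₀ * clq R 2 A) ≡⟨ e₁ P (2 * b₀) (clq R 2 A) ⟩
        2 * b₀ * (P * P) * clq R 2 A ≤⟨ *-monoʳ-≤ (2 * b₀ * (P * P)) (clq-mono R 2 A⊆A₀) ⟩
        2 * b₀ * (P * P) * clq R 2 A₀ ≤⟨ proj₂ (proj₂ (proj₂ sub)) ⟩
        # A₀ * # A₀ ≤⟨ *-mono-≤ A₀≤ A₀≤ ⟩
        P * # A * (P * # A) ≡⟨ e₂ P (# A) ⟩
        P * P * (# A * # A) ∎)
        where
        open ≤-Reasoning
        e₁ : ∀ P b c → P * P * (b * c) ≡ b * (P * P) * c
        e₁ = solve-∀
        e₂ : ∀ P a → P * a * (P * a) ≡ P * P * (a * a)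
        e₂ = solve-∀
      A-size : 2 * b₀ + t ≤ # A
      A-size = *-cancelˡ-≤′ m m>0 (≤-trans (≤-trans (n≤1+n (m * (2 * b₀ + t))) N-large) A-large)
      Z : VSet N
      Z = deficient R t A
      Z-small : k * S * # Z ≤ (S + 2 * k) * N
      Z-small = deficient-small R B cover k S A k>0 S>0 (≤-trans (m≤n+m t (2 * b₀)) A-size)
        (book-bound B k S m rich A k>0 m>0 A>0 poor few A-large (conf-sparse R B cover b₀ A A-sparse (≤-trans (m≤m+n (2 * b₀) t) A-size)))

  -- Recursion on the number s of blobs still to be chosen, with all constants settled before the
  -- graph is given. Clique size 1 + s with s blobs to go ends at size 1, when rarity in `U` means
  -- that `U` has few vertices.
  chain : ∀ s e → Σ ℕ λ E → Σ ℕ λ q → Σ ℕ λ n₀ → ∀ {N} {R B : Fin N → Fin N → Bool} → n₀ ≤ N → BookFree R B k S q →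
    ∀ {j} → j + s ≡ k → Blobs R k S j (1 + s) E → Blobs R k S k 1 e
  chain zero e = e , 0 , 0 , λ _ _ {j} eq b → subst (λ j → Blobs _ k S j 1 e) (trans (sym (+-identityʳ j)) eq) b
  chain (suc s) e with chain s e
  ... | E , q , n₀ , rest = Step.E s E , q + Step.q s E , n₀ + Step.n₀ s E , λ {_} {R} {B} N-large h {j} eq b →
    rest (≤-trans (m≤m+n n₀ _) N-large) (BookFree-mono (m≤m+n q _) h) (trans (sym (+-suc j s)) eq)
      (Step.next s E (≤-trans (m≤n+m _ n₀) N-large) (BookFree-mono (m≤n+m _ q) h) eq b)

  initial : ∀ {N} {R : Fin N → Fin N → Bool} E → E * clq R (suc k) (λ _ → true) ≤ N ^ suc k → Blobs R k S 0 (1 + k) E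
  initial {N} E few = record
    { U = λ _ → true
    ; part = λ ()
    ; U-large = ≤-reflexive (trans (cong (k * S *_) (sym (trans (sum-const N 1) (*-identityʳ N)))) (sym (+-identityʳ _)))
    ; part-large = λ ()
    ; U⊆part = λ ()
    ; part∩part⊆U = λ ()
    ; U-few = few
    ; part-few = λ ()
    }

-- Rebalancing a partition

size : ∀ {n k} → (Fin n → Fin k) → Fin k → ℕ
size p i = # (λ v → p v ≡ᶠ i)

sum-size : ∀ {n k} (p : Fin n → Fin k) → sum (size p) ≡ n
sum-size {n} p = trans (∑-comm (λ i v → ⟦ p v ≡ᶠ i ⟧)) (trans (sum-cong-≗ (λ v → #-single (p v))) (trans (sum-const n 1) (*-identityʳ n)))

f≤sum : ∀ {n} (f : Fin n → ℕ) i → f i ≤ sum f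
f≤sum f Fin.zero    = m≤m+n (f Fin.zero) _
f≤sum f (Fin.suc i) = ≤-trans (f≤sum (f ∘ Fin.suc) i) (m≤n+m _ (f Fin.zero))

≡ᶠ-single : ∀ {n} (f : Fin n → ℕ) i → 0 < f i → ∀ j → ⟦ i ≡ᶠ j ⟧ ≤ f j
≡ᶠ-single f i p j with i ≟F j
... | yes refl = p
... | no _     = z≤n

Rebalanced : ∀ {n k} → (Fin n → Fin k) → (Fin k → ℕ) → Set
Rebalanced {n} {k} p cap = Σ (Fin n → Fin k) λ p′ → (∀ i → size p′ i ≡ cap i) × # (λ v → not (p v ≡ᶠ p′ v)) ≤ sum (λ i → cap i ∸ size p i)

-- The first vertex keeps its part if there is still room; otherwise it goes to a part that the remaining vertices leave deficient.
rebalance : ∀ {n k} (p : Fin n → Fin k) (cap : Fin k → ℕ) → sum cap ≡ n → Rebalanced p cap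
rebalance {zero} p cap eq = p , (λ i → sym (n≤0⇒n≡0 (≤-trans (f≤sum cap i) (≤-reflexive eq)))) , z≤n
rebalance {suc n} {k} p cap eq = choose (cap c) refl
  where
  c : Fin k
  c = p Fin.zero
  g : Fin k → ℕ
  g = size (p ∘ Fin.suc)
  -- `cost` charges the first vertex, if it leaves its part, to the shortfall of the part i that
  -- receives it.
  assign : ∀ i → 0 < cap i → (∀ j → ⟦ i ≡ᶠ j ⟧ ≤ cap j → ⟦ i ≡ᶠ j ⟧ * ⟦ not (c ≡ᶠ i) ⟧ + (cap j ∸ ⟦ i ≡ᶠ j ⟧ ∸ g j) ≤ cap j ∸ (⟦ c ≡ᶠ j ⟧ + g j)) → Rebalanced p cap
  assign i room cost = p″ , sizes , (begin
      ⟦ not (c ≡ᶠ i) ⟧ + # (λ v → not (p (Fin.suc v) ≡ᶠ p′ v)) ≤⟨ +-monoʳ-≤ ⟦ not (c ≡ᶠ i) ⟧ (proj₂ (proj₂ rec)) ⟩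
      ⟦ not (c ≡ᶠ i) ⟧ + sum (λ j → cap′ j ∸ g j) ≡⟨ cong (_+ sum (λ j → cap′ j ∸ g j)) (trans (sum-*ʳ ⟦ not (c ≡ᶠ i) ⟧ (λ j → ⟦ i ≡ᶠ j ⟧)) (trans (cong (_* ⟦ not (c ≡ᶠ i) ⟧) (#-single i)) (*-identityˡ _))) ⟨
      sum (λ j → ⟦ i ≡ᶠ j ⟧ * ⟦ not (c ≡ᶠ i) ⟧) + sum (λ j → cap′ j ∸ g j) ≡⟨ ∑-distrib-+ (λ j → ⟦ i ≡ᶠ j ⟧ * ⟦ not (c ≡ᶠ i) ⟧) (λ j → cap′ j ∸ g j) ⟨
      sum (λ j → ⟦ i ≡ᶠ j ⟧ * ⟦ not (c ≡ᶠ i) ⟧ + (cap′ j ∸ g j)) ≤⟨ sum-mono (λ j → cost j (≡ᶠ-single cap i room j)) ⟩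
      sum (λ j → cap j ∸ (⟦ c ≡ᶠ j ⟧ + g j)) ∎)
    where
    open ≤-Reasoning
    cap′ : Fin k → ℕ
    cap′ j = cap j ∸ ⟦ i ≡ᶠ j ⟧
    eq′ : sum cap′ ≡ n
    eq′ = suc-injective (trans (trans (+-comm 1 (sum cap′)) (trans (cong (sum cap′ +_) (sym (#-single i)))
      (trans (sym (∑-distrib-+ cap′ (λ j → ⟦ i ≡ᶠ j ⟧))) (sum-cong-≗ (λ j → m∸n+n≡m (≡ᶠ-single cap i room j)))))) eq)
    rec : Rebalanced (p ∘ Fin.suc) cap′
    rec = rebalance (p ∘ Fin.suc) cap′ eq′
    p′ : Fin n → Fin k
    p′ = proj₁ rec
    p″ : Fin (suc n) → Fin k
    p″ Fin.zero    = i
    p″ (Fin.suc v) = p′ v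
    sizes : ∀ j → ⟦ i ≡ᶠ j ⟧ + size p′ j ≡ cap j
    sizes j = trans (cong (⟦ i ≡ᶠ j ⟧ +_) (proj₁ (proj₂ rec) j)) (m+[n∸m]≡n (≡ᶠ-single cap i room j))
  choose : ∀ m → cap c ≡ m → Rebalanced p cap
  choose (suc m) eqc = assign c (≤-trans (s≤s z≤n) (≤-reflexive (sym eqc))) stay
    where
    stay : ∀ j → ⟦ c ≡ᶠ j ⟧ ≤ cap j → ⟦ c ≡ᶠ j ⟧ * ⟦ not (c ≡ᶠ c) ⟧ + (cap j ∸ ⟦ c ≡ᶠ j ⟧ ∸ g j) ≤ cap j ∸ (⟦ c ≡ᶠ j ⟧ + g j)
    stay j _ rewrite ≡ᶠ-refl c | *-zeroʳ ⟦ c ≡ᶠ j ⟧ = ≤-reflexive (∸-+-assoc (cap j) ⟦ c ≡ᶠ j ⟧ (g j))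
  -- The part c is full, but the total capacity n + 1 exceeds the n remaining vertices, so some i
  -- has `g i < cap i`. Filling that place lowers its shortfall by one, which pays for the move.
  choose zero eqc with sum-pigeon cap g (≤-reflexive (trans (cong suc (sum-size (p ∘ Fin.suc))) (sym eq)))
  ... | i , room = assign i (≤-trans (s≤s z≤n) room) move
    where
    drop : ∀ a b → b < a → 1 * 1 + (a ∸ 1 ∸ b) ≤ a ∸ b
    drop (suc a) b (s≤s q) = ≤-reflexive (sym (+-∸-assoc 1 q))
    move : ∀ j → ⟦ i ≡ᶠ j ⟧ ≤ cap j → ⟦ i ≡ᶠ j ⟧ * ⟦ not (c ≡ᶠ i) ⟧ + (cap j ∸ ⟦ i ≡ᶠ j ⟧ ∸ g j) ≤ cap j ∸ (⟦ c ≡ᶠ j ⟧ + g j)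
    move j _ with c ≟F j | i ≟F j | c ≟F i
    ... | yes refl | yes refl | _ = ⊥-elim (n≮0 (≤-trans room (≤-reflexive eqc)))
    ... | yes refl | no _ | _ rewrite eqc = ≤-reflexive (0∸n≡0 (g c))
    ... | no c≢j | yes refl | yes refl = ⊥-elim (c≢j refl)
    ... | no c≢j | yes refl | no _ = drop (cap i) (g i) room
    ... | no _ | no _ | _ = ≤-refl

balanced-caps : ∀ k q r → r ≤ k → Σ (Fin k → ℕ) λ cap → sum cap ≡ k * q + r × ∀ i → q ≤ cap i × cap i ≤ suc q
balanced-caps zero q zero _ = (λ ()) , refl , λ ()
balanced-caps (suc k) q zero _ = (λ _ → q) , trans (sum-const (suc k) q) (sym (+-identityʳ _)) , λ _ → ≤-refl , n≤1+n q
balanced-caps (suc k) q (suc r) (s≤s r≤k) with balanced-caps k q r r≤k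
... | cap , eq , near = cap′ , trans (cong (suc q +_) eq) (e₁ q (k * q) r) , near′
  where
  cap′ : Fin (suc k) → ℕ
  cap′ Fin.zero    = suc q
  cap′ (Fin.suc i) = cap i
  near′ : ∀ i → q ≤ cap′ i × cap′ i ≤ suc q
  near′ Fin.zero    = n≤1+n q , ≤-refl
  near′ (Fin.suc i) = near i
  e₁ : ∀ q x r → suc q + (x + r) ≡ q + x + suc r
  e₁ = solve-∀

-- Blue edges leaving a nearly blue set

scaled-power : ∀ k s a x → 0 < k → s * x * a ^ k ≤ a * (a ^ k + s ^ k * x ^ k)
-- With y = s x / a the claim reads y ≤ 1 + y ^ k, by comparing y with 1. It turns bounds on k-th
-- powers of degrees into bounds on degrees.
scaled-power (suc k) s a x _ with ≤-total (s * x) a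
... | inj₁ p = *-mono-≤ p (m≤m+n (a ^ suc k) (s ^ suc k * x ^ suc k))
... | inj₂ p = begin
  s * x * (a * a ^ k) ≡⟨ e₁ (s * x) a (a ^ k) ⟩
  a * (s * x * a ^ k) ≤⟨ *-monoʳ-≤ a (*-monoʳ-≤ (s * x) (^-monoˡ-≤ k p)) ⟩
  a * (s * x) ^ suc k ≡⟨ cong (a *_) (^-*-distrib s x (suc k)) ⟩
  a * (s ^ suc k * x ^ suc k) ≤⟨ *-monoʳ-≤ a (m≤n+m (s ^ suc k * x ^ suc k) (a ^ suc k)) ⟩
  a * (a ^ suc k + s ^ suc k * x ^ suc k) ∎
  where
  open ≤-Reasoning
  e₁ : ∀ y a q → y * (a * q) ≡ a * (y * q)
  e₁ = solve-∀

module _ {N : ℕ} (B : Fin N → Fin N → Bool) where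

  crossing : VSet N → ℕ
  crossing A = sum (λ z → ⟦ not (A z) ⟧ * deg B A z)

  -- Let a = # A. By Bernoulli the vertices of A contribute at least (1 - 1/(3kS)) a^{k+1} to the
  -- degree sum. As a is close to N / k or larger, at most 4k N a^k / S is left for the vertices
  -- outside. By `scaled-power` a degree is at most a / s plus a multiple of its k-th power, and 4k
  -- s^k ≤ S makes the second share, summed over all z, no larger than the first.
  crossing-bound : ∀ k S s A → 0 < k → 0 < S → 0 < # A → 4 * k * s ^ k ≤ S → (S + 2 * k) * N ≤ k * S * # A + 2 * (k * k) * N → 3 * (k * k) * S * conf B A ≤ # A * # A →
    k * S * sum (λ z → deg B A z ^ k) ≤ (S + k) * N * # A ^ k → s * crossing A ≤ 2 * (N * N)
  crossing-bound k S s A k>0 S>0 a>0 S-large A-large sparse bound = ≤-trans (*-cancelˡ-≤′ (S * p) (0<* S>0 (0<^ k a>0)) (begin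
      S * p * (s * crossing A) ≡⟨ e₁ S p s (crossing A) ⟩
      S * (s * p * crossing A) ≡⟨ cong (S *_) (sum-*ˡ (s * p) (λ z → ⟦ not (A z) ⟧ * deg B A z)) ⟨
      S * sum (λ z → s * p * (⟦ not (A z) ⟧ * deg B A z)) ≤⟨ *-monoʳ-≤ S (sum-mono pointwise) ⟩
      S * sum (λ z → a * p + a * s ^ k * (⟦ not (A z) ⟧ * deg B A z ^ k))
        ≡⟨ cong (S *_) (trans (∑-distrib-+ (λ _ → a * p) (λ z → a * s ^ k * (⟦ not (A z) ⟧ * deg B A z ^ k))) (cong₂ _+_ (sum-const N (a * p)) (sum-*ˡ (a * s ^ k) (λ z → ⟦ not (A z) ⟧ * deg B A z ^ k)))) ⟩
      S * (N * (a * p) + a * s ^ k * out) ≡⟨ e₂ S N a p (s ^ k) out ⟩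
      a * (S * N * p + s ^ k * (S * out)) ≤⟨ *-monoʳ-≤ a (+-monoʳ-≤ (S * N * p) (≤-trans (*-monoʳ-≤ (s ^ k) out≤) (≤-trans (≤-reflexive (e₃ k (s ^ k) (N * p))) (*-monoˡ-≤ (N * p) S-large)))) ⟩
      a * (S * N * p + S * (N * p)) ≡⟨ e₄ a S N p ⟩
      S * p * (2 * (a * N)) ∎))
      (*-monoʳ-≤ 2 (*-monoˡ-≤ N (#≤N A)))
    where
    open ≤-Reasoning
    a p out inn : ℕ
    a = # A
    p = a ^ k
    out = sum (λ z → ⟦ not (A z) ⟧ * deg B A z ^ k)
    inn = sum (λ z → ⟦ A z ⟧ * deg B A z ^ k)
    e₁ : ∀ S p s c → S * p * (s * c) ≡ S * (s * p * c)
    e₁ = solve-∀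
    e₂ : ∀ S N a p s o → S * (N * (a * p) + a * s * o) ≡ a * (S * N * p + s * (S * o))
    e₂ = solve-∀
    e₃ : ∀ k s q → s * (4 * k * q) ≡ 4 * k * s * q
    e₃ = solve-∀
    e₄ : ∀ a S N p → a * (S * N * p + S * (N * p)) ≡ S * p * (2 * (a * N))
    e₄ = solve-∀
    pointwise : ∀ z → s * p * (⟦ not (A z) ⟧ * deg B A z) ≤ a * p + a * s ^ k * (⟦ not (A z) ⟧ * deg B A z ^ k)
    pointwise z with not (A z)
    ... | false = ≤-trans (≤-reflexive (*-zeroʳ (s * p))) z≤n
    ... | true  = ≤-trans (≤-reflexive (e₅ s p (deg B A z))) (≤-trans (scaled-power k s a (deg B A z) k>0) (≤-reflexive (e₆ a p (s ^ k) (deg B A z ^ k))))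
      where
      e₅ : ∀ s p x → s * p * (1 * x) ≡ s * x * p
      e₅ = solve-∀
      e₆ : ∀ a p s x → a * (p + s * x) ≡ a * p + a * s * (1 * x)
      e₆ = solve-∀
    in+out : sum (λ z → deg B A z ^ k) ≡ inn + out
    in+out = trans (sum-cong-≗ (λ z → split (A z) (deg B A z ^ k))) (∑-distrib-+ (λ z → ⟦ A z ⟧ * deg B A z ^ k) (λ z → ⟦ not (A z) ⟧ * deg B A z ^ k))
      where
      split : ∀ b x → x ≡ ⟦ b ⟧ * x + ⟦ not b ⟧ * x
      split false x = sym (*-identityˡ x)
      split true  x = sym (trans (+-identityʳ (1 * x)) (*-identityˡ x))
    inside : a * (a * p) ≤ a * inn + k * p * conf B A
    inside = begin
      a * (a * p) ≡⟨ sum-*ʳ (a * p) (λ z → ⟦ A z ⟧) ⟨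
      sum (λ z → ⟦ A z ⟧ * (a * p)) ≤⟨ sum-mono (λ z → *-monoʳ-≤ ⟦ A z ⟧ (bernoulli-deg B k A z)) ⟩
      sum (λ z → ⟦ A z ⟧ * (a * deg B A z ^ k + k * missing B A z * p)) ≡⟨ sum-cong-≗ (λ z → e₇ ⟦ A z ⟧ a (deg B A z ^ k) k (missing B A z) p) ⟩
      sum (λ z → a * (⟦ A z ⟧ * deg B A z ^ k) + k * p * (⟦ A z ⟧ * missing B A z))
        ≡⟨ trans (∑-distrib-+ (λ z → a * (⟦ A z ⟧ * deg B A z ^ k)) (λ z → k * p * (⟦ A z ⟧ * missing B A z))) (cong₂ _+_ (sum-*ˡ a (λ z → ⟦ A z ⟧ * deg B A z ^ k)) (sum-*ˡ (k * p) (λ z → ⟦ A z ⟧ * missing B A z))) ⟩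
      a * inn + k * p * conf B A ∎
      where
      e₇ : ∀ i a x k m p → i * (a * x + k * m * p) ≡ a * (i * x) + k * p * (i * m)
      e₇ = solve-∀
    inside′ : 3 * k * S * (a * p) ≤ 3 * k * S * inn + a * p
    inside′ = *-cancelˡ-≤′ a a>0 (≤-by (+-mono-≤ (*-monoʳ-≤ (3 * k * S) inside) (*-monoʳ-≤ p sparse)) (≤-reflexive (e₇ a k S p inn (conf B A))))
      where
      e₇ : ∀ a k S p i c → a * (3 * k * S * (a * p)) + (3 * k * S * (a * i + k * p * c) + p * (a * a)) ≡ a * (3 * k * S * i + a * p) + (3 * k * S * (a * (a * p)) + p * (3 * (k * k) * S * c))
      e₇ = solve-∀
    k≤k² : k ≤ k * k
    k≤k² = m≤m*n k k {{>-nonZero k>0}}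
    1≤k² : 1 ≤ k * k
    1≤k² = 0<* k>0 k>0
    out≤ : S * out ≤ 4 * k * (N * p)
    out≤ = *-cancelˡ-≤′ (3 * k) (0<* {3} {k} (s≤s z≤n) k>0) (≤-by
      (+-mono-≤ (+-mono-≤ (+-mono-≤ inside′ (*-monoʳ-≤ 3 (≤-trans (≤-reflexive (cong (k * S *_) (sym in+out))) bound))) (*-monoʳ-≤ (3 * p) A-large))
        (+-mono-≤ (*-monoˡ-≤ p (#≤N A)) (+-mono-≤ (*-monoˡ-≤ (3 * (N * p)) k≤k²) (*-monoˡ-≤ (3 * (N * p)) 1≤k²))))
      (≤-trans (m≤m+n _ (6 * k * (N * p) + 2 * (N * p))) (≤-reflexive (e₇ k S N a p inn out))))
      where
      e₇ : ∀ k S N a p i o →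
        3 * k * (S * o) + (3 * k * S * i + a * p + 3 * ((S + k) * N * p) + 3 * p * (k * S * a + 2 * (k * k) * N) + (N * p + (k * k * (3 * (N * p)) + k * k * (3 * (N * p))))) + (6 * k * (N * p) + 2 * (N * p))
        ≡ 3 * k * (4 * k * (N * p)) + (3 * k * S * (a * p) + 3 * (k * S * (i + o)) + 3 * p * ((S + 2 * k) * N) + (a * p + (k * (3 * (N * p)) + 1 * (3 * (N * p)))))
      e₇ = solve-∀

-- Edges at odds with a partition

mismatch : ∀ {N k} → (R B : Fin N → Fin N → Bool) → (Fin N → Fin k) → ℕ
mismatch R B p = sum (λ x → sum (λ y → ⟦ (p x ≡ᶠ p y) ∧ R x y ⟧ + ⟦ not (p x ≡ᶠ p y) ∧ B x y ⟧))

≡ᶠ-true : ∀ {n} {i j : Fin n} → (i ≡ᶠ j) ≡ true → i ≡ j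
≡ᶠ-true {i = i} {j} = ⌊⌋-true (i ≟F j)

false≢true : ∀ {A : Set} {b} → b ≡ false → b ≡ true → A
false≢true refl ()

module Partition {N k : ℕ} (R B : Fin N → Fin N → Bool) (part : Fin k → VSet N) (U : VSet N)
  (overlaps : ∀ i i′ → i ≢ i′ → part i ∩ part i′ ⊆ U) (default : Fin k) where

  found : ∀ z → Dec (∃ λ i → part i z ≡ true)
  found z = any? (λ i → part i z ≟ true)

  lost : VSet N
  lost z = not ⌊ found z ⌋

  -- Only lost vertices receive `default`, and every pair with a lost vertex is written off. For the
  -- others the choice is forced outside U, where the parts are disjoint.
  home : Fin N → Fin k
  home z with found z
  ... | yes (i , _) = i
  ... | no _        = default

  part-home : ∀ z → lost z ≡ false → part (home z) z ≡ true
  part-home z with found z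
  ... | yes (i , p) = λ _ → p
  ... | no _        = λ ()

  home-unique : ∀ z i → part i z ≡ true → U z ≡ false → home z ≡ i
  home-unique z i p ¬U with found z
  ... | no ¬p = ⊥-elim (¬p (i , p))
  ... | yes (i′ , p′) with i′ ≟F i
  ... | yes eq = eq
  ... | no neq = false≢true ¬U (overlaps i′ i neq z (∧-intro p′ p))

  -- A lost vertex lies in no part, a vertex outside U in at most one, and a vertex of U in at most
  -- k. Since the parts have total size about N, few vertices can be lost.
  total+lost : sum (λ i → # (part i)) + # lost ≤ N + k * # U
  total+lost = begin
    sum (λ i → # (part i)) + # lost ≡⟨ cong (_+ # lost) (∑-comm (λ i z → ⟦ part i z ⟧)) ⟩
    sum (λ z → sum (λ i → ⟦ part i z ⟧)) + # lost ≡⟨ ∑-distrib-+ (λ z → sum (λ i → ⟦ part i z ⟧)) (λ z → ⟦ lost z ⟧) ⟨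
    sum (λ z → sum (λ i → ⟦ part i z ⟧) + ⟦ lost z ⟧) ≤⟨ sum-mono point ⟩
    sum (λ z → 1 + k * ⟦ U z ⟧) ≡⟨ trans (∑-distrib-+ (λ _ → 1) (λ z → k * ⟦ U z ⟧)) (cong₂ _+_ (trans (sum-const N 1) (*-identityʳ N)) (sum-*ˡ k (λ z → ⟦ U z ⟧))) ⟩
    N + k * # U ∎
    where
    open ≤-Reasoning
    none : ∀ z → lost z ≡ true → sum (λ i → ⟦ part i z ⟧) ≤ 0
    none z l = ≤-trans (sum-bound 0 (λ i → ≤-reflexive (cong ⟦_⟧ (absent i)))) (≤-reflexive (*-zeroʳ k))
      where
      absent : ∀ i → part i z ≡ false
      absent i with part i z in eq
      ... | false = refl
      ... | true  = ⊥-elim (⌊⌋-false (found z) (not-true l) (i , eq))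
    one : ∀ z → U z ≡ false → sum (λ i → ⟦ part i z ⟧) ≤ 1
    one z ¬U = ≤-trans (sum-mono (λ i → ⟦⟧-mono (λ p → ⌊⌋-intro (home z ≟F i) (home-unique z i p ¬U)))) (≤-reflexive (#-single (home z)))
    all : ∀ z → sum (λ i → ⟦ part i z ⟧) ≤ k * 1
    all z = sum-bound 1 (λ i → ⟦⟧≤1 (part i z))
    cases : ∀ c l u → (l ≡ true → c ≤ 0) → (u ≡ false → c ≤ 1) → c ≤ k * 1 → c + ⟦ l ⟧ ≤ 1 + k * ⟦ u ⟧
    cases c true  u     p q r = ≤-trans (+-monoˡ-≤ 1 (p refl)) (m≤m+n 1 (k * ⟦ u ⟧))
    cases c false true  p q r = ≤-trans (≤-reflexive (+-identityʳ c)) (m≤n⇒m≤1+n r)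
    cases c false false p q r = ≤-trans (≤-reflexive (+-identityʳ c)) (≤-trans (q refl) (m≤m+n 1 (k * 0)))
    point : ∀ z → sum (λ i → ⟦ part i z ⟧) + ⟦ lost z ⟧ ≤ 1 + k * ⟦ U z ⟧
    point z = cases (sum (λ i → ⟦ part i z ⟧)) (lost z) (U z) (none z) (one z) (all z)

  part≤size : ∀ i → # (part i) ≤ size home i + # U
  part≤size i = ≤-trans (sum-mono (λ z → point z (U z) refl)) (≤-reflexive (∑-distrib-+ (λ z → ⟦ home z ≡ᶠ i ⟧) (λ z → ⟦ U z ⟧)))
    where
    point : ∀ z u → U z ≡ u → ⟦ part i z ⟧ ≤ ⟦ home z ≡ᶠ i ⟧ + ⟦ u ⟧
    point z true  eq = ≤-trans (⟦⟧≤1 (part i z)) (m≤n+m 1 ⟦ home z ≡ᶠ i ⟧)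
    point z false eq = ≤-trans (⟦⟧-mono (λ p → ⌊⌋-intro (home z ≟F i) (home-unique z i p eq))) (m≤m+n _ 0)

  module _ (p′ : Fin N → Fin k) where

    moved : VSet N
    moved z = not (home z ≡ᶠ p′ z)

    atypical : Fin N → ℕ
    atypical z = ⟦ lost z ⟧ + ⟦ U z ⟧ + ⟦ moved z ⟧

    inside across : Fin N → Fin N → Fin k → ℕ
    inside x y i = ⟦ part i x ⟧ * ⟦ part i y ∧ R x y ⟧
    across x y i = ⟦ not (part i x) ⟧ * ⟦ part i y ∧ B x y ⟧

    -- If both vertices are typical, their new parts are the sets that contain them. A red pair
    -- within one part is then seen by `inside`, a blue pair between two parts by `across` at the
    -- part of y, which x avoids. Any other pair is charged 1.
    mismatch-pair : ∀ x y → ⟦ (p′ x ≡ᶠ p′ y) ∧ R x y ⟧ + ⟦ not (p′ x ≡ᶠ p′ y) ∧ B x y ⟧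
      ≤ atypical x + atypical y + (sum (inside x y) + sum (across x y))
    mismatch-pair x y = cases (lost x) (U x) (moved x) (lost y) (U y) (moved y) refl refl refl refl refl refl
      where
      same diff : Bool
      same = (p′ x ≡ᶠ p′ y) ∧ R x y
      diff = not (p′ x ≡ᶠ p′ y) ∧ B x y
      s : ℕ
      s = sum (inside x y) + sum (across x y)
      ≤1 : ∀ {n} → 1 ≤ n → ⟦ same ⟧ + ⟦ diff ⟧ ≤ n
      ≤1 = ≤-trans (exclusive (p′ x ≡ᶠ p′ y) (R x y) (B x y))
        where
        exclusive : ∀ b c d → ⟦ b ∧ c ⟧ + ⟦ not b ∧ d ⟧ ≤ 1
        exclusive true  c d = ≤-trans (≤-reflexive (+-identityʳ ⟦ c ⟧)) (⟦⟧≤1 c)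
        exclusive false c d = ⟦⟧≤1 d
      typical : lost x ≡ false → U x ≡ false → moved x ≡ false → lost y ≡ false → U y ≡ false → moved y ≡ false → ⟦ same ⟧ + ⟦ diff ⟧ ≤ s
      typical lx ux mx ly uy my = byCase (p′ x ≡ᶠ p′ y) (R x y) (B x y) refl refl refl
        where
        stays : ∀ z → moved z ≡ false → home z ≡ p′ z
        stays z m = ≡ᶠ-true (not-false m)
          where
          not-false : ∀ {b} → not b ≡ false → b ≡ true
          not-false {true} _ = refl
        px : part (p′ x) x ≡ true
        px = subst (λ i → part i x ≡ true) (stays x mx) (part-home x lx)
        py : part (p′ y) y ≡ true
        py = subst (λ i → part i y ≡ true) (stays y my) (part-home y ly)
        byCase : ∀ e r b → (p′ x ≡ᶠ p′ y) ≡ e → R x y ≡ r → B x y ≡ b → ⟦ e ∧ r ⟧ + ⟦ not e ∧ b ⟧ ≤ s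
        byCase true false b _ _ _ = z≤n
        byCase false r false _ _ _ = z≤n
        byCase true true b e r _ = ≤-trans (≤-reflexive (sym found-inside)) (≤-trans (f≤sum (inside x y) (p′ x)) (m≤m+n _ (sum (across x y))))
          where
          found-inside : inside x y (p′ x) ≡ 1
          found-inside rewrite px | subst (λ i → part i y ≡ true) (sym (≡ᶠ-true e)) py | r = refl
        byCase false r true e _ b = ≤-trans (≤-reflexive (sym found-across)) (≤-trans (f≤sum (across x y) (p′ y)) (m≤n+m _ (sum (inside x y))))
          where
          outside : part (p′ y) x ≡ false
          outside with part (p′ y) x in eq
          ... | false = refl
          ... | true  = ⊥-elim (⌊⌋-false (p′ x ≟F p′ y) e (trans (sym (stays x mx)) (home-unique x (p′ y) eq ux)))
          found-across : across x y (p′ y) ≡ 1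
          found-across rewrite outside | py | b = refl
      cases : ∀ lx ux mx ly uy my → lost x ≡ lx → U x ≡ ux → moved x ≡ mx → lost y ≡ ly → U y ≡ uy → moved y ≡ my →
        ⟦ same ⟧ + ⟦ diff ⟧ ≤ ⟦ lx ⟧ + ⟦ ux ⟧ + ⟦ mx ⟧ + (⟦ ly ⟧ + ⟦ uy ⟧ + ⟦ my ⟧) + s
      cases false false false false false false = typical
      cases true  _     _     _     _     _ _ _ _ _ _ _ = ≤1 (s≤s z≤n)
      cases false true  _     _     _     _ _ _ _ _ _ _ = ≤1 (s≤s z≤n)
      cases false false true  _     _     _ _ _ _ _ _ _ = ≤1 (s≤s z≤n)
      cases false false false true  _     _ _ _ _ _ _ _ = ≤1 (s≤s z≤n)
      cases false false false false true  _ _ _ _ _ _ _ = ≤1 (s≤s z≤n)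
      cases false false false false false true _ _ _ _ _ _ = ≤1 (s≤s z≤n)

    sum-atypical : sum atypical ≡ # lost + # U + # moved
    sum-atypical = trans (∑-distrib-+ (λ z → ⟦ lost z ⟧ + ⟦ U z ⟧) (λ z → ⟦ moved z ⟧)) (cong (_+ # moved) (∑-distrib-+ (λ z → ⟦ lost z ⟧) (λ z → ⟦ U z ⟧)))

    sum²-rotate : ∀ (g : Fin N → Fin N → Fin k → ℕ) → sum (λ x → sum (λ y → sum (g x y))) ≡ sum (λ i → sum (λ x → sum (λ y → g x y i)))
    sum²-rotate g = trans (sum-cong-≗ (λ x → ∑-comm (g x))) (∑-comm (λ x i → sum (λ y → g x y i)))

    mismatch-bound : mismatch R B p′ ≤ 2 * N * (# lost + # U + # moved) + (sum (λ i → clq R 2 (part i)) + sum (λ i → crossing B (part i)))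
    mismatch-bound = begin
      mismatch R B p′ ≤⟨ sum-mono (λ x → sum-mono (mismatch-pair x)) ⟩
      sum (λ x → sum (λ y → atypical x + atypical y + (sum (inside x y) + sum (across x y)))) ≡⟨ sum-cong-≗ row ⟩
      sum (λ x → N * atypical x + T + (sum (λ y → sum (inside x y)) + sum (λ y → sum (across x y))))
        ≡⟨ trans (∑-distrib-+ (λ x → N * atypical x + T) (λ x → sum (λ y → sum (inside x y)) + sum (λ y → sum (across x y))))
             (cong₂ _+_ (trans (∑-distrib-+ (λ x → N * atypical x) (λ _ → T)) (cong₂ _+_ (sum-*ˡ N atypical) (sum-const N T)))
                        (∑-distrib-+ (λ x → sum (λ y → sum (inside x y))) (λ x → sum (λ y → sum (across x y))))) ⟩
      N * T + N * T + (sum (λ x → sum (λ y → sum (inside x y))) + sum (λ x → sum (λ y → sum (across x y))))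
        ≡⟨ cong₂ _+_ (trans (e₁ N T) (cong (2 * N *_) sum-atypical)) (cong₂ _+_ insides acrosses) ⟩
      2 * N * (# lost + # U + # moved) + (sum (λ i → clq R 2 (part i)) + sum (λ i → crossing B (part i))) ∎
      where
      open ≤-Reasoning
      T : ℕ
      T = sum atypical
      e₁ : ∀ N T → N * T + N * T ≡ 2 * N * T
      e₁ = solve-∀
      row : ∀ x → sum (λ y → atypical x + atypical y + (sum (inside x y) + sum (across x y))) ≡ N * atypical x + T + (sum (λ y → sum (inside x y)) + sum (λ y → sum (across x y)))
      row x = trans (∑-distrib-+ (λ y → atypical x + atypical y) (λ y → sum (inside x y) + sum (across x y)))
        (cong₂ _+_ (trans (∑-distrib-+ (λ _ → atypical x) atypical) (cong (_+ T) (sum-const N (atypical x)))) (∑-distrib-+ (λ y → sum (inside x y)) (λ y → sum (across x y))))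
      insides : sum (λ x → sum (λ y → sum (inside x y))) ≡ sum (λ i → clq R 2 (part i))
      insides = trans (sum²-rotate inside) (sum-cong-≗ (λ i → trans (sum-cong-≗ (λ x → sum-*ˡ ⟦ part i x ⟧ (λ y → ⟦ part i y ∧ R x y ⟧))) (sym (clq-2 R (part i)))))
      acrosses : sum (λ x → sum (λ y → sum (across x y))) ≡ sum (λ i → crossing B (part i))
      acrosses = trans (sum²-rotate across) (sum-cong-≗ (λ i → sum-cong-≗ (λ x → sum-*ˡ ⟦ not (part i x) ⟧ (λ y → ⟦ part i y ∧ B x y ⟧))))

-- Accuracy of the final partition

module Parameters (k h : ℕ) (k>0 : 0 < k) (h>0 : 0 < h) where

  -- Three errors may each take N² / 4 after multiplication by h: blue edges leaving the parts,
  -- controlled by `s`; atypical vertices, by `64 * (k * k) * h` in `S`; red edges inside the parts,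
  -- by `4 * k * h` in `e`. The rest of `S` serves `crossing-bound` and keeps the parts above N /
  -- (2k). In `e`, the summand `S` makes `U` small, and the last summand turns rarity relative to N²
  -- into sparsity relative to the size of a part.
  s S b₀ e : ℕ
  s = 8 * k * h
  S = suc (4 * k * s ^ k + 64 * (k * k) * h + 4 * (k * k))
  b₀ = 3 * (k * k) * S
  e = S + 4 * k * h + 4 * (k * k) * (2 * b₀)

  S>0 : 0 < S
  S>0 = s≤s z≤n

  4k²≤S : 4 * (k * k) ≤ S
  4k²≤S = ≤-trans (m≤n+m (4 * (k * k)) (4 * k * s ^ k + 64 * (k * k) * h)) (n≤1+n _)

  64k²h≤S : 64 * (k * k) * h ≤ S
  64k²h≤S = ≤-trans (≤-trans (m≤n+m (64 * (k * k) * h) (4 * k * s ^ k)) (m≤m+n (4 * k * s ^ k + 64 * (k * k) * h) (4 * (k * k)))) (n≤1+n _)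

  4ks^k≤S : 4 * k * s ^ k ≤ S
  4ks^k≤S = ≤-trans (≤-trans (m≤m+n (4 * k * s ^ k) (64 * (k * k) * h)) (m≤m+n (4 * k * s ^ k + 64 * (k * k) * h) (4 * (k * k)))) (n≤1+n _)

  1≤k² : 1 ≤ k * k
  1≤k² = 0<* k>0 k>0

  k≤k² : k ≤ k * k
  k≤k² = m≤m*n k k {{>-nonZero k>0}}

  module _ {N q : ℕ} {R B : Fin N → Fin N → Bool} (free : BookFree R B k S q) (q-large : 3 * S * (2 * k) ^ k ≤ q)
    (blobs : Blobs R k S k 1 e) (N-large : 1 + k * S + 2 * k * (2 * b₀) ≤ N) where
    open BookFree free
    open Blobs blobs

    N>0 : 0 < N
    N>0 = ≤-trans (s≤s z≤n) N-large

    kS≤N : k * S ≤ N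
    kS≤N = ≤-trans (≤-trans (n≤1+n (k * S)) (m≤m+n (1 + k * S) (2 * k * (2 * b₀)))) N-large

    u : ℕ
    u = # U

    S·U≤N : S * u ≤ N
    S·U≤N = ≤-trans (*-monoˡ-≤ u (≤-trans (m≤m+n S (4 * k * h)) (m≤m+n (S + 4 * k * h) (4 * (k * k) * (2 * b₀)))))
      (≤-trans (≤-reflexive (cong (e *_) (sym (clq-1 R U)))) (≤-trans U-few (≤-reflexive (*-identityʳ N))))

    module _ (i : Fin k) where
      private
        A : VSet N
        A = part i

      part-large′ : (S + 2 * k) * N ≤ k * S * # A + 2 * (k * k) * N
      part-large′ = ≤-by (part-large i) (≤-reflexive (e₁ k S N (# A)))
        where
        e₁ : ∀ k S N a → (S + 2 * k) * N + (k * S * a + k * ((S + 2 * k) * N)) ≡ k * S * a + 2 * (k * k) * N + (k * S * N + (S + 2 * k) * N)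
        e₁ = solve-∀

      N≤2kA : N ≤ 2 * k * # A
      N≤2kA = *-cancelˡ-≤′ S S>0 (≤-by (+-mono-≤ (*-monoʳ-≤ 2 part-large′) (*-monoˡ-≤ N 4k²≤S)) (≤-trans (m≤m+n _ (4 * k * N)) (≤-reflexive (e₁ k S N (# A)))))
        where
        e₁ : ∀ k S N a → S * N + (2 * (k * S * a + 2 * (k * k) * N) + S * N) + 4 * k * N ≡ S * (2 * k * a) + (2 * ((S + 2 * k) * N) + 4 * (k * k) * N)
        e₁ = solve-∀

      A>0 : 0 < # A
      A>0 = 0<m*n⇒0<n (2 * k) (# A) (≤-trans N>0 N≤2kA)

      2k>0 : 0 < 2 * k
      2k>0 = 0<* {2} {k} (s≤s z≤n) k>0

      few₂ : e * clq R 2 A ≤ N * N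
      few₂ = ≤-trans (part-few i) (≤-reflexive (cong (N *_) (*-identityʳ N)))

      2b₀≤A : 2 * b₀ ≤ # A
      2b₀≤A = *-cancelˡ-≤′ (2 * k) 2k>0 (≤-trans (≤-trans (m≤n+m (2 * k * (2 * b₀)) (1 + k * S)) N-large) N≤2kA)

      A-sparse : 2 * b₀ * clq R 2 A ≤ # A * # A
      A-sparse = *-cancelˡ-≤′ (4 * (k * k)) (0<* {4} {k * k} (s≤s z≤n) 1≤k²) (begin
        4 * (k * k) * (2 * b₀ * clq R 2 A) ≡⟨ *-assoc (4 * (k * k)) (2 * b₀) (clq R 2 A) ⟨
        4 * (k * k) * (2 * b₀) * clq R 2 A ≤⟨ *-monoˡ-≤ (clq R 2 A) (m≤n+m (4 * (k * k) * (2 * b₀)) (S + 4 * k * h)) ⟩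
        e * clq R 2 A ≤⟨ few₂ ⟩
        N * N ≤⟨ *-mono-≤ N≤2kA N≤2kA ⟩
        2 * k * # A * (2 * k * # A) ≡⟨ e₁ k (# A) ⟩
        4 * (k * k) * (# A * # A) ∎)
        where
        open ≤-Reasoning
        e₁ : ∀ k a → 2 * k * a * (2 * k * a) ≡ 4 * (k * k) * (a * a)
        e₁ = solve-∀

      A-conf : b₀ * conf B A ≤ # A * # A
      A-conf = conf-sparse R B cover b₀ A A-sparse 2b₀≤A

      A-crossing : s * crossing B A ≤ 2 * (N * N)
      A-crossing = crossing-bound B k S s A k>0 S>0 A>0 4ks^k≤S part-large′ A-conf
        (book-bound B k S (2 * k) rich A k>0 2k>0 A>0 poor (≤-trans (*-monoˡ-≤ (richCliques B k rich) q-large) few) N≤2kA A-conf)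

    private
      default : Fin k
      default = fromℕ< k>0
    open Partition R B part U part∩part⊆U default

    lost≤ : S * # lost ≤ 2 * (k * k) * N + k * N
    lost≤ = *-cancelˡ-≤′ k k>0 (≤-by (+-mono-≤ summed (+-mono-≤ (*-monoʳ-≤ (k * S) total+lost) (*-monoʳ-≤ (k * k) S·U≤N))) (≤-trans (m≤m+n _ (2 * (k * k) * N)) (≤-reflexive (e₁ k S N (# lost) (sum (λ i → # (part i))) u))))
      where
      open ≤-Reasoning
      e₁ : ∀ k S N l p u → k * (S * l) + (k * S * p + k * (2 * (k * k) * N) + (k * S * (N + k * u) + k * k * N)) + 2 * (k * k) * N
        ≡ k * (2 * (k * k) * N + k * N) + (k * ((S + 2 * k) * N) + (k * S * (p + l) + k * k * (S * u)))
      e₁ = solve-∀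
      summed : k * ((S + 2 * k) * N) ≤ k * S * sum (λ i → # (part i)) + k * (2 * (k * k) * N)
      summed = begin
        k * ((S + 2 * k) * N) ≡⟨ sum-const k ((S + 2 * k) * N) ⟨
        sum {k} (λ _ → (S + 2 * k) * N) ≤⟨ sum-mono part-large′ ⟩
        sum (λ i → k * S * # (part i) + 2 * (k * k) * N) ≡⟨ trans (∑-distrib-+ (λ i → k * S * # (part i)) (λ _ → 2 * (k * k) * N)) (cong₂ _+_ (sum-*ˡ (k * S) (λ i → # (part i))) (sum-const k (2 * (k * k) * N))) ⟩
        k * S * sum (λ i → # (part i)) + k * (2 * (k * k) * N) ∎

    module _ (cap : Fin k → ℕ) (Q : ℕ) (kQ≤N : k * Q ≤ N) (cap≤ : ∀ i → cap i ≤ suc Q) where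

      -- `rebalance` pays only for shortfalls, so lower bounds on the parts suffice. A part has at
      -- least N/k - 2kN/S vertices, at most # U ≤ N / S of them have another home, and a capacity
      -- exceeds N / k by at most 1.
      deficit : ∀ i → S * (cap i ∸ size home i) ≤ N + 2 * k * N + S
      deficit i = ≤-trans (≤-reflexive (*-distribˡ-∸ S (cap i) (size home i))) (m≤n+o⇒m∸n≤o (S * cap i) (S * size home i)
        (*-cancelˡ-≤′ k k>0 (≤-by (+-mono-≤ (+-mono-≤ (*-monoʳ-≤ (k * S) (cap≤ i)) (*-monoʳ-≤ S kQ≤N)) (+-mono-≤ (part-large′ i) (+-mono-≤ (*-monoʳ-≤ (k * S) (part≤size i)) (*-monoʳ-≤ k S·U≤N))))
          (≤-trans (m≤m+n _ (2 * k * N)) (≤-reflexive (e₁ k S N Q (cap i) (# (part i)) (size home i) u))))))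
        where
        e₁ : ∀ k S N Q c a z u → k * (S * c) + (k * S * suc Q + S * N + (k * S * a + 2 * (k * k) * N + (k * S * (z + u) + k * N))) + 2 * k * N
          ≡ k * (S * z + (N + 2 * k * N + S)) + (k * S * c + S * (k * Q) + ((S + 2 * k) * N + (k * S * a + k * (S * u))))
        e₁ = solve-∀

      deficits : S * sum (λ i → cap i ∸ size home i) ≤ k * (N + 2 * k * N + S)
      deficits = ≤-trans (≤-reflexive (sym (sum-*ˡ S (λ i → cap i ∸ size home i)))) (sum-bound (N + 2 * k * N + S) deficit)

    close : Σ (Fin N → Fin k) λ p → (∀ i j → size p i ≤ size p j + 1) × h * mismatch R B p ≤ N * N
    close = p′ , balanced , *-cancelˡ-≤′ 4 (s≤s z≤n) (begin
      4 * (h * mismatch R B p′) ≤⟨ *-monoʳ-≤ 4 (*-monoʳ-≤ h (mismatch-bound p′)) ⟩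
      4 * (h * (2 * N * T + (sum (λ i → clq R 2 (part i)) + sum (λ i → crossing B (part i))))) ≡⟨ e₁ h N T (sum (λ i → clq R 2 (part i))) (sum (λ i → crossing B (part i))) ⟩
      8 * h * N * T + (4 * h * sum (λ i → clq R 2 (part i)) + 4 * h * sum (λ i → crossing B (part i))) ≤⟨ +-mono-≤ T≤ (+-mono-≤ inside≤ crossing≤) ⟩
      N * N + (N * N + N * N) ≤⟨ m≤m+n _ (N * N) ⟩
      N * N + (N * N + N * N) + N * N ≡⟨ e₂ (N * N) ⟩
      4 * (N * N) ∎)
      where
      open ≤-Reasoning
      instance
        k≢0 : NonZero k
        k≢0 = >-nonZero k>0
      caps : Σ (Fin k → ℕ) λ cap → sum cap ≡ k * (N / k) + N % k × ∀ i → N / k ≤ cap i × cap i ≤ suc (N / k)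
      caps = balanced-caps k (N / k) (N % k) (<⇒≤ (m%n<n N k))
      cap : Fin k → ℕ
      cap = proj₁ caps
      N≡ : N ≡ k * (N / k) + N % k
      N≡ = trans (m≡m%n+[m/n]*n N k) (trans (+-comm (N % k) (N / k * k)) (cong (_+ N % k) (*-comm (N / k) k)))
      kQ≤N : k * (N / k) ≤ N
      kQ≤N = ≤-trans (m≤m+n (k * (N / k)) (N % k)) (≤-reflexive (sym N≡))
      rebalanced : Rebalanced home cap
      rebalanced = rebalance home cap (trans (proj₁ (proj₂ caps)) (sym N≡))
      p′ : Fin N → Fin k
      p′ = proj₁ rebalanced
      balanced : ∀ i j → size p′ i ≤ size p′ j + 1
      balanced i j = ≤-trans (≤-reflexive (proj₁ (proj₂ rebalanced) i)) (≤-trans (proj₂ (proj₂ (proj₂ caps) i))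
        (≤-trans (s≤s (proj₁ (proj₂ (proj₂ caps) j))) (≤-reflexive (trans (+-comm 1 (cap j)) (cong (_+ 1) (sym (proj₁ (proj₂ rebalanced) j)))))))
      T : ℕ
      T = # lost + u + # (moved p′)
      moved≤ : S * # (moved p′) ≤ k * (N + 2 * k * N + S)
      moved≤ = ≤-trans (*-monoʳ-≤ S (proj₂ (proj₂ rebalanced))) (deficits cap (N / k) kQ≤N (λ i → proj₂ (proj₂ (proj₂ caps) i)))
      S·T≤ : S * T ≤ 8 * (k * k) * N
      S·T≤ = ≤-by (+-mono-≤ (+-mono-≤ lost≤ (+-mono-≤ S·U≤N moved≤)) (+-mono-≤ kS≤N (+-mono-≤ (*-monoʳ-≤ (2 * N) k≤k²) (*-monoʳ-≤ (2 * N) 1≤k²))))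
          (≤-reflexive (e₃ k S N (# lost) u (# (moved p′))))
        where
        e₃ : ∀ k S N l u m → S * (l + u + m) + (2 * (k * k) * N + k * N + (N + k * (N + 2 * k * N + S)) + (N + (2 * N * (k * k) + 2 * N * (k * k))))
          ≡ 8 * (k * k) * N + (S * l + (S * u + S * m) + (k * S + (2 * N * k + 2 * N * 1)))
        e₃ = solve-∀
      e₁ : ∀ h N T a c → 4 * (h * (2 * N * T + (a + c))) ≡ 8 * h * N * T + (4 * h * a + 4 * h * c)
      e₁ = solve-∀
      e₂ : ∀ n → n + (n + n) + n ≡ 4 * n
      e₂ = solve-∀
      T≤ : 8 * h * N * T ≤ N * N
      T≤ = *-cancelˡ-≤′ S S>0 (begin
        S * (8 * h * N * T) ≡⟨ e₄ S h N T ⟩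
        8 * h * N * (S * T) ≤⟨ *-monoʳ-≤ (8 * h * N) S·T≤ ⟩
        8 * h * N * (8 * (k * k) * N) ≡⟨ e₅ h N k ⟩
        64 * (k * k) * h * (N * N) ≤⟨ *-monoˡ-≤ (N * N) 64k²h≤S ⟩
        S * (N * N) ∎)
        where
        e₄ : ∀ S h N T → S * (8 * h * N * T) ≡ 8 * h * N * (S * T)
        e₄ = solve-∀
        e₅ : ∀ h N k → 8 * h * N * (8 * (k * k) * N) ≡ 64 * (k * k) * h * (N * N)
        e₅ = solve-∀
      inside≤ : 4 * h * sum (λ i → clq R 2 (part i)) ≤ N * N
      inside≤ = *-cancelˡ-≤′ k k>0 (begin
        k * (4 * h * sum (λ i → clq R 2 (part i))) ≡⟨ trans (e₄ k h (sum (λ i → clq R 2 (part i)))) (sym (sum-*ˡ (4 * k * h) (λ i → clq R 2 (part i)))) ⟩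
        sum (λ i → 4 * k * h * clq R 2 (part i)) ≤⟨ sum-bound (N * N) (λ i → ≤-trans (*-monoˡ-≤ (clq R 2 (part i)) (≤-trans (m≤n+m (4 * k * h) S) (m≤m+n (S + 4 * k * h) (4 * (k * k) * (2 * b₀))))) (few₂ i)) ⟩
        k * (N * N) ∎)
        where
        e₄ : ∀ k h x → k * (4 * h * x) ≡ 4 * k * h * x
        e₄ = solve-∀
      crossing≤ : 4 * h * sum (λ i → crossing B (part i)) ≤ N * N
      crossing≤ = *-cancelˡ-≤′ (2 * k) (0<* {2} {k} (s≤s z≤n) k>0) (begin
        2 * k * (4 * h * sum (λ i → crossing B (part i))) ≡⟨ trans (e₄ k h (sum (λ i → crossing B (part i)))) (sym (sum-*ˡ s (λ i → crossing B (part i)))) ⟩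
        sum (λ i → s * crossing B (part i)) ≤⟨ sum-bound (2 * (N * N)) A-crossing ⟩
        k * (2 * (N * N)) ≡⟨ e₅ k (N * N) ⟩
        2 * k * (N * N) ∎)
        where
        e₄ : ∀ k h x → 2 * k * (4 * h * x) ≡ 8 * k * h * x
        e₄ = solve-∀
        e₅ : ∀ k n → k * (2 * n) ≡ 2 * k * n
        e₅ = solve-∀

-- Stability for a pair of graphs

Stability : ℕ → ℕ → Set
Stability k h = Σ ℕ λ S → Σ ℕ λ q → Σ ℕ λ E → Σ ℕ λ n₀ → ∀ {N} {R B : Fin N → Fin N → Bool} → n₀ ≤ N →
  BookFree R B k S q → E * clq R (suc k) (λ _ → true) ≤ N ^ suc k →
  Σ (Fin N → Fin k) λ p → (∀ i j → size p i ≤ size p j + 1) × h * mismatch R B p ≤ N * N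

stability : ∀ k h → 0 < k → 0 < h → Stability k h
stability k h k>0 h>0 = S , q + q₁ , proj₁ chained , n₀ + n₁ , λ {N} {R} {B} N-large free few →
  close {q = q + q₁} free (m≤n+m q₁ q)
    (proj₂ (proj₂ (proj₂ chained)) (≤-trans (m≤m+n n₀ n₁) N-large) (BookFree-mono (m≤m+n q q₁) free) refl (initial (proj₁ chained) few))
    (≤-trans (m≤n+m n₁ n₀) N-large)
  where
  open Parameters k h k>0 h>0
  open Choose k S k>0 S>0 4k²≤S using (chain; initial)
  chained = chain k e
  q n₀ q₁ n₁ : ℕ
  q = proj₁ (proj₂ chained)
  n₀ = proj₁ (proj₂ (proj₂ chained))
  q₁ = 3 * S * (2 * k) ^ k
  n₁ = 1 + k * S + 2 * k * (2 * b₀)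

-- Passing between tuples and subsets

clq-tuples : ∀ {N} (R : Fin N → Fin N → Bool) r X → clq R r X ≡ ΣV r (λ f → ⟦ allV X f ∧ isClique R f ⟧)
clq-tuples R zero    X = refl
clq-tuples R (suc r) X = sum-cong-≗ (λ x → trans (cong (⟦ X x ⟧ *_) (clq-tuples R r (X ∩ R x)))
  (trans (sym (ΣV-*ˡ r ⟦ X x ⟧ (λ f → ⟦ allV (X ∩ R x) f ∧ isClique R f ⟧))) (ΣV-cong r (λ f → trans (sym (⟦∧⟧ (X x) (allV (X ∩ R x) f ∧ isClique R f)))
    (cong ⟦_⟧ (trans (cong (λ b → X x ∧ b ∧ isClique R f) (allV-∩ X (R x) f)) (reassoc (X x) (allV X f) (allV (R x) f) (isClique R f))))))))
  where
  reassoc : ∀ a b c d → a ∧ (b ∧ c) ∧ d ≡ (a ∧ b) ∧ c ∧ d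
  reassoc false b     c d = refl
  reassoc true  false c d = refl
  reassoc true  true  c d = refl

-- The first vertex of a red K_{k+1} is an extension of the other k, so the count becomes a sum of
-- book sizes over red K_k.
clq-ext : ∀ {N} (R : Fin N → Fin N → Bool) k → clq R (suc k) (λ _ → true) ≡ ΣV k (λ f → ⟦ isClique R f ⟧ * ext R f)
clq-ext R k = trans (sum-cong-≗ (λ x → trans (*-identityˡ _) (clq-tuples R k (R x))))
  (trans (sym (ΣV-sum k (λ f x → ⟦ allV (R x) f ∧ isClique R f ⟧))) (ΣV-cong k (λ f →
    trans (sum-cong-≗ (λ x → trans (⟦∧⟧ (allV (R x) f) (isClique R f)) (*-comm ⟦ allV (R x) f ⟧ ⟦ isClique R f ⟧))) (sum-*ˡ ⟦ isClique R f ⟧ (λ x → ⟦ allV (R x) f ⟧)))))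

setOf : ∀ {N r} → Vec (Fin N) r → Subset N
setOf []      = ∅
setOf (x ∷ f) = setOf f [ x ]≔ true

setOf-cases : ∀ {N r} x (f : Vec (Fin N) r) i → lookup (setOf (x ∷ f)) i ≡ true → i ≡ x ⊎ lookup (setOf f) i ≡ true
setOf-cases x f i p with i ≟F x
... | yes eq = inj₁ eq
... | no neq = inj₂ (trans (sym (lookup∘update′ neq (setOf f) true)) p)

setOf-elim : ∀ {N r} (X : VSet N) (f : Vec (Fin N) r) → allV X f ≡ true → lookup (setOf f) ⊆ X
setOf-elim X [] _ i p = false≢true (lookup-replicate i false) p
setOf-elim X (x ∷ f) a i p with setOf-cases x f i p
... | inj₁ refl = proj₁ (∧-true a)
... | inj₂ q    = setOf-elim X f (proj₂ (∧-true {X x} a)) i q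

allV-mono : ∀ {N r} {X Y : VSet N} → X ⊆ Y → (f : Vec (Fin N) r) → allV X f ≡ true → allV Y f ≡ true
allV-mono h [] _ = refl
allV-mono {X = X} h (x ∷ f) p = ∧-intro (h x (proj₁ (∧-true p))) (allV-mono h f (proj₂ (∧-true {X x} p)))

allV-setOf : ∀ {N r} (f : Vec (Fin N) r) → allV (lookup (setOf f)) f ≡ true
allV-setOf [] = refl
allV-setOf (x ∷ f) = ∧-intro (lookup∘update x (setOf f) true) (allV-mono grow f (allV-setOf f))
  where
  grow : lookup (setOf f) ⊆ lookup (setOf (x ∷ f))
  grow i p with i ≟F x
  ... | yes refl = lookup∘update x (setOf f) true
  ... | no neq   = trans (lookup∘update′ neq (setOf f) true) p

∣insert∣ : ∀ {n} (S : Subset n) x → lookup S x ≡ false → ∣ S [ x ]≔ true ∣ ≡ suc ∣ S ∣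
∣insert∣ (false ∷ S) Fin.zero    _ = refl
∣insert∣ (false ∷ S) (Fin.suc x) p = ∣insert∣ S x p
∣insert∣ (true ∷ S)  (Fin.suc x) p = cong suc (∣insert∣ S x p)

∣∅∣ : ∀ n → ∣ ∅ {n} ∣ ≡ 0
∣∅∣ zero    = refl
∣∅∣ (suc n) = ∣∅∣ n

#-lookup : ∀ {n} (S : Subset n) → # (lookup S) ≡ ∣ S ∣
#-lookup []          = refl
#-lookup (false ∷ S) = #-lookup S
#-lookup (true ∷ S)  = cong suc (#-lookup S)

countFin-# : ∀ {n} (f : Fin n → Bool) → countFin f ≡ # f
countFin-# {zero}  f = refl
countFin-# {suc n} f = cong (⟦ f Fin.zero ⟧ +_) (countFin-# (f ∘ Fin.suc))

sumFin-sum : ∀ {n} (f : Fin n → ℕ) → sumFin f ≡ sum f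
sumFin-sum {zero}  f = refl
sumFin-sum {suc n} f = cong (f Fin.zero +_) (sumFin-sum (f ∘ Fin.suc))

allFin-intro : ∀ {n} (f : Fin n → Bool) → (∀ i → f i ≡ true) → allFin f ≡ true
allFin-intro {zero}  f h = refl
allFin-intro {suc n} f h = ∧-intro (h Fin.zero) (allFin-intro (f ∘ Fin.suc) (h ∘ Fin.suc))

allSubsets-complete : ∀ {n} (S : Subset n) → S ∈ₗ allSubsets n
allSubsets-complete [] = here refl
allSubsets-complete {suc n} (true ∷ S)  = ∈-++⁺ˡ (∈-map⁺ (true ∷_) (allSubsets-complete S))
allSubsets-complete {suc n} (false ∷ S) = ∈-++⁺ʳ (map (true ∷_) (allSubsets n)) (∈-map⁺ (false ∷_) (allSubsets-complete S))

module _ {N : ℕ} (P : Subset N → Bool) where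

  hits : List (Subset N) → ∀ {r} → Vec (Fin N) r → ℕ
  hits []      f = 0
  hits (Q ∷ L) f = ⟦ P Q ∧ allV (lookup Q) f ⟧ + hits L f

  hits-∈ : ∀ {Q L r} (f : Vec (Fin N) r) → Q ∈ₗ L → P Q ≡ true → allV (lookup Q) f ≡ true → 1 ≤ hits L f
  hits-∈ {Q} f (here refl) p a = ≤-trans (≤-reflexive (cong ⟦_⟧ (sym (∧-intro p a)))) (m≤m+n ⟦ P Q ∧ allV (lookup Q) f ⟧ _)
  hits-∈ {L = Q ∷ L} f (there i) p a = ≤-trans (hits-∈ f i p a) (m≤n+m (hits L f) ⟦ P Q ∧ allV (lookup Q) f ⟧)

  -- A set of k vertices contains k ^ k tuples of length k. Allowing repeated entries costs only a
  -- constant factor compared with k!.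
  count-hits : ∀ k → (∀ Q → P Q ≡ true → ∣ Q ∣ ≡ k) → ∀ L → ΣV k (hits L) ≤ k ^ k * length (filterᵇ P L)
  count-hits k card [] = ≤-trans (≤-reflexive (trans (ΣV-*ˡ k 0 (λ f → 0)) refl)) z≤n
  count-hits k card (Q ∷ L) = ≤-trans (≤-reflexive (ΣV-+ k (λ f → ⟦ P Q ∧ allV (lookup Q) f ⟧) (hits L))) (byCase (P Q) refl)
    where
    byCase : ∀ b → P Q ≡ b → ΣV k (λ f → ⟦ P Q ∧ allV (lookup Q) f ⟧) + ΣV k (hits L) ≤ k ^ k * length (filterᵇ P (Q ∷ L))
    byCase false eq rewrite eq = ≤-trans (≤-reflexive (cong (_+ ΣV k (hits L)) (ΣV-*ˡ k 0 (λ f → 0)))) (count-hits k card L)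
    byCase true eq rewrite eq = ≤-trans (+-mono-≤ (≤-reflexive (trans (count-allV k (lookup Q)) (cong (_^ k) (trans (#-lookup Q) (card Q eq))))) (count-hits k card L))
      (≤-reflexive (sym (*-suc (k ^ k) (length (filterᵇ P L)))))

  count-tuples : ∀ k → (∀ Q → P Q ≡ true → ∣ Q ∣ ≡ k) → ΣV k (λ f → ⟦ P (setOf f) ⟧) ≤ k ^ k * length (filterᵇ P (allSubsets N))
  count-tuples k card = ≤-trans (ΣV-mono k (λ f → point f (P (setOf f)) refl)) (count-hits k card (allSubsets N))
    where
    point : ∀ f b → P (setOf f) ≡ b → ⟦ b ⟧ ≤ hits (allSubsets N) f
    point f false _  = z≤n
    point f true  eq = hits-∈ f (allSubsets-complete (setOf f)) eq (allV-setOf f)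

-- Rationals

ℕtoℚᵘ : ∀ n → toℚᵘ (ℕtoℚ n) ℚᵘ.≃ ℚᵘ.mkℚᵘ (⁺ n) 0
ℕtoℚᵘ n = ℚ.toℚᵘ-fromℚᵘ (ℚᵘ.mkℚᵘ (⁺ n) 0)

ℕtoℚ-mono : ∀ {m n} → m ≤ n → ℕtoℚ m ℚ.≤ ℕtoℚ n
ℕtoℚ-mono {m} {n} m≤n = ℚ.toℚᵘ-cancel-≤ (begin
  toℚᵘ (ℕtoℚ m)      ≃⟨ ℕtoℚᵘ m ⟩
  ℚᵘ.mkℚᵘ (⁺ m) 0    ≤⟨ ℚᵘ.*≤* (ℤ.*-monoʳ-≤-nonNeg (⁺ 1) (ℤ.+≤+ m≤n)) ⟩
  ℚᵘ.mkℚᵘ (⁺ n) 0    ≃⟨ ℕtoℚᵘ n ⟨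
  toℚᵘ (ℕtoℚ n)      ∎)
  where open ℚᵘ.≤-Reasoning

ℕtoℚ-cancel : ∀ {m n} → ℕtoℚ m ℚ.≤ ℕtoℚ n → m ≤ n
ℕtoℚ-cancel {m} {n} p = ℤ.drop‿+≤+ (ℤ.*-cancelʳ-≤-pos (⁺ m) (⁺ n) (⁺ 1) (ℚᵘ.drop-*≤* (begin
  ℚᵘ.mkℚᵘ (⁺ m) 0    ≃⟨ ℕtoℚᵘ m ⟨
  toℚᵘ (ℕtoℚ m)      ≤⟨ ℚ.toℚᵘ-mono-≤ p ⟩
  toℚᵘ (ℕtoℚ n)      ≃⟨ ℕtoℚᵘ n ⟩
  ℚᵘ.mkℚᵘ (⁺ n) 0    ∎)))
  where open ℚᵘ.≤-Reasoning

ℕtoℚ-+ : ∀ m n → ℕtoℚ (m + n) ≡ ℕtoℚ m ℚ.+ ℕtoℚ n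
ℕtoℚ-+ m n = ℚ.toℚᵘ-injective (begin-equality
  toℚᵘ (ℕtoℚ (m + n))                       ≃⟨ ℕtoℚᵘ (m + n) ⟩
  ℚᵘ.mkℚᵘ (⁺ (m + n)) 0                     ≃⟨ ℚᵘ.*≡* (cong (ℤ._* ⁺ 1) (sym (cong₂ ℤ._+_ (ℤ.*-identityʳ (⁺ m)) (ℤ.*-identityʳ (⁺ n))))) ⟩
  ℚᵘ.mkℚᵘ (⁺ m) 0 ℚᵘ.+ ℚᵘ.mkℚᵘ (⁺ n) 0      ≃⟨ ℚᵘ.+-cong (ℕtoℚᵘ m) (ℕtoℚᵘ n) ⟨
  toℚᵘ (ℕtoℚ m) ℚᵘ.+ toℚᵘ (ℕtoℚ n)          ≃⟨ ℚ.toℚᵘ-homo-+ (ℕtoℚ m) (ℕtoℚ n) ⟨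
  toℚᵘ (ℕtoℚ m ℚ.+ ℕtoℚ n)                  ∎)
  where open ℚᵘ.≤-Reasoning

ℕtoℚ-* : ∀ m n → ℕtoℚ (m * n) ≡ ℕtoℚ m ℚ.* ℕtoℚ n
ℕtoℚ-* m n = ℚ.toℚᵘ-injective (begin-equality
  toℚᵘ (ℕtoℚ (m * n))                       ≃⟨ ℕtoℚᵘ (m * n) ⟩
  ℚᵘ.mkℚᵘ (⁺ (m * n)) 0                     ≃⟨ ℚᵘ.*≡* (cong (ℤ._* ⁺ 1) (ℤ.pos-* m n)) ⟩
  ℚᵘ.mkℚᵘ (⁺ m) 0 ℚᵘ.* ℚᵘ.mkℚᵘ (⁺ n) 0      ≃⟨ ℚᵘ.*-cong (ℕtoℚᵘ m) (ℕtoℚᵘ n) ⟨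
  toℚᵘ (ℕtoℚ m) ℚᵘ.* toℚᵘ (ℕtoℚ n)          ≃⟨ ℚ.toℚᵘ-homo-* (ℕtoℚ m) (ℕtoℚ n) ⟨
  toℚᵘ (ℕtoℚ m ℚ.* ℕtoℚ n)                  ∎)
  where open ℚᵘ.≤-Reasoning

ℕtoℚ-nonNeg : ∀ n → ℚ.NonNegative (ℕtoℚ n)
ℕtoℚ-nonNeg n = ℚ.normalize-nonNeg n 1

unit : ℕ → ℚ
unit g = ⁺ 1 ℚ./ suc g

suc*unit : ∀ g → ℕtoℚ (suc g) ℚ.* unit g ≡ 1ℚ
suc*unit g = ℚ.toℚᵘ-injective (begin-equality
  toℚᵘ (ℕtoℚ (suc g) ℚ.* unit g)              ≃⟨ ℚ.toℚᵘ-homo-* (ℕtoℚ (suc g)) (unit g) ⟩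
  toℚᵘ (ℕtoℚ (suc g)) ℚᵘ.* toℚᵘ (unit g)      ≃⟨ ℚᵘ.*-cong (ℕtoℚᵘ (suc g)) (ℚ.toℚᵘ-fromℚᵘ (ℚᵘ.mkℚᵘ (⁺ 1) g)) ⟩
  ℚᵘ.mkℚᵘ (⁺ suc g) 0 ℚᵘ.* ℚᵘ.mkℚᵘ (⁺ 1) g    ≃⟨ ℚᵘ.*≡* (trans (ℤ.*-identityʳ _) (trans (ℤ.*-identityʳ (⁺ suc g)) (sym (trans (ℤ.*-identityˡ _) (ℤ.*-identityˡ (⁺ suc g)))))) ⟩
  toℚᵘ 1ℚ                                     ∎)
  where open ℚᵘ.≤-Reasoning

0<unit : ∀ g → 0ℚ ℚ.< unit g
0<unit g = ℚ.positive⁻¹ (unit g) {{ℚ.normalize-pos 1 (suc g)}}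

unit<1 : ∀ g → unit (suc g) ℚ.< 1ℚ
unit<1 g = ℚ.toℚᵘ-cancel-< (begin-strict
  toℚᵘ (unit (suc g))       ≃⟨ ℚ.toℚᵘ-fromℚᵘ (ℚᵘ.mkℚᵘ (⁺ 1) (suc g)) ⟩
  ℚᵘ.mkℚᵘ (⁺ 1) (suc g)     <⟨ ℚᵘ.*<* (ℤ.+<+ (s≤s (s≤s z≤n))) ⟩
  toℚᵘ 1ℚ                   ∎)
  where open ℚᵘ.≤-Reasoning

clear-denominator : ∀ M C {q} {x n} → ℕtoℚ M ℚ.* q ≡ ℕtoℚ C → ℕtoℚ x ℚ.≤ q ℚ.* ℕtoℚ n → M * x ≤ C * n
clear-denominator M C {q} {x} {n} eq p = ℕtoℚ-cancel (begin
  ℕtoℚ (M * x)                    ≡⟨ ℕtoℚ-* M x ⟩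
  ℕtoℚ M ℚ.* ℕtoℚ x               ≤⟨ ℚ.*-monoˡ-≤-nonNeg (ℕtoℚ M) {{ℕtoℚ-nonNeg M}} p ⟩
  ℕtoℚ M ℚ.* (q ℚ.* ℕtoℚ n)       ≡⟨ ℚ.*-assoc (ℕtoℚ M) q (ℕtoℚ n) ⟨
  ℕtoℚ M ℚ.* q ℚ.* ℕtoℚ n         ≡⟨ cong (ℚ._* ℕtoℚ n) eq ⟩
  ℕtoℚ C ℚ.* ℕtoℚ n               ≡⟨ ℕtoℚ-* C n ⟨
  ℕtoℚ (C * n)                    ∎)
  where open ℚ.≤-Reasoning

-- For c = C / G and γ = 1 / G, with G = suc g, the extension threshold is c/k + γ = (C + k) / (kG),
-- k standing for `suc k`. Red cliques use c = γ and C = 1, blue ones c = 1 and C = G.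
clear-sum : ∀ k g c C → ℕtoℚ (suc g) ℚ.* c ≡ ℕtoℚ C → ℕtoℚ (suc k * suc g) ℚ.* (c ℚ.* unit k ℚ.+ unit g) ≡ ℕtoℚ (C + suc k)
clear-sum k g c C eq = begin
  ℕtoℚ (suc k * suc g) ℚ.* (c ℚ.* α ℚ.+ γ) ≡⟨ cong (ℚ._* (c ℚ.* α ℚ.+ γ)) (ℕtoℚ-* (suc k) (suc g)) ⟩
  K ℚ.* G ℚ.* (c ℚ.* α ℚ.+ γ) ≡⟨ solve 5 (λ K G c α γ → K :* G :* (c :* α :+ γ) := K :* α :* (G :* c) :+ G :* γ :* K) refl K G c α γ ⟩
  K ℚ.* α ℚ.* (G ℚ.* c) ℚ.+ G ℚ.* γ ℚ.* K ≡⟨ cong₂ ℚ._+_ (cong₂ ℚ._*_ (suc*unit k) eq) (cong (ℚ._* K) (suc*unit g)) ⟩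
  1ℚ ℚ.* ℕtoℚ C ℚ.+ 1ℚ ℚ.* K ≡⟨ cong₂ ℚ._+_ (ℚ.*-identityˡ (ℕtoℚ C)) (ℚ.*-identityˡ K) ⟩
  ℕtoℚ C ℚ.+ K ≡⟨ ℕtoℚ-+ C (suc k) ⟨
  ℕtoℚ (C + suc k) ∎
  where
  open ≡-Reasoning
  open +-*-Solver
  K G α γ : ℚ
  K = ℕtoℚ (suc k)
  G = ℕtoℚ (suc g)
  α = unit k
  γ = unit g

archimedean : ∀ θ → 0ℚ ℚ.< θ → Σ ℕ λ h → 0 < h × 1ℚ ℚ.≤ ℕtoℚ h ℚ.* θ
archimedean (mkℚ (⁺ 0) d co) (ℚ.*<* (ℤ.+<+ ()))
archimedean (mkℚ -[1+ a ] d co) (ℚ.*<* ())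
-- The denominator of θ is a witness, since its product with θ is the positive integer a + 1.
archimedean θ@(mkℚ +[1+ a ] d co) _ = suc d , s≤s z≤n , ℚ.toℚᵘ-cancel-≤ (begin
  toℚᵘ 1ℚ                                          ≤⟨ ℚᵘ.*≤* (ℤ.+≤+ (≤-trans (≤-reflexive (e₁ d)) (≤-trans (*-monoʳ-≤ (suc d) (s≤s (z≤n {a}))) (≤-reflexive (e₂ d a))))) ⟩
  ℚᵘ.mkℚᵘ (⁺ suc d) 0 ℚᵘ.* ℚᵘ.mkℚᵘ +[1+ a ] d      ≃⟨ ℚᵘ.*-congʳ (ℕtoℚᵘ (suc d)) ⟨
  toℚᵘ (ℕtoℚ (suc d)) ℚᵘ.* toℚᵘ θ                  ≃⟨ ℚ.toℚᵘ-homo-* (ℕtoℚ (suc d)) θ ⟨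
  toℚᵘ (ℕtoℚ (suc d) ℚ.* θ)                        ∎)
  where
  open ℚᵘ.≤-Reasoning
  e₁ : ∀ d → suc (d + 0 + 0) ≡ suc d * 1
  e₁ = solve-∀
  e₂ : ∀ d a → suc d * suc a ≡ suc ((a + d * suc a) * 1)
  e₂ = solve-∀

-- Monochromatic cliques of a colouring

-- The diagonal of χ is arbitrary and is discarded in both colours. A clique tuple then has distinct
-- entries, which is what identifies it with a k-set.
adj : ∀ {N} → Colouring N → Bool → Fin N → Fin N → Bool
adj χ b i j = not (i ≡ᶠ j) ∧ (χ i j ==ᵇ b)

≡ᶠ-sym : ∀ {n} (i j : Fin n) → (i ≡ᶠ j) ≡ (j ≡ᶠ i)
≡ᶠ-sym i j with i ≟F j | j ≟F i
... | yes _    | yes _  = refl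
... | no _     | no _   = refl
... | yes refl | no ¬p  = ⊥-elim (¬p refl)
... | no ¬p    | yes refl = ⊥-elim (¬p refl)

T⇒true : ∀ {b} → IsTrue b → b ≡ true
T⇒true {true} _ = refl

true⇒T : ∀ {b} → b ≡ true → IsTrue b
true⇒T refl = _

≤ᵇ-mono : ∀ t {m n} → m ≤ n → (t ≤ᵇ ℕtoℚ m) ≡ true → (t ≤ᵇ ℕtoℚ n) ≡ true
≤ᵇ-mono t {m} {n} m≤n p = T⇒true (ℚ.≤⇒≤ᵇ {t} {ℕtoℚ n} (ℚ.≤-trans (ℚ.≤ᵇ⇒≤ {t} {ℕtoℚ m} (true⇒T p)) (ℕtoℚ-mono m≤n)))

≤ᵇ-false : ∀ t x → (t ≤ᵇ x) ≡ false → x ℚ.≤ t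
≤ᵇ-false t x p = ℚ.<⇒≤ (ℚ.≰⇒> (λ q → false≢true p (T⇒true (ℚ.≤⇒≤ᵇ {t} {x} q))))

≡ᵇ-refl : ∀ n → (n ≡ᵇ n) ≡ true
≡ᵇ-refl zero    = refl
≡ᵇ-refl (suc n) = ≡ᵇ-refl n

module _ {N : ℕ} (χ : Colouring N) (χ-sym : Symmetric χ) (b : Bool) where

  adj-sym : ∀ i j → adj χ b i j ≡ adj χ b j i
  adj-sym i j with i ≟F j | j ≟F i
  ... | yes _    | yes _  = refl
  ... | yes refl | no ¬p  = ⊥-elim (¬p refl)
  ... | no ¬p    | yes refl = ⊥-elim (¬p refl)
  ... | no ¬p    | no _   = cong (_==ᵇ b) (χ-sym i j ¬p)

  adj-irrefl : ∀ i → adj χ b i i ≡ false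
  adj-irrefl i rewrite ≡ᶠ-refl i = refl

  fresh : ∀ {r} x (f : Vec (Fin N) r) → allV (adj χ b x) f ≡ true → lookup (setOf f) x ≡ false
  fresh x f a with lookup (setOf f) x in eq
  ... | false = refl
  ... | true  = false≢true (adj-irrefl x) (setOf-elim (adj χ b x) f a x eq)

  clique-card : ∀ {r} (f : Vec (Fin N) r) → isClique (adj χ b) f ≡ true → ∣ setOf f ∣ ≡ r
  clique-card []      _ = ∣∅∣ N
  clique-card (x ∷ f) c = trans (∣insert∣ (setOf f) x (fresh x f (proj₁ (∧-true c)))) (cong suc (clique-card f (proj₂ (∧-true {allV (adj χ b x) f} c))))

  clique-pairs : ∀ {r} (f : Vec (Fin N) r) → isClique (adj χ b) f ≡ true → ∀ i j → lookup (setOf f) i ≡ true → lookup (setOf f) j ≡ true → i ≢ j → adj χ b i j ≡ true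
  clique-pairs [] _ i j p _ _ = false≢true (lookup-replicate i false) p
  clique-pairs (x ∷ f) c i j p q i≢j with setOf-cases x f i p | setOf-cases x f j q
  ... | inj₁ refl | inj₁ refl = ⊥-elim (i≢j refl)
  ... | inj₁ refl | inj₂ q′   = setOf-elim (adj χ b x) f (proj₁ (∧-true c)) j q′
  ... | inj₂ p′   | inj₁ refl = trans (adj-sym i x) (setOf-elim (adj χ b x) f (proj₁ (∧-true c)) i p′)
  ... | inj₂ p′   | inj₂ q′   = clique-pairs f (proj₂ (∧-true {allV (adj χ b x) f} c)) i j p′ q′ i≢j

  setOf-isMonoClique : ∀ {r} (f : Vec (Fin N) r) → isClique (adj χ b) f ≡ true → isMonoClique χ b r (setOf f) ≡ true
  setOf-isMonoClique {r} f c = ∧-intro (trans (cong (_≡ᵇ r) (clique-card f c)) (≡ᵇ-refl r)) (allFin-intro _ (λ i → allFin-intro _ (λ j → edge i j (lookup (setOf f) i) (lookup (setOf f) j) (i ≡ᶠ j) refl refl refl)))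
    where
    edge : ∀ i j p q e → lookup (setOf f) i ≡ p → lookup (setOf f) j ≡ q → (i ≡ᶠ j) ≡ e → ((p ∧ q ∧ not e) ⇒ᵇ (χ i j ==ᵇ b)) ≡ true
    edge i j false q     e     _ _ _ = refl
    edge i j true  false e     _ _ _ = refl
    edge i j true  true  true  _ _ _ = refl
    edge i j true  true  false p q e = proj₂ (∧-true {not (i ≡ᶠ j)} (clique-pairs f c i j p q (⌊⌋-false (i ≟F j) e)))

  ext≤extensions : ∀ {r} (f : Vec (Fin N) r) → ext (adj χ b) f ≤ extensions χ b (setOf f)
  ext≤extensions f = ≤-trans (#-mono {A = λ u → allV (adj χ b u) f} {λ u → not (lookup (setOf f) u) ∧ allFin (λ v → lookup (setOf f) v ⇒ᵇ (χ u v ==ᵇ b))} extends) (≤-reflexive (sym (countFin-# (λ u → not (lookup (setOf f) u) ∧ allFin (λ v → lookup (setOf f) v ⇒ᵇ (χ u v ==ᵇ b))))))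
    where
    extends : ∀ u → allV (adj χ b u) f ≡ true → not (lookup (setOf f) u) ∧ allFin (λ v → lookup (setOf f) v ⇒ᵇ (χ u v ==ᵇ b)) ≡ true
    extends u a = ∧-intro (cong not (fresh u f a)) (allFin-intro _ (λ v → edge v (lookup (setOf f) v) refl))
      where
      edge : ∀ v p → lookup (setOf f) v ≡ p → (p ⇒ᵇ (χ u v ==ᵇ b)) ≡ true
      edge v false _ = refl
      edge v true  p = proj₂ (∧-true {not (u ≡ᶠ v)} (setOf-elim (adj χ b u) f a v p))

  -- Each rich clique tuple is carried to its underlying set, a rich clique of the colouring, and a
  -- k-set is hit by at most k ^ k tuples.
  richTuples≤ : ∀ k t → richCliques (adj χ b) k (λ f → t ≤ᵇ ℕtoℚ (ext (adj χ b) f)) ≤ k ^ k * numRichCliques χ b k t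
  richTuples≤ k t = ≤-trans (ΣV-mono k (λ f → ⟦⟧-mono (rich f))) (count-tuples P k card)
    where
    P : Subset N → Bool
    P Q = isMonoClique χ b k Q ∧ (t ≤ᵇ ℕtoℚ (extensions χ b Q))
    rich : ∀ f → isClique (adj χ b) f ∧ (t ≤ᵇ ℕtoℚ (ext (adj χ b) f)) ≡ true → P (setOf f) ≡ true
    rich f p = ∧-intro (setOf-isMonoClique f (proj₁ (∧-true p))) (≤ᵇ-mono t (ext≤extensions f) (proj₂ (∧-true {isClique (adj χ b) f} p)))
    card : ∀ Q → P Q ≡ true → ∣ Q ∣ ≡ k
    card Q p = ≡ᵇ⇒≡ ∣ Q ∣ k (true⇒T (proj₁ (∧-true (proj₁ (∧-true p)))))

-- Consequences of the failure of (i) and (ii)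

ΣV-const : ∀ {N} r c → ΣV {N} r (λ _ → c) ≡ N ^ r * c
ΣV-const zero c = sym (*-identityˡ c)
ΣV-const {N} (suc r) c = trans (sum-cong-≗ {N} (λ _ → ΣV-const r c)) (trans (sum-const N (N ^ r * c)) (sym (*-assoc N (N ^ r) c)))

-- A rich K_k has at most N extensions, but rich ones number at most k^k N^k / G; a poor one has at
-- most 2N / G, and there are at most N^k of them. Together this gives at most (k^k + 2) N^{k+1} / G
-- copies of K_{k+1}.
few-cliques : ∀ {N} (R : Fin N → Fin N → Bool) k G E (rich : Vec (Fin N) k → Bool) → 0 < G → (∀ f → rich f ≡ false → G * ext R f ≤ 2 * N) →
  G * richCliques R k rich ≤ k ^ k * N ^ k → E * (k ^ k + 2) ≤ G → E * clq R (suc k) (λ _ → true) ≤ N ^ suc k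
few-cliques {N} R k G E rich G>0 poor few E≤ = *-cancelˡ-≤′ (k ^ k + 2) (≤-trans (s≤s z≤n) (m≤n+m 2 (k ^ k))) (begin
  (k ^ k + 2) * (E * C) ≡⟨ e₁ (k ^ k + 2) E C ⟩
  E * (k ^ k + 2) * C ≤⟨ *-monoˡ-≤ C E≤ ⟩
  G * C ≡⟨ trans (cong (G *_) (clq-ext R k)) (sym (ΣV-*ˡ k G (λ f → ⟦ isClique R f ⟧ * ext R f))) ⟩
  ΣV k (λ f → G * (⟦ isClique R f ⟧ * ext R f)) ≤⟨ ΣV-mono k pointwise ⟩
  ΣV k (λ f → G * N * ⟦ isClique R f ∧ rich f ⟧ + 2 * N) ≡⟨ trans (ΣV-+ k (λ f → G * N * ⟦ isClique R f ∧ rich f ⟧) (λ _ → 2 * N)) (cong₂ _+_ (ΣV-*ˡ k (G * N) (λ f → ⟦ isClique R f ∧ rich f ⟧)) (ΣV-const k (2 * N))) ⟩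
  G * N * richCliques R k rich + N ^ k * (2 * N) ≡⟨ e₂ G N (richCliques R k rich) (N ^ k) ⟩
  N * (G * richCliques R k rich) + 2 * (N * N ^ k) ≤⟨ +-monoˡ-≤ (2 * (N * N ^ k)) (*-monoʳ-≤ N few) ⟩
  N * (k ^ k * N ^ k) + 2 * (N * N ^ k) ≡⟨ e₃ N (k ^ k) (N ^ k) ⟩
  (k ^ k + 2) * (N * N ^ k) ∎)
  where
  open ≤-Reasoning
  C : ℕ
  C = clq R (suc k) (λ _ → true)
  e₁ : ∀ p E C → p * (E * C) ≡ E * p * C
  e₁ = solve-∀
  e₂ : ∀ G N ρ p → G * N * ρ + p * (2 * N) ≡ N * (G * ρ) + 2 * (N * p)
  e₂ = solve-∀
  e₃ : ∀ N p n → N * (p * n) + 2 * (N * n) ≡ (p + 2) * (N * n)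
  e₃ = solve-∀
  pointwise : ∀ f → G * (⟦ isClique R f ⟧ * ext R f) ≤ G * N * ⟦ isClique R f ∧ rich f ⟧ + 2 * N
  pointwise f = byCase (isClique R f) (rich f) refl
    where
    byCase : ∀ c r → rich f ≡ r → G * (⟦ c ⟧ * ext R f) ≤ G * N * ⟦ c ∧ r ⟧ + 2 * N
    byCase false r _ = ≤-trans (≤-reflexive (*-zeroʳ G)) z≤n
    byCase true true _ = ≤-trans (≤-trans (*-monoʳ-≤ G (≤-trans (≤-reflexive (*-identityˡ (ext R f))) (#≤N (λ u → allV (R u) f)))) (≤-reflexive (sym (*-identityʳ (G * N))))) (m≤m+n (G * N * 1) (2 * N))
    byCase true false eq = ≤-trans (≤-trans (*-monoʳ-≤ G (≤-reflexive (*-identityˡ (ext R f)))) (poor f eq)) (m≤n+m (2 * N) (G * N * 0))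

numDiffEdges≤mismatch : ∀ {N k} (χ : Colouring N) (p : Fin N → Fin k) → numDiffEdges χ (λ i j → not (p i ≡ᶠ p j)) ≤ mismatch (adj χ red) (adj χ blue) p
numDiffEdges≤mismatch χ p = ≤-trans (≤-reflexive (trans (sumFin-sum (λ i → countFin (differ i))) (sum-cong-≗ (λ i → countFin-# (differ i))))) (sum-mono (λ i → sum-mono (λ j → pair i j)))
  where
  differ : ∀ i j → Bool
  differ i j = ⌊ toℕ i <? toℕ j ⌋ ∧ not (χ i j ==ᵇ not (p i ≡ᶠ p j))
  pair : ∀ i j → ⟦ ⌊ toℕ i <? toℕ j ⌋ ∧ not (χ i j ==ᵇ not (p i ≡ᶠ p j)) ⟧ ≤ ⟦ (p i ≡ᶠ p j) ∧ adj χ red i j ⟧ + ⟦ not (p i ≡ᶠ p j) ∧ adj χ blue i j ⟧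
  pair i j with toℕ i <? toℕ j | i ≟F j
  ... | no _  | _ = z≤n
  ... | yes q | yes refl = ⊥-elim (<-irrefl refl q)
  ... | yes q | no _ with χ i j | p i ≡ᶠ p j
  ... | true  | true  = ≤-refl
  ... | true  | false = ≤-refl
  ... | false | true  = ≤-refl
  ... | false | false = ≤-refl

-- Both sides are book thresholds: 1/k + 1/G in the hypothesis and 1/k + 1/(3S), the one of
-- `BookFree`, in the conclusion.
scale-threshold : ∀ k S G x N → 0 < G → 3 * S ≤ G → k * G * x ≤ (G + k) * N → 3 * k * S * x ≤ (3 * S + k) * N
scale-threshold k S G x N G>0 S≤ p = *-cancelˡ-≤′ G G>0 (≤-by (+-mono-≤ (*-monoʳ-≤ (3 * S) p) (*-monoʳ-≤ (k * N) S≤)) (≤-reflexive (e₁ k S G x N)))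
  where
  e₁ : ∀ k S G x N → G * (3 * k * S * x) + (3 * S * ((G + k) * N) + k * N * G) ≡ G * ((3 * S + k) * N) + (3 * S * (k * G * x) + k * N * (3 * S))
  e₁ = solve-∀

-- For c = γ = 1 / G the red threshold is (1 + 1 / suc k) / G, at most 2 / G.
drop-threshold : ∀ k G x N → suc k * G * x ≤ (1 + suc k) * N → G * x ≤ 2 * N
drop-threshold k G x N p = *-cancelˡ-≤′ (suc k) (s≤s z≤n) (≤-by p (≤-trans (m≤m+n _ (k * N)) (≤-reflexive (e₁ k G x N))))
  where
  e₁ : ∀ k G x N → suc k * (G * x) + (1 + suc k) * N + k * N ≡ suc k * (2 * N) + suc k * G * x
  e₁ = solve-∀

-- The dichotomy for a colouring

module Main (k₀ g : ℕ) {N : ℕ} (χ : Colouring N) (χ-sym : Symmetric χ) where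

  k G : ℕ
  k = suc k₀
  G = suc g

  γ : ℚ
  γ = unit g

  module _ (b : Bool) (c : ℚ) (C : ℕ) (Gc≡C : ℕtoℚ G ℚ.* c ≡ ℕtoℚ C) where

    t : ℚ
    t = (c ℚ.* unit k₀ ℚ.+ γ) ℚ.* ℕtoℚ N

    richTuple : Vec (Fin N) k → Bool
    richTuple f = t ≤ᵇ ℕtoℚ (ext (adj χ b) f)

    poorTuple : ∀ f → richTuple f ≡ false → k * G * ext (adj χ b) f ≤ (C + k) * N
    poorTuple f p = clear-denominator (k * G) (C + k) {c ℚ.* unit k₀ ℚ.+ γ} {ext (adj χ b) f} {N} (clear-sum k₀ g c C Gc≡C) (≤ᵇ-false t (ℕtoℚ (ext (adj χ b) f)) p)

    few-rich : ¬ (γ ℚ.* ℕtoℚ (N ^ k) ℚ.≤ ℕtoℚ (numRichCliques χ b k t)) → G * richCliques (adj χ b) k richTuple ≤ k ^ k * N ^ k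
    few-rich ¬p = begin
      G * richCliques (adj χ b) k richTuple ≤⟨ *-monoʳ-≤ G (richTuples≤ χ χ-sym b k t) ⟩
      G * (k ^ k * numRichCliques χ b k t) ≡⟨ e₁ G (k ^ k) (numRichCliques χ b k t) ⟩
      k ^ k * (G * numRichCliques χ b k t) ≤⟨ *-monoʳ-≤ (k ^ k) (clear-denominator G 1 {γ} {numRichCliques χ b k t} {N ^ k} (suc*unit g) (ℚ.<⇒≤ (ℚ.≰⇒> ¬p))) ⟩
      k ^ k * (1 * N ^ k) ≡⟨ cong (k ^ k *_) (*-identityˡ (N ^ k)) ⟩
      k ^ k * N ^ k ∎
      where
      open ≤-Reasoning
      e₁ : ∀ G p n → G * (p * n) ≡ p * (G * n)
      e₁ = solve-∀

  cover : ∀ i j → adj χ blue i j ≡ false → adj χ red i j ≡ true ⊎ i ≡ j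
  cover i j p with i ≟F j
  ... | yes eq = inj₂ eq
  ... | no _ with χ i j
  ... | true = inj₁ refl
  cover i j () | no _ | false

  γ-numerator : ℕtoℚ G ℚ.* γ ≡ ℕtoℚ 1
  γ-numerator = suc*unit g

  1-numerator : ℕtoℚ G ℚ.* 1ℚ ≡ ℕtoℚ G
  1-numerator = ℚ.*-identityʳ (ℕtoℚ G)

  bookFree : ∀ S q → 3 * S ≤ G → q * k ^ k ≤ G → ¬ (γ ℚ.* ℕtoℚ (N ^ k) ℚ.≤ ℕtoℚ (numRichCliques χ blue k (t blue 1ℚ G 1-numerator))) →
    BookFree (adj χ red) (adj χ blue) k S q
  bookFree S q S≤ q≤ ¬p = record
    { R-sym = adj-sym χ χ-sym red
    ; cover = cover
    ; rich  = richTuple blue 1ℚ G 1-numerator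
    ; poor  = λ f _ p → scale-threshold k S G (ext (adj χ blue) f) N (s≤s z≤n) S≤ (poorTuple blue 1ℚ G 1-numerator f p)
    ; few   = *-cancelˡ-≤′ (k ^ k) (0<^ k (s≤s z≤n)) (begin
        k ^ k * (q * ν) ≡⟨ e₁ (k ^ k) q ν ⟩
        q * k ^ k * ν ≤⟨ *-monoˡ-≤ ν q≤ ⟩
        G * ν ≤⟨ few-rich blue 1ℚ G 1-numerator ¬p ⟩
        k ^ k * N ^ k ∎)
    }
    where
    open ≤-Reasoning
    ν : ℕ
    ν = richCliques (adj χ blue) k (richTuple blue 1ℚ G 1-numerator)
    e₁ : ∀ p q ν → p * (q * ν) ≡ q * p * ν
    e₁ = solve-∀

  few-red : ∀ E → E * (k ^ k + 2) ≤ G → ¬ (γ ℚ.* ℕtoℚ (N ^ k) ℚ.≤ ℕtoℚ (numRichCliques χ red k (t red γ 1 γ-numerator))) →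
    E * clq (adj χ red) (suc k) (λ _ → true) ≤ N ^ suc k
  few-red E E≤ ¬p = few-cliques (adj χ red) k G E (richTuple red γ 1 γ-numerator) (s≤s z≤n)
    (λ f p → drop-threshold k₀ G (ext (adj χ red) f) N (poorTuple red γ 1 γ-numerator f p)) (few-rich red γ 1 γ-numerator ¬p) E≤

  recolour : ∀ h θ → 0ℚ ℚ.< θ → 1ℚ ℚ.≤ ℕtoℚ h ℚ.* θ → (Σ (Fin N → Fin k) λ p → (∀ i j → size p i ≤ size p j + 1) × h * mismatch (adj χ red) (adj χ blue) p ≤ N * N) →
    Σ (Colouring N) λ χ′ → Symmetric χ′ × (ℕtoℚ (numDiffEdges χ χ′) ℚ.≤ θ ℚ.* ℕtoℚ (N ^ 2)) × RedBalancedCompletePartite k χ′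
  recolour h θ θ>0 1≤hθ (p , balanced , few) = χ′ , (λ i j _ → cong not (≡ᶠ-sym (p i) (p j))) , close , p , balanced′ , λ _ _ _ → refl
    where
    χ′ : Colouring N
    χ′ i j = not (p i ≡ᶠ p j)
    d : ℕ
    d = numDiffEdges χ χ′
    balanced′ : ∀ a b → partSize p a ≤ partSize p b + 1
    balanced′ a b = ≤-trans (≤-reflexive (countFin-# (λ v → p v ≡ᶠ a))) (≤-trans (balanced a b) (≤-reflexive (cong (_+ 1) (sym (countFin-# (λ v → p v ≡ᶠ b))))))
    hd≤ : h * d ≤ N ^ 2
    hd≤ = ≤-trans (*-monoʳ-≤ h (numDiffEdges≤mismatch χ p)) (≤-trans few (≤-reflexive (cong (N *_) (sym (*-identityʳ N)))))
    θ≥0 : ℚ.NonNegative θ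
    θ≥0 = ℚ.nonNegative (ℚ.<⇒≤ θ>0)
    close : ℕtoℚ d ℚ.≤ θ ℚ.* ℕtoℚ (N ^ 2)
    close = begin
      ℕtoℚ d ≡⟨ ℚ.*-identityˡ (ℕtoℚ d) ⟨
      1ℚ ℚ.* ℕtoℚ d ≤⟨ ℚ.*-monoʳ-≤-nonNeg (ℕtoℚ d) {{ℕtoℚ-nonNeg d}} 1≤hθ ⟩
      ℕtoℚ h ℚ.* θ ℚ.* ℕtoℚ d ≡⟨ solve 3 (λ h θ d → h :* θ :* d := θ :* (h :* d)) refl (ℕtoℚ h) θ (ℕtoℚ d) ⟩
      θ ℚ.* (ℕtoℚ h ℚ.* ℕtoℚ d) ≡⟨ cong (θ ℚ.*_) (ℕtoℚ-* h d) ⟨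
      θ ℚ.* ℕtoℚ (h * d) ≤⟨ ℚ.*-monoˡ-≤-nonNeg θ {{θ≥0}} (ℕtoℚ-mono hd≤) ⟩
      θ ℚ.* ℕtoℚ (N ^ 2) ∎
      where
      open ℚ.≤-Reasoning
      open +-*-Solver

  dichotomy : ∀ h S q E θ → 0ℚ ℚ.< θ → 1ℚ ℚ.≤ ℕtoℚ h ℚ.* θ → E * (k ^ k + 2) ≤ G → q * k ^ k ≤ G → 3 * S ≤ G →
    (BookFree (adj χ red) (adj χ blue) k S q → E * clq (adj χ red) (suc k) (λ _ → true) ≤ N ^ suc k →
      Σ (Fin N → Fin k) λ p → (∀ i j → size p i ≤ size p j + 1) × h * mismatch (adj χ red) (adj χ blue) p ≤ N * N) →
    (Σ (Colouring N) λ χ′ → Symmetric χ′ × (ℕtoℚ (numDiffEdges χ χ′) ℚ.≤ θ ℚ.* ℕtoℚ (N ^ 2)) × RedBalancedCompletePartite k χ′)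
    ⊎ ((γ ℚ.* ℕtoℚ (N ^ k) ℚ.≤ ℕtoℚ (numRichCliques χ red k (t red γ 1 γ-numerator)))
    ⊎ (γ ℚ.* ℕtoℚ (N ^ k) ℚ.≤ ℕtoℚ (numRichCliques χ blue k (t blue 1ℚ G 1-numerator))))
  dichotomy h S q E θ θ>0 1≤hθ E≤ q≤ S≤ stable = orElse (_ ℚ.≤? _) (_ ℚ.≤? _)
    (λ ¬r ¬b → recolour h θ θ>0 1≤hθ (stable (bookFree S q S≤ q≤ ¬b) (few-red E E≤ ¬r)))
    where
    orElse : ∀ {A B C : Set} → Dec A → Dec B → (¬ A → ¬ B → C) → C ⊎ (A ⊎ B)
    orElse (yes a) _       f = inj₂ (inj₁ a)
    orElse (no _)  (yes b) f = inj₂ (inj₂ b)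
    orElse (no ¬a) (no ¬b) f = inj₁ (f ¬a ¬b)

Dichotomy : ℕ → ℚ → Set
Dichotomy k θ = Σ ℚ λ c → Σ ℚ λ γ → (0ℚ ℚ.< c) × (c ℚ.< 1ℚ) × (0ℚ ℚ.< γ) × (γ ℚ.< 1ℚ) ×
  Σ ℕ λ N₀ → (N : ℕ) → N ≥ N₀ → (χ : Colouring N) → Symmetric χ →
  (Σ (Colouring N) λ χ′ → Symmetric χ′ × (ℕtoℚ (numDiffEdges χ χ′) ℚ.≤ θ ℚ.* ℕtoℚ (N ^ 2)) × RedBalancedCompletePartite k χ′)
  ⊎ ((γ ℚ.* ℕtoℚ (N ^ k) ℚ.≤ ℕtoℚ (numRichCliques χ red k (((c /ℕ k) ℚ.+ γ) ℚ.* ℕtoℚ N)))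
  ⊎ (γ ℚ.* ℕtoℚ (N ^ k) ℚ.≤ ℕtoℚ (numRichCliques χ blue k (((1ℚ /ℕ k) ℚ.+ γ) ℚ.* ℕtoℚ N))))

stability⇒dichotomy : ∀ k₀ h θ → 0ℚ ℚ.< θ → 1ℚ ℚ.≤ ℕtoℚ h ℚ.* θ → Stability (suc k₀) h → Dichotomy (suc k₀) θ
-- A sum in place of a maximum: 1/γ has to exceed the bounds for rare red K_{k+1}, for few rich blue
-- K_k, and for a blue threshold of at most 1/k + 1/(3S).
stability⇒dichotomy k₀ h θ θ>0 1≤hθ (S , q , E , n₀ , stable) = choose (E * (p + 2) + q * p + 3 * S)
    (≤-trans (m≤m+n (E * (p + 2)) (q * p)) (m≤m+n (E * (p + 2) + q * p) (3 * S)))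
    (≤-trans (m≤n+m (q * p) (E * (p + 2))) (m≤m+n (E * (p + 2) + q * p) (3 * S)))
    (m≤n+m (3 * S) (E * (p + 2) + q * p))
  where
  p : ℕ
  p = suc k₀ ^ suc k₀
  choose : ∀ g → E * (p + 2) ≤ g → q * p ≤ g → 3 * S ≤ g → Dichotomy (suc k₀) θ
  -- Both c and γ are 1 / (g + 2), where the 2 keeps them strictly below 1 even for g = 0.
  choose g E≤ q≤ S≤ = unit (suc g) , unit (suc g) , 0<unit (suc g) , unit<1 g , 0<unit (suc g) , unit<1 g , n₀ , λ N N≥n₀ χ χ-sym →
      Main.dichotomy k₀ (suc g) χ χ-sym h S q E θ θ>0 1≤hθ (up E≤) (up q≤) (up S≤) (stable N≥n₀)
    where
    up : ∀ {n} → n ≤ g → n ≤ suc (suc g)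
    up n≤g = ≤-trans n≤g (≤-trans (n≤1+n g) (n≤1+n (suc g)))

theorem1p2 : (k : ℕ) → k ≥ 2 → (θ : ℚ) → 0ℚ ℚ.< θ →
    Σ ℚ λ c → Σ ℚ λ γ → (0ℚ ℚ.< c) × (c ℚ.< 1ℚ) × (0ℚ ℚ.< γ) × (γ ℚ.< 1ℚ) ×
    Σ ℕ λ N₀ → (N : ℕ) → N ≥ N₀ → (χ : Colouring N) → Symmetric χ →
    (Σ (Colouring N) λ χ' → Symmetric χ' ×
    (ℕtoℚ (numDiffEdges χ χ') ℚ.≤ θ ℚ.* ℕtoℚ (N ^ 2)) ×
    RedBalancedCompletePartite k χ')
    ⊎ ((γ ℚ.* ℕtoℚ (N ^ k) ℚ.≤ ℕtoℚ (numRichCliques χ red k (((c /ℕ k) ℚ.+ γ) ℚ.* ℕtoℚ N)))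
    ⊎ (γ ℚ.* ℕtoℚ (N ^ k) ℚ.≤ ℕtoℚ (numRichCliques χ blue k (((1ℚ /ℕ k) ℚ.+ γ) ℚ.* ℕtoℚ N))))
theorem1p2 (suc k₀) _ θ θ>0 = from (archimedean θ θ>0)
  where
  from : (Σ ℕ λ h → 0 < h × 1ℚ ℚ.≤ ℕtoℚ h ℚ.* θ) → Dichotomy (suc k₀) θ
  from (h , h>0 , 1≤hθ) = stability⇒dichotomy k₀ h θ θ>0 1≤hθ (stability (suc k₀) h (s≤s z≤n) h>0)
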